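{- Let $m\ge 3$ and $n\ge 1$ be integers. The additional closeness $A(L_{m,n})$ of the lollipop graph $L_{m,n}$ is given as follows: $$A(L_{m,1}) = \frac{m^2}{2}+1,\qquad A(L_{m,2}) = \frac{m(m+1)}{2}+2,\qquad A(L_{m,3}) = \frac{m(2m+3)}{4}+4,\qquad A(L_{m,4}) = \frac{m(m+2)}{2}+6,$$ and for $n\ge 5$ it is given by the following procedure. For integers $2\le k\le n$ put $$a(k) = (m+1-2^{k-n})\,\frac{m-1}{2} + 2(n-k) - 2 + 2^{1+k-n} + (k+m+2-2^{1+k-n})\,c(k),$$ where $c(k) = 2-3\cdot 2^{ -p}$ if $k=2p-1$ and $c(k)=2-2^{1-p}$ if $k=2p$ (this $a(k)$ is the closeness of the graph obtained from $L_{m,n}$ by adding the link $(v_m,v_{m+k})$). Let $p_1$ be the smallest integer $p>1$ with $$2p+m+1+2^{2p-n}-\left(\frac{m}{3}+1\right)2^{3p-n-1}-\frac{2}{\ln 2}<0,$$ and let $p_2$ be the smallest integer $p>1$ with $$2p+m+2+2^{1+2p-n}-(m+3)\,2^{3p-n-1}-\frac{2}{\ln 2}<0 .$$ Then, for $n\ge 5$, $$A(L_{m,n}) = \max\{\, a(k) : k\in\{2p_1-1,\ 2p_1-3,\ 2p_2,\ 2p_2-2\},\ 2\le k\le n \,\}.$$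
   Context: All graphs are finite, simple and undirected. The closeness of a graph $G$ is $C(G)=\sum_{i}\sum_{j\ne i}2^{ -d(i,j)}$, where $i,j$ range over the vertices of $G$ (ordered pairs), $d(i,j)$ is the distance between $i$ and $j$ in $G$, and the term $2^{ -d(i,j)}$ is $0$ if $i$ and $j$ lie in different connected components. The additional closeness of $G$ is $A(G)=\max_{p,q} C(G_{p,q})$, where $\{p,q\}$ ranges over the pairs of distinct non-adjacent vertices of $G$ and $G_{p,q}$ is the graph obtained from $G$ by adding the link $(p,q)$. The lollipop graph $L_{m,n}$ ($m\ge 3$, $n\ge 1$) has $m+n$ vertices $v_1,\dots,v_{m+n}$: the vertices $v_1,\dots,v_m$ form a complete graph $K_m$, the vertices $v_{m+1},\dots,v_{m+n}$ form a path $P_n$ (with links $(v_{m+i},v_{m+i+1})$, $1\le i\le n-1$), and there is one further link, the bridge $(v_m,v_{m+1})$. -}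

module Defs where

open import Data.Bool.Base using (if_then_else_)
open import Data.Empty using (⊥-elim)
open import Data.Fin.Base as Fin using (Fin; toℕ)
open import Data.Fin.Properties as Fin using (any?; pigeonhole)
open import Data.Integer.Base as ℤ using (ℤ; +_; -[1+_])
open import Data.List.Base using ([]; _∷_)
open import Data.List.Membership.Propositional using (_∈_)
open import Data.Maybe.Base as Maybe using (Maybe; just; nothing)
open import Data.Nat.Base as ℕ using (ℕ; zero; suc; z≤n; s≤s; s≤s⁻¹; ⌈_/2⌉)
import Data.Nat.Induction as ℕ
import Data.Nat.Properties as ℕ
open import Data.Nat.Divisibility using (_∣?_)
open import Data.Product.Base using (∃-syntax; Σ-syntax; _×_; _,_)
open import Data.Rational.Base
open import Data.Rational.Properties using (+-0-commutativeMonoid)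
open import Data.Sum.Base using (_⊎_; inj₁; inj₂; swap)
open import Function.Base using (_∘_)
open import Induction.WellFounded using (Acc; acc)
open import Relation.Binary.PropositionalEquality using (_≡_; _≢_; refl; sym; trans; cong; subst)
open import Relation.Nullary using (Dec; yes; no; does; ¬_)
open import Relation.Nullary.Decidable using (_×-dec_; _⊎-dec_)
open import Algebra.Properties.CommutativeMonoid.Sum +-0-commutativeMonoid public
  using (sum)

ι : ℕ → ℚ
ι n = + n / 1

infix 30 2^_

2^_ : ℤ → ℚ
2^ (+ n)    = + (2 ℕ.^ n) / 1
2^ -[1+ n ] = _/_ (+ 1) (2 ℕ.^ suc n) {{ℕ.m^n≢0 2 (suc n)}}

IsMaximum : (ℚ → Set) → ℚ → Set
IsMaximum P x = P x × (∀ y → P y → y ≤ x)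

IsSmallest : (ℕ → Set) → ℕ → Set
IsSmallest P p = P p × (∀ q → P q → p ℕ.≤ q)

-- The upper Darboux sum of ∫₁² dt/t for the partition of [1,2] into
-- N + 1 equal parts; the infimum of these sums over N is ln 2.
upperSum : ℕ → ℚ
upperSum N = sum {suc N} λ i → + 1 / (suc N ℕ.+ toℕ i)

ln2<_ : ℚ → Set
ln2< u = ∃[ N ] upperSum N < u

-- A rational x lies below the real number 2 / ln 2 exactly when
-- x * u < 2 for some rational u > ln 2.
_<2/ln2 : ℚ → Set
x <2/ln2 = ∃[ u ] (ln2< u) × x * u < ι 2

record Graph (n : ℕ) : Set₁ where
  field
    Adj     : Fin n → Fin n → Set
    adj?    : ∀ i j → Dec (Adj i j)
    adj-sym : ∀ {i j} → Adj i j → Adj j i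
    irrefl  : ∀ {i} → ¬ Adj i i

addLink : ∀ {n} → Graph n → (p q : Fin n) → p ≢ q → Graph n
addLink G p q p≢q = record
  { Adj     = λ i j → Adj i j ⊎ ((i ≡ p × j ≡ q) ⊎ (i ≡ q × j ≡ p))
  ; adj?    = λ i j → adj? i j ⊎-dec
                ((i Fin.≟ p ×-dec j Fin.≟ q) ⊎-dec (i Fin.≟ q ×-dec j Fin.≟ p))
  ; adj-sym = λ where
      (inj₁ e)                     → inj₁ (adj-sym e)
      (inj₂ (inj₁ (i≡p , j≡q)))    → inj₂ (inj₂ (j≡q , i≡p))
      (inj₂ (inj₂ (i≡q , j≡p)))    → inj₂ (inj₁ (j≡p , i≡q))
  ; irrefl  = λ where
      (inj₁ e)                     → irrefl e
      (inj₂ (inj₁ (i≡p , i≡q)))    → p≢q (trans (sym i≡p) i≡q)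
      (inj₂ (inj₂ (i≡q , i≡p)))    → p≢q (trans (sym i≡p) i≡q)
  }
  where open Graph G

firstBelow : {P : ℕ → Set} → (∀ k → Dec (P k)) → ℕ → Maybe ℕ
firstBelow P? zero    = nothing
firstBelow P? (suc b) =
  if does (P? 0) then just 0 else Maybe.map suc (firstBelow (P? ∘ suc) b)

-- The term 2^(-d) contributed by a pair at distance d; `nothing` stands
-- for vertices in different components.
weight : Maybe ℕ → ℚ
weight (just d) = 2^ (ℤ.- (+ d))
weight nothing  = 0ℚ

module _ {n : ℕ} (G : Graph n) where
  open Graph G

  Walk : ℕ → Fin n → Fin n → Set
  Walk zero    i j = i ≡ j
  Walk (suc k) i j = ∃[ l ] Adj i l × Walk k l j

  walk? : ∀ k i j → Dec (Walk k i j)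
  walk? zero    i j = i Fin.≟ j
  walk? (suc k) i j = any? λ l → adj? i l ×-dec walk? k l j

  -- Lengths below n suffice for this to be the graph distance: see
  -- dist-just and dist-nothing.
  dist : Fin n → Fin n → Maybe ℕ
  dist i j = firstBelow (λ k → walk? k i j) n

  closeness : ℚ
  closeness = sum λ i → sum λ j →
    if does (i Fin.≟ j) then 0ℚ else weight (dist i j)

IsAdditionalCloseness : ∀ {n} → Graph n → ℚ → Set
IsAdditionalCloseness {n} G = IsMaximum λ x →
  ∃[ p ] ∃[ q ] Σ[ p≢q ∈ p ≢ q ]
    ¬ Graph.Adj G p q × x ≡ closeness (addLink G p q p≢q)

firstBelow-just : {P : ℕ → Set} (P? : ∀ k → Dec (P k)) (b : ℕ) {d : ℕ} →
  firstBelow P? b ≡ just d → P d × (∀ k → P k → d ℕ.≤ k)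
firstBelow-just P? (suc b) eq with P? 0
firstBelow-just P? (suc b) refl | yes p = p , λ _ _ → z≤n
firstBelow-just {P} P? (suc b) eq | no ¬p
  with firstBelow (P? ∘ suc) b in eq′
firstBelow-just {P} P? (suc b) refl | no ¬p | just d
  with pd , least ← firstBelow-just (P? ∘ suc) b eq′ = pd , λ where
    zero    p → ⊥-elim (¬p p)
    (suc k) p → s≤s (least k p)

firstBelow-nothing : {P : ℕ → Set} (P? : ∀ k → Dec (P k)) (b : ℕ) →
  firstBelow P? b ≡ nothing → ∀ k → k ℕ.< b → ¬ P k
firstBelow-nothing P? (suc b) eq k k<b p with P? 0
firstBelow-nothing P? (suc b) () k k<b p | yes _
firstBelow-nothing P? (suc b) eq k k<b p | no ¬p
  with firstBelow (P? ∘ suc) b in eq′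
firstBelow-nothing P? (suc b) eq zero    k<b p | no ¬p | nothing = ¬p p
firstBelow-nothing P? (suc b) eq (suc k) k<b p | no ¬p | nothing =
  firstBelow-nothing (P? ∘ suc) b eq′ k (s≤s⁻¹ k<b) p

module _ {n : ℕ} (G : Graph n) where
  open Graph G

  private
    at : ∀ k {i j} → Walk G k i j → Fin (suc k) → Fin n
    at k       {i} w           Fin.zero    = i
    at (suc k)     (_ , _ , w) (Fin.suc a) = at k w a

    take : ∀ k {i j} (w : Walk G k i j) a → Walk G (toℕ a) i (at k w a)
    take k       w           Fin.zero    = refl
    take (suc k) (l , e , w) (Fin.suc a) = l , e , take k w a

    drop : ∀ k {i j} (w : Walk G k i j) a →
      ∃[ s ] toℕ a ℕ.+ s ≡ k × Walk G s (at k w a) j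
    drop k       w           Fin.zero    = k , refl , w
    drop (suc k) (l , e , w) (Fin.suc a)
      with s , eq , v ← drop k w a = s , cong suc eq , v

    append : ∀ k {s i l j} → Walk G k i l → Walk G s l j → Walk G (k ℕ.+ s) i j
    append zero    refl        v = v
    append (suc k) (l , e , w) v = l , e , append k w v

    shorten : ∀ k → Acc ℕ._<_ k → ∀ {i j} → Walk G k i j →
      ∃[ l ] l ℕ.< n × Walk G l i j
    shorten k (acc rec) {i} {j} w with k ℕ.<? n
    ... | yes k<n = k , k<n , w
    ... | no  k≮n
      with a , b , a<b , eq ← pigeonhole (s≤s (ℕ.≮⇒≥ k≮n)) (at k w)
      with s , b+s≡k , v ← drop k w b =
      shorten (toℕ a ℕ.+ s)
        (rec (subst (toℕ a ℕ.+ s ℕ.<_) b+s≡k (ℕ.+-monoˡ-< s a<b)))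
        (append (toℕ a) (take k w a) (subst (λ x → Walk G s x j) (sym eq) v))

  dist-just : ∀ {i j d} → dist G i j ≡ just d →
    Walk G d i j × (∀ k → Walk G k i j → d ℕ.≤ k)
  dist-just {i} {j} = firstBelow-just (λ k → walk? G k i j) n

  dist-nothing : ∀ {i j} → dist G i j ≡ nothing → ∀ k → ¬ Walk G k i j
  dist-nothing {i} {j} eq k w
    with l , l<n , v ← shorten k (ℕ.<-wellFounded k) w =
    firstBelow-nothing (λ k → walk? G k i j) n eq l l<n v

-- The vertex v_x is the i with label i ≡ x.
label : ∀ {N} → Fin N → ℕ
label i = suc (toℕ i)

-- The links (v_x , v_y) with x < y: those of K_m, the bridge, and those
-- of the path.
Link : ℕ → ℕ → ℕ → Set
Link m x y = (x ℕ.< y × y ℕ.≤ m)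
           ⊎ (x ≡ m × y ≡ suc m)
           ⊎ (m ℕ.< x × y ≡ suc x)

link? : ∀ m x y → Dec (Link m x y)
link? m x y = (x ℕ.<? y ×-dec y ℕ.≤? m)
        ⊎-dec (x ℕ.≟ m ×-dec y ℕ.≟ suc m)
        ⊎-dec (m ℕ.<? x ×-dec y ℕ.≟ suc x)

link-irrefl : ∀ m {x} → ¬ Link m x x
link-irrefl m (inj₁ (x<x , _))               = ℕ.<-irrefl refl x<x
link-irrefl m (inj₂ (inj₁ (refl , x≡1+x)))   = ℕ.1+n≢n (sym x≡1+x)
link-irrefl m (inj₂ (inj₂ (_ , x≡1+x)))      = ℕ.1+n≢n (sym x≡1+x)

lollipop : (m n : ℕ) → Graph (m ℕ.+ n)
lollipop m n = record
  { Adj     = λ i j → Link m (label i) (label j) ⊎ Link m (label j) (label i)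
  ; adj?    = λ i j → link? m (label i) (label j) ⊎-dec link? m (label j) (label i)
  ; adj-sym = swap
  ; irrefl  = λ where
      (inj₁ e) → link-irrefl m e
      (inj₂ e) → link-irrefl m e
  }

-- Here ⌈ k /2⌉ is the p with k = 2p or k = 2p - 1.
c : ℕ → ℚ
c k = if does (2 ∣? k)
  then ι 2 - 2^ (+ 1 ℤ.- + ⌈ k /2⌉)
  else ι 2 - ι 3 * 2^ (ℤ.- (+ ⌈ k /2⌉))

a : (m n k : ℕ) → ℚ
a m n k =
    (ι m + 1ℚ - 2^ (+ k ℤ.- + n)) * ((ι m - 1ℚ) * ½)
  + ι 2 * (ι n - ι k) - ι 2 + 2^ (+ 1 ℤ.+ + k ℤ.- + n)
  + (ι k + ι m + ι 2 - 2^ (+ 1 ℤ.+ + k ℤ.- + n)) * c k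

Condition₁ : (m n p : ℕ) → Set
Condition₁ m n p = 1 ℕ.< p ×
  ( ι 2 * ι p + ι m + 1ℚ + 2^ (+ 2 ℤ.* + p ℤ.- + n)
  - (+ m / 3 + 1ℚ) * 2^ (+ 3 ℤ.* + p ℤ.- + n ℤ.- + 1)) <2/ln2

Condition₂ : (m n p : ℕ) → Set
Condition₂ m n p = 1 ℕ.< p ×
  ( ι 2 * ι p + ι m + ι 2 + 2^ (+ 1 ℤ.+ + 2 ℤ.* + p ℤ.- + n)
  - (ι m + ι 3) * 2^ (+ 3 ℤ.* + p ℤ.- + n ℤ.- + 1)) <2/ln2

-- Truncated subtraction is exact here, since p₁ and p₂ exceed 1.
Candidate : (m n p₁ p₂ : ℕ) → ℚ → Set
Candidate m n p₁ p₂ x = ∃[ k ]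
  k ∈ (2 ℕ.* p₁ ℕ.∸ 1) ∷ (2 ℕ.* p₁ ℕ.∸ 3) ∷ (2 ℕ.* p₂) ∷ (2 ℕ.* p₂ ℕ.∸ 2) ∷ []
  × 2 ℕ.≤ k × k ℕ.≤ n × x ≡ a m n k

{-# OPTIONS --safe #-}

-- Write m = h + 2.  Adding a link {p, q} to a graph with distance d gives the
-- distance min (d x y, d x p + 1 + d q y, d x q + 1 + d p y).  In the lollipop
-- the new link closes a cycle, and since weights are multiplicative along
-- shortest paths through its two ends, the closeness is explicit in the
-- following two cases, which are all up to symmetry.
--
-- * The link joins v_(m+i) and v_(m+i+k).  For fixed k, moving the cycle one
--   step towards the clique does not decrease the closeness, so i = 0 is best:
--   this is a(k).
-- * The link joins v_(m+k) and a clique vertex other than v_m.  The cycle is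
--   one longer; the closeness is at most a(k) when k = 2 or k ≥ 4, at most a(2)
--   when k = 1, and equal to a(3) + 1/4 when k = 3, which is at most a(5) when
--   n ≥ 5.
--
-- It remains to maximise a(k).  Along each parity of k the increments of a have
-- the sign of an explicit E(p) which, once it is nonpositive, stays so.  No
-- monotonicity of the derivatives in the conditions is needed: they decide the
-- sign of E at p, or at p - 1, by a margin for which 2 ≤ 2 / ln 2 ≤ 4 suffices.
module Submission where

open import Defs
open import Data.Bool.Base using (true; false; if_then_else_)
open import Data.Empty using (⊥-elim)
open import Data.Fin.Base as Fin using (Fin; toℕ; fromℕ<)
open import Data.Fin.Permutation as Perm using (Permutation; _⟨$⟩ʳ_; _⟨$⟩ˡ_)
open import Data.Fin.Properties as Fin using (toℕ-injective; toℕ-fromℕ<; toℕ<n)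
open import Data.Integer.Base as ℤ using (ℤ; +_; -[1+_])
import Data.Integer.Properties as ℤ
open import Data.List.Base using ([]; _∷_)
open import Data.List.Membership.Propositional using (_∈_)
open import Data.List.Relation.Unary.Any using (here; there)
open import Data.Maybe.Base using (just; nothing)
open import Data.Nat.Base as ℕ using (ℕ; zero; suc; z≤n; s≤s; s≤s⁻¹; _∸_; _⊓_; _⊔_; ∣_-_∣; ⌈_/2⌉)
open import Data.Nat.Divisibility using (_∣?_)
import Data.Nat.Properties as ℕ
import Data.Nat.Tactic.RingSolver as ℕSolver
open import Data.Product.Base using (∃-syntax; Σ-syntax; _×_; _,_; proj₁; proj₂)
open import Data.Rational.Base using (ℚ; 0ℚ; 1ℚ; ½; _+_; _*_; _-_; -_; _/_; _≤_; _<_; NonNegative; nonNegative; toℚᵘ; fromℚᵘ)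
open import Data.Rational.Properties as ℚ using ()
open import Data.Rational.Solver using (module +-*-Solver)
open import Data.Rational.Unnormalised.Base as ℚᵘ using (mkℚᵘ; *≡*; *≤*)
import Data.Rational.Unnormalised.Properties as ℚᵘ
open import Data.Sum.Base using (_⊎_; inj₁; inj₂; [_,_]′; swap)
open import Function.Base using (_∘_; id)
open import Relation.Binary.Definitions using (Tri; tri<; tri≈; tri>)
open import Relation.Binary.PropositionalEquality
open import Relation.Nullary using (Dec; does; yes; no; ¬_; contradiction)
open import Relation.Nullary.Decidable using (dec-true; dec-false; dec⇒maybe; toWitness)
open import Tactic.RingSolver using (solve-∀)
open import Tactic.RingSolver.Core.AlmostCommutativeRing using (AlmostCommutativeRing; fromCommutativeRing)
open import Algebra.Properties.CommutativeMonoid.Sum ℚ.+-0-commutativeMonoid using (sum-cong-≗; sum-permute)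
open +-*-Solver using (Polynomial; _:+_; _:*_; _:-_; con; _:=_) renaming (solve to solveℚ)

-- The two conditions come from calculus: up to the factors 3 ln 2 · 2^(-p) and 2 ln 2 · 2^(-p),
-- their left-hand sides are the derivatives of a(2p - 1) and a(2p) in a real variable p. The
-- discrete increments have the same shape, but in E(p) the coefficient of the dominant term
-- 2^(3p-n) is three times as large. So E(p) is compared with three times the condition at p, and
-- E(p - 1) with 3/8 of it, since that term grows by the factor 8. The dominant terms cancel, and
-- what is left is linear in p and m plus a multiple of 2^(2p-n), with a definite sign. The sign of
-- E at p₁ - 1 (or p₂ - 1) remains open, which is why each parity needs two candidates. The range k
-- ≤ n is a separate obstacle: 2p₁ - 1 or 2p₂ may exceed n, and then the smaller candidate must be
-- shown to lie within the range. For distances, the lollipop is a line whose first point is blown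
-- up into m - 1 mutually adjacent clones. Everything from one chosen clone onwards is an honest
-- line of integers.

ring : AlmostCommutativeRing _ _
ring = fromCommutativeRing ℚ.+-*-commutativeRing λ x → dec⇒maybe (0ℚ ℚ.≟ x)

-- Order and arithmetic in ℚ

+-congˡ : ∀ x {y z} → y ≡ z → x + y ≡ x + z
+-congˡ x = cong λ y → x + y

+-nonneg : ∀ {p q} → 0ℚ ≤ p → 0ℚ ≤ q → 0ℚ ≤ p + q
+-nonneg = ℚ.+-mono-≤

*-nonneg : ∀ {p q} → 0ℚ ≤ p → 0ℚ ≤ q → 0ℚ ≤ p * q
*-nonneg {p} {q} 0≤p 0≤q =
  subst (_≤ p * q) (ℚ.*-zeroʳ p) (ℚ.*-monoˡ-≤-nonNeg p {{nonNegative 0≤p}} 0≤q)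

-- The standard form of an inequality below: a certificate `d` that is visibly nonnegative, and an
-- identity for the ring solver.
≤-by : ∀ {p q} d → 0ℚ ≤ d → p + d ≡ q → p ≤ q
≤-by {p} d 0≤d refl = subst (_≤ p + d) (ℚ.+-identityʳ p) (ℚ.+-monoʳ-≤ p 0≤d)

0≤q-p : ∀ {p q} → p ≤ q → 0ℚ ≤ q - p
0≤q-p {p} {q} p≤q = subst (_≤ q - p) (ℚ.+-inverseʳ p) (ℚ.+-monoˡ-≤ (- p) p≤q)

0≤p : ∀ p {{_ : NonNegative p}} → 0ℚ ≤ p
0≤p p = ℚ.nonNegative⁻¹ p

-- `_/_` normalises by a gcd and is stuck on variables. It is `fromℚᵘ` of an unnormalised fraction,
-- where arithmetic is componentwise; the laws of `ι` and of `2^_` are read off from there.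
fromℚᵘ-* : ∀ p q → fromℚᵘ (p ℚᵘ.* q) ≡ fromℚᵘ p * fromℚᵘ q
fromℚᵘ-* p q = ℚ.toℚᵘ-injective (begin
  toℚᵘ (fromℚᵘ (p ℚᵘ.* q))             ≈⟨ ℚ.toℚᵘ-fromℚᵘ (p ℚᵘ.* q) ⟩
  p ℚᵘ.* q                             ≈⟨ ℚᵘ.*-cong (ℚ.toℚᵘ-fromℚᵘ p) (ℚ.toℚᵘ-fromℚᵘ q) ⟨
  toℚᵘ (fromℚᵘ p) ℚᵘ.* toℚᵘ (fromℚᵘ q) ≈⟨ ℚ.toℚᵘ-homo-* (fromℚᵘ p) (fromℚᵘ q) ⟨
  toℚᵘ (fromℚᵘ p * fromℚᵘ q)           ∎)
  where open ℚᵘ.≃-Reasoning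

fromℚᵘ-+ : ∀ p q → fromℚᵘ (p ℚᵘ.+ q) ≡ fromℚᵘ p + fromℚᵘ q
fromℚᵘ-+ p q = ℚ.toℚᵘ-injective (begin
  toℚᵘ (fromℚᵘ (p ℚᵘ.+ q))             ≈⟨ ℚ.toℚᵘ-fromℚᵘ (p ℚᵘ.+ q) ⟩
  p ℚᵘ.+ q                             ≈⟨ ℚᵘ.+-cong (ℚ.toℚᵘ-fromℚᵘ p) (ℚ.toℚᵘ-fromℚᵘ q) ⟨
  toℚᵘ (fromℚᵘ p) ℚᵘ.+ toℚᵘ (fromℚᵘ q) ≈⟨ ℚ.toℚᵘ-homo-+ (fromℚᵘ p) (fromℚᵘ q) ⟨
  toℚᵘ (fromℚᵘ p + fromℚᵘ q)           ∎)
  where open ℚᵘ.≃-Reasoning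

ι-+ : ∀ m n → ι (m ℕ.+ n) ≡ ι m + ι n
ι-+ m n = trans (cong (_/ 1) (cong₂ ℤ._+_ (sym (ℤ.*-identityʳ (+ m))) (sym (ℤ.*-identityʳ (+ n)))))
                (fromℚᵘ-+ (mkℚᵘ (+ m) 0) (mkℚᵘ (+ n) 0))

ι-* : ∀ m n → ι (m ℕ.* n) ≡ ι m * ι n
ι-* m n = trans (cong (_/ 1) (ℤ.pos-* m n)) (fromℚᵘ-* (mkℚᵘ (+ m) 0) (mkℚᵘ (+ n) 0))

ι-suc : ∀ n → ι (suc n) ≡ 1ℚ + ι n
ι-suc = ι-+ 1

0≤ι : ∀ n → 0ℚ ≤ ι n
0≤ι n = 0≤p (ι n) {{ℚ.normalize-nonNeg n 1}}

ι-mono-≤ : ∀ {m n} → m ℕ.≤ n → ι m ≤ ι n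
ι-mono-≤ {m} {n} m≤n = ≤-by (ι (n ℕ.∸ m)) (0≤ι (n ℕ.∸ m))
  (trans (sym (ι-+ m (n ℕ.∸ m))) (cong ι (ℕ.m+[n∸m]≡n m≤n)))

-- Powers of two

w : ℕ → ℚ
w zero    = 1ℚ
w (suc d) = ½ * w d

0≤w : ∀ d → 0ℚ ≤ w d
0≤w zero    = 0≤p 1ℚ
0≤w (suc d) = *-nonneg (0≤p ½) (0≤w d)

w-+ : ∀ d e → w (d ℕ.+ e) ≡ w d * w e
w-+ zero    e = sym (ℚ.*-identityˡ (w e))
w-+ (suc d) e = trans (cong (½ *_) (w-+ d e)) (sym (ℚ.*-assoc ½ (w d) (w e)))

w≤1 : ∀ d → w d ≤ 1ℚ
w≤1 zero    = ℚ.≤-refl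
w≤1 (suc d) = ℚ.≤-trans (≤-by (½ * w d) (*-nonneg (0≤p ½) (0≤w d)) (lem (w d))) (w≤1 d)
  where
  lem : ∀ x → ½ * x + ½ * x ≡ x
  lem = solve-∀ ring

2^-suc : ∀ n → 2^ -[1+ suc n ] ≡ ½ * 2^ -[1+ n ]
2^-suc n = lem (2 ℕ.^ suc n) {{ℕ.m^n≢0 2 (suc n)}} {{ℕ.m^n≢0 2 (suc (suc n))}}
  where
  lem : ∀ k .{{_ : ℕ.NonZero k}} .{{_ : ℕ.NonZero (2 ℕ.* k)}} →
        + 1 / (2 ℕ.* k) ≡ ½ * (+ 1 / k)
  lem (suc k) = fromℚᵘ-* (mkℚᵘ (+ 1) 1) (mkℚᵘ (+ 1) k)

2^-pos : ∀ n → 2^ (+ suc n) ≡ ι 2 * 2^ (+ n)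
2^-pos n = ι-* 2 (2 ℕ.^ n)

2^neg≡w : ∀ d → 2^ (ℤ.- (+ d)) ≡ w d
2^neg≡w zero          = refl
2^neg≡w (suc zero)    = refl
2^neg≡w (suc (suc d)) = trans (2^-suc d) (cong (½ *_) (2^neg≡w (suc d)))

double : ∀ x → ι 2 * (½ * x) ≡ x
double = solve-∀ ring

2^-suc-+ : ∀ i → 2^ (ℤ.suc i) ≡ ι 2 * 2^ i
2^-suc-+ (+ n)          = 2^-pos n
2^-suc-+ -[1+ zero ]    = refl
2^-suc-+ -[1+ suc n ]   = sym (trans (cong (ι 2 *_) (2^-suc n)) (double (2^ -[1+ n ])))

2^-pred : ∀ i → 2^ (ℤ.pred i) ≡ ½ * 2^ i
2^-pred i = begin
  2^ (ℤ.pred i)                    ≡⟨ double′ (2^ (ℤ.pred i)) ⟩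
  ½ * (ι 2 * 2^ (ℤ.pred i))        ≡⟨ cong (½ *_) (2^-suc-+ (ℤ.pred i)) ⟨
  ½ * 2^ (ℤ.suc (ℤ.pred i))        ≡⟨ cong (λ j → ½ * 2^ j) (ℤ.suc-pred i) ⟩
  ½ * 2^ i                         ∎
  where
  open ≡-Reasoning
  double′ : ∀ x → x ≡ ½ * (ι 2 * x)
  double′ = solve-∀ ring

2^-+ : ∀ i j → 2^ (i ℤ.+ j) ≡ 2^ i * 2^ j
2^-+ (+ zero) j = trans (cong 2^_ (ℤ.+-identityˡ j)) (sym (ℚ.*-identityˡ (2^ j)))
2^-+ (+ suc n) j = begin
  2^ (+ suc n ℤ.+ j)          ≡⟨ cong 2^_ (ℤ.+-assoc (+ 1) (+ n) j) ⟩
  2^ (ℤ.suc (+ n ℤ.+ j))      ≡⟨ 2^-suc-+ (+ n ℤ.+ j) ⟩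
  ι 2 * 2^ (+ n ℤ.+ j)        ≡⟨ cong (ι 2 *_) (2^-+ (+ n) j) ⟩
  ι 2 * (2^ (+ n) * 2^ j)     ≡⟨ ℚ.*-assoc (ι 2) (2^ (+ n)) (2^ j) ⟨
  ι 2 * 2^ (+ n) * 2^ j       ≡⟨ cong (_* 2^ j) (2^-pos n) ⟨
  2^ (+ suc n) * 2^ j         ∎
  where open ≡-Reasoning
2^-+ -[1+ zero ] j = 2^-pred j
2^-+ -[1+ suc n ] j = begin
  2^ (-[1+ suc n ] ℤ.+ j)     ≡⟨ cong 2^_ (ℤ.+-assoc -[1+ 0 ] -[1+ n ] j) ⟩
  2^ (ℤ.pred (-[1+ n ] ℤ.+ j)) ≡⟨ 2^-pred (-[1+ n ] ℤ.+ j) ⟩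
  ½ * 2^ (-[1+ n ] ℤ.+ j)     ≡⟨ cong (½ *_) (2^-+ -[1+ n ] j) ⟩
  ½ * (2^ -[1+ n ] * 2^ j)    ≡⟨ ℚ.*-assoc ½ (2^ -[1+ n ]) (2^ j) ⟨
  ½ * 2^ -[1+ n ] * 2^ j      ≡⟨ cong (_* 2^ j) (2^-suc n) ⟨
  2^ -[1+ suc n ] * 2^ j      ∎
  where open ≡-Reasoning

2^k-n : ∀ k n → 2^ (+ k ℤ.- + n) ≡ 2^ (+ k) * w n
2^k-n k n = trans (2^-+ (+ k) (ℤ.- + n)) (cong (2^ (+ k) *_) (2^neg≡w n))

2^*w : ∀ k → 2^ (+ k) * w k ≡ 1ℚ
2^*w zero    = refl
2^*w (suc k) = trans (cong (_* (½ * w k)) (2^-pos k)) (trans (lem (2^ (+ k)) (w k)) (2^*w k))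
  where
  lem : ∀ x y → ι 2 * x * (½ * y) ≡ x * y
  lem = solve-∀ ring

0≤2^ : ∀ i → 0ℚ ≤ 2^ i
0≤2^ (+ n)    = 0≤ι (2 ℕ.^ n)
0≤2^ -[1+ n ] = subst (0ℚ ≤_) (sym (2^neg≡w (suc n))) (0≤w (suc n))

-- Sums over initial segments of ℕ

∑ : ℕ → (ℕ → ℚ) → ℚ
∑ zero    f = 0ℚ
∑ (suc n) f = f 0 + ∑ n (f ∘ suc)

sum≡∑ : ∀ n (f : ℕ → ℚ) → sum {n} (f ∘ toℕ) ≡ ∑ n f
sum≡∑ zero    f = refl
sum≡∑ (suc n) f = +-congˡ (f 0) (sum≡∑ n (f ∘ suc))

∑-cong : ∀ n {f g} → (∀ x → x ℕ.< n → f x ≡ g x) → ∑ n f ≡ ∑ n g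
∑-cong zero    f≡g = refl
∑-cong (suc n) f≡g = cong₂ _+_ (f≡g 0 (s≤s z≤n)) (∑-cong n λ x x<n → f≡g (suc x) (s≤s x<n))

∑-++ : ∀ m n f → ∑ (m ℕ.+ n) f ≡ ∑ m f + ∑ n (λ x → f (m ℕ.+ x))
∑-++ zero    n f = sym (ℚ.+-identityˡ _)
∑-++ (suc m) n f = trans (+-congˡ (f 0) (∑-++ m n (f ∘ suc))) (sym (ℚ.+-assoc (f 0) _ _))

∑-+ : ∀ n f g → ∑ n (λ x → f x + g x) ≡ ∑ n f + ∑ n g
∑-+ zero    f g = refl
∑-+ (suc n) f g = trans (+-congˡ (f 0 + g 0) (∑-+ n (f ∘ suc) (g ∘ suc))) (lem (f 0) (g 0) (∑ n (f ∘ suc)) (∑ n (g ∘ suc)))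
  where
  lem : ∀ a b c d → a + b + (c + d) ≡ (a + c) + (b + d)
  lem = solve-∀ ring

∑-*ʳ : ∀ n f c → ∑ n (λ x → f x * c) ≡ ∑ n f * c
∑-*ʳ zero    f c = sym (ℚ.*-zeroˡ c)
∑-*ʳ (suc n) f c = trans (+-congˡ (f 0 * c) (∑-*ʳ n (f ∘ suc) c)) (sym (ℚ.*-distribʳ-+ c (f 0) _))

∑-*ˡ : ∀ n f c → ∑ n (λ x → c * f x) ≡ c * ∑ n f
∑-*ˡ n f c = trans (∑-cong n λ x _ → ℚ.*-comm c (f x)) (trans (∑-*ʳ n f c) (ℚ.*-comm (∑ n f) c))

∑-const : ∀ n c → ∑ n (λ _ → c) ≡ ι n * c
∑-const zero    c = sym (ℚ.*-zeroˡ c)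
∑-const (suc n) c = trans (+-congˡ c (∑-const n c))
  (trans (lem c (ι n)) (cong (_* c) (sym (ι-suc n))))
  where
  lem : ∀ c n → c + n * c ≡ (1ℚ + n) * c
  lem = solve-∀ ring

∑-snoc : ∀ n f → ∑ (suc n) f ≡ ∑ n f + f n
∑-snoc zero    f = ℚ.+-comm (f 0) 0ℚ
∑-snoc (suc n) f = trans (+-congˡ (f 0) (∑-snoc n (f ∘ suc))) (sym (ℚ.+-assoc (f 0) _ _))

∑-rev : ∀ n f → ∑ (suc n) (λ x → f (n ℕ.∸ x)) ≡ ∑ (suc n) f
∑-rev zero    f = refl
∑-rev (suc n) f = trans (+-congˡ (f (suc n)) (∑-rev n f))
  (trans (ℚ.+-comm (f (suc n)) _) (sym (∑-snoc (suc n) f)))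

∑∑ : ℕ → ℕ → (ℕ → ℕ → ℚ) → ℚ
∑∑ m n F = ∑ m λ x → ∑ n λ y → F x y

∑∑-cong : ∀ m n {F G} → (∀ x y → x ℕ.< m → y ℕ.< n → F x y ≡ G x y) → ∑∑ m n F ≡ ∑∑ m n G
∑∑-cong m n F≡G = ∑-cong m λ x x<m → ∑-cong n λ y y<n → F≡G x y x<m y<n

∑∑-product : ∀ m n f g → ∑∑ m n (λ x y → f x * g y) ≡ ∑ m f * ∑ n g
∑∑-product m n f g = trans (∑-cong m λ x _ → ∑-*ˡ n g (f x)) (∑-*ʳ m f (∑ n g))

-- The sum of `F x y` over x < y < n, split off by the smallest index. Since distances are
-- symmetric, it yields half of a closeness.
pairs : ℕ → (ℕ → ℕ → ℚ) → ℚ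
pairs zero    F = 0ℚ
pairs (suc n) F = ∑ n (λ y → F 0 (suc y)) + pairs n (λ x y → F (suc x) (suc y))

∑∑≡pairs : ∀ n F → (∀ x → F x x ≡ 0ℚ) → (∀ x y → F x y ≡ F y x) →
           ∑∑ n n F ≡ pairs n F + pairs n F
∑∑≡pairs zero    F irr sym-F = refl
∑∑≡pairs (suc n) F irr sym-F = begin
  F 0 0 + ∑ n (F 0 ∘ suc) + ∑ n (λ x → F (suc x) 0 + ∑ n (λ y → F (suc x) (suc y)))
    ≡⟨ cong₂ (λ a b → a + ∑ n (F 0 ∘ suc) + b) (irr 0)
         (∑-+ n (λ x → F (suc x) 0) (λ x → ∑ n (λ y → F (suc x) (suc y)))) ⟩
  0ℚ + ∑ n (F 0 ∘ suc) + (∑ n (λ x → F (suc x) 0) + ∑∑ n n (λ x y → F (suc x) (suc y)))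
    ≡⟨ cong₂ (λ a b → 0ℚ + ∑ n (F 0 ∘ suc) + (a + b))
         (∑-cong n λ x _ → sym-F (suc x) 0)
         (∑∑≡pairs n (λ x y → F (suc x) (suc y)) (λ x → irr (suc x)) (λ x y → sym-F (suc x) (suc y))) ⟩
  0ℚ + ∑ n (F 0 ∘ suc) + (∑ n (F 0 ∘ suc) + (p + p))
    ≡⟨ lem (∑ n (F 0 ∘ suc)) p ⟩
  (∑ n (F 0 ∘ suc) + p) + (∑ n (F 0 ∘ suc) + p) ∎
  where
  open ≡-Reasoning
  p = pairs n (λ x y → F (suc x) (suc y))
  lem : ∀ a p → 0ℚ + a + (a + (p + p)) ≡ (a + p) + (a + p)
  lem = solve-∀ ring

pairs-cong : ∀ n {F G} → (∀ x y → x ℕ.< y → y ℕ.< n → F x y ≡ G x y) → pairs n F ≡ pairs n G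
pairs-cong zero    F≡G = refl
pairs-cong (suc n) F≡G = cong₂ _+_
  (∑-cong n λ y y<n → F≡G 0 (suc y) (s≤s z≤n) (s≤s y<n))
  (pairs-cong n λ x y x<y y<n → F≡G (suc x) (suc y) (s≤s x<y) (s≤s y<n))

-- This cuts a graph at a vertex: where shortest paths between the blocks run through the cut, the
-- mixed sum becomes a product.
pairs-++ : ∀ m n F → pairs (m ℕ.+ n) F ≡
  pairs m F + ∑∑ m n (λ x y → F x (m ℕ.+ y)) + pairs n (λ x y → F (m ℕ.+ x) (m ℕ.+ y))
pairs-++ zero    n F = lem _
  where
  lem : ∀ a → a ≡ 0ℚ + 0ℚ + a
  lem = solve-∀ ring
pairs-++ (suc m) n F = trans
  (cong₂ _+_ (∑-++ m n (λ y → F 0 (suc y))) (pairs-++ m n (λ x y → F (suc x) (suc y))))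
  (lem (∑ m (λ y → F 0 (suc y))) (∑ n (λ y → F 0 (suc (m ℕ.+ y))))
       (pairs m (λ x y → F (suc x) (suc y))) (∑∑ m n (λ x y → F (suc x) (suc (m ℕ.+ y))))
       (pairs n (λ x y → F (suc (m ℕ.+ x)) (suc (m ℕ.+ y)))))
  where
  lem : ∀ a b c d e → a + b + (c + d + e) ≡ a + c + (b + d) + e
  lem = solve-∀ ring

pairs-const : ∀ n c → pairs n (λ _ _ → c) ≡ ι n * (ι n - 1ℚ) * ½ * c
pairs-const zero    c = sym (lem c)
  where
  lem : ∀ c → 0ℚ * (0ℚ - 1ℚ) * ½ * c ≡ 0ℚ
  lem = solve-∀ ring
pairs-const (suc n) c = trans (cong₂ _+_ (∑-const n c) (pairs-const n c))
  (trans (lem (ι n) c) (cong (λ x → x * (x - 1ℚ) * ½ * c) (sym (ι-suc n))))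
  where
  lem : ∀ n c → n * c + n * (n - 1ℚ) * ½ * c ≡ (1ℚ + n) * (1ℚ + n - 1ℚ) * ½ * c
  lem = solve-∀ ring

-- Distances after adding a link

via : ∀ {A : Set} → (A → A → ℕ) → A → A → A → A → ℕ
via D p q x y = D x y ⊓ ((D x p ℕ.+ suc (D q y)) ⊓ (D x q ℕ.+ suc (D p y)))

module _ {n} (G : Graph n) where
  open Graph G

  walk-++ : ∀ k {l x y z} → Walk G k x y → Walk G l y z → Walk G (k ℕ.+ l) x z
  walk-++ zero    refl        v = v
  walk-++ (suc k) (_ , e , u) v = _ , e , walk-++ k u v

  walk-snoc : ∀ k {x y z} → Walk G k x y → Adj y z → Walk G (suc k) x z
  walk-snoc k {x} {y} {z} u e =
    subst (λ l → Walk G l x z) (ℕ.+-comm k 1) (walk-++ k u (_ , e , refl))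

  walk-reverse : ∀ k {x y} → Walk G k x y → Walk G k y x
  walk-reverse zero    refl        = refl
  walk-reverse (suc k) (_ , e , u) = walk-snoc k (walk-reverse k u) (adj-sym e)

  -- As `D` is total, this includes connectedness, so the weight 0 of unreachable pairs never
  -- enters.
  record IsDistance (D : Fin n → Fin n → ℕ) : Set where
    field
      walk    : ∀ x y → Walk G (D x y) x y
      minimal : ∀ k {x y} → Walk G k x y → D x y ℕ.≤ k

    dist≡ : ∀ x y → dist G x y ≡ just (D x y)
    dist≡ x y with dist G x y in eq
    ... | just d  = cong just (ℕ.≤-antisym (proj₂ (dist-just G eq) (D x y) (walk x y))
                                           (minimal d (proj₁ (dist-just G eq))))
    ... | nothing = ⊥-elim (dist-nothing G eq (D x y) (walk x y))

    D-refl : ∀ x → D x x ≡ 0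
    D-refl x = ℕ.n≤0⇒n≡0 (minimal 0 refl)

    step : ∀ {x y} z → Adj x y → D x z ℕ.≤ suc (D y z)
    step z e = minimal _ (_ , e , walk _ z)

  -- A function that vanishes on the diagonal and changes by at most one along a link cannot exceed
  -- the length of a walk. Minimality is thereby reduced to a check of single links.
  lipschitz⇒minimal : (D : Fin n → Fin n → ℕ) → (∀ x → D x x ≡ 0) →
    (∀ {x y} z → Adj x y → D x z ℕ.≤ suc (D y z)) → ∀ k {x y} → Walk G k x y → D x y ℕ.≤ k
  lipschitz⇒minimal D D-refl step zero    refl        = ℕ.≤-reflexive (D-refl _)
  lipschitz⇒minimal D D-refl step (suc k) (_ , e , u) =
    ℕ.≤-trans (step _ e) (s≤s (lipschitz⇒minimal D D-refl step k u))

module _ {n} (G : Graph n) (p q : Fin n) (p≢q : p ≢ q) where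
  private
    G′ = addLink G p q p≢q
    module G = Graph G
    module G′ = Graph G′

  lift-walk : ∀ k {x y} → Walk G k x y → Walk G′ k x y
  lift-walk zero    u           = u
  lift-walk (suc k) (_ , e , u) = _ , inj₁ e , lift-walk k u

  -- Each of the three terms of the minimum is the length of an actual walk. Conversely, an old link
  -- changes every term by at most one, and `jump` treats the new link.
  via-isDistance : ∀ {D} → IsDistance G D → IsDistance G′ (via D p q)
  via-isDistance {D} isD = record
    { walk    = walk′
    ; minimal = lipschitz⇒minimal G′ (via D p q)
        (λ x → ℕ.n≤0⇒n≡0 (ℕ.≤-trans (ℕ.m⊓n≤m (D x x) _) (ℕ.≤-reflexive (D-refl x)))) step′
    }
    where
    open IsDistance isD

    walk′ : ∀ x y → Walk G′ (via D p q x y) x y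
    walk′ x y with ℕ.⊓-sel (D x y) ((D x p ℕ.+ suc (D q y)) ⊓ (D x q ℕ.+ suc (D p y)))
    ... | inj₁ eq = subst (λ k → Walk G′ k x y) (sym eq) (lift-walk _ (walk x y))
    ... | inj₂ eq with ℕ.⊓-sel (D x p ℕ.+ suc (D q y)) (D x q ℕ.+ suc (D p y))
    ...   | inj₁ eq′ = subst (λ k → Walk G′ k x y) (sym (trans eq eq′))
                         (walk-++ G′ (D x p) (lift-walk _ (walk x p))
                           (q , inj₂ (inj₁ (refl , refl)) , lift-walk _ (walk q y)))
    ...   | inj₂ eq′ = subst (λ k → Walk G′ k x y) (sym (trans eq eq′))
                         (walk-++ G′ (D x q) (lift-walk _ (walk x q))
                           (p , inj₂ (inj₂ (refl , refl)) , lift-walk _ (walk p y)))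

    -- One step along the new link from p to q (or back) replaces a term of
    -- the minimum at its end by one at its start that is at most one larger.
    jump : ∀ p q z → D p z ⊓ ((D p p ℕ.+ suc (D q z)) ⊓ (D p q ℕ.+ suc (D p z)))
                     ℕ.≤ suc (D q z ⊓ ((D q p ℕ.+ suc (D q z)) ⊓ (D q q ℕ.+ suc (D p z))))
    jump p q z = ℕ.⊓-glb {y = suc (D q z)} V≤Dqz
                   (ℕ.⊓-glb {y = suc (D q p ℕ.+ suc (D q z))}
                     (ℕ.≤-trans V≤Dqz (ℕ.m≤n⇒m≤1+n (ℕ.m≤n+m (suc (D q z)) (D q p))))
                     (ℕ.≤-trans (ℕ.m⊓n≤m (D p z) _)
                       (ℕ.m≤n⇒m≤1+n (ℕ.≤-trans (ℕ.n≤1+n (D p z)) (ℕ.m≤n+m (suc (D p z)) (D q q))))))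
      where
      V≤Dqz : D p z ⊓ ((D p p ℕ.+ suc (D q z)) ⊓ (D p q ℕ.+ suc (D p z))) ℕ.≤ suc (D q z)
      V≤Dqz = ℕ.≤-trans (ℕ.m⊓n≤n (D p z) _) (ℕ.≤-trans (ℕ.m⊓n≤m (D p p ℕ.+ suc (D q z)) _)
                (ℕ.≤-reflexive (cong (ℕ._+ suc (D q z)) (D-refl p))))

    step′ : ∀ {x y} z → G′.Adj x y → via D p q x z ℕ.≤ suc (via D p q y z)
    step′ {x} {y} z (inj₁ e) =
      ℕ.⊓-mono-≤ {D x z} {suc (D y z)} (step z e)
        (ℕ.⊓-mono-≤ (ℕ.+-monoˡ-≤ _ (step p e)) (ℕ.+-monoˡ-≤ _ (step q e)))
    step′ z (inj₂ (inj₁ (refl , refl))) = jump p q z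
    step′ z (inj₂ (inj₂ (refl , refl))) =
      subst₂ (λ a b → D q z ⊓ a ℕ.≤ suc (D p z ⊓ b))
        (ℕ.⊓-comm (D q q ℕ.+ suc (D p z)) (D q p ℕ.+ suc (D q z)))
        (ℕ.⊓-comm (D p q ℕ.+ suc (D p z)) (D p p ℕ.+ suc (D q z)))
        (jump q p z)

-- The distance in the lollipop

-- Here m = h ℕ.+ 2 and the vertices are numbered from 0:
-- the bridge ends at number h ℕ.+ 1, so all of 0, …, h are clique vertices of
-- the same position.
L : ℕ → ℕ → ℕ → ℕ
L h x y = (1 ⊓ ∣ x - y ∣) ⊔ ∣ x ∸ h - y ∸ h ∣

L-refl : ∀ h x → L h x x ≡ 0
L-refl h x rewrite ℕ.∣n-n∣≡0 x | ℕ.∣n-n∣≡0 (x ∸ h) = refl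

L-sym : ∀ h x y → L h x y ≡ L h y x
L-sym h x y = cong₂ (λ a b → (1 ⊓ a) ⊔ b) (ℕ.∣-∣-comm x y) (ℕ.∣-∣-comm (x ∸ h) (y ∸ h))

-- Once `y` lies beyond the clones, the positions `x ∸ h` and `y ∸ h` differ by at least one, which
-- absorbs the first term of the maximum.
L-< : ∀ h {x y} → x ℕ.< y → h ℕ.< y → L h x y ≡ (y ∸ h) ∸ (x ∸ h)
L-< h {x} {y} x<y h<y = trans
  (ℕ.m≤n⇒m⊔n≡n (ℕ.≤-trans (ℕ.m⊓n≤m 1 ∣ x - y ∣)
    (subst (1 ℕ.≤_) (sym eq) (ℕ.m<n⇒0<n∸m (lt (x ℕ.≤? h))))))
  eq
  where
  lt : _ → x ∸ h ℕ.< y ∸ h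
  lt (yes x≤h) = subst (ℕ._< y ∸ h) (sym (ℕ.m≤n⇒m∸n≡0 x≤h)) (ℕ.m<n⇒0<n∸m h<y)
  lt (no  x≰h) = ℕ.∸-monoˡ-< x<y (ℕ.<⇒≤ (ℕ.≰⇒> x≰h))
  eq : ∣ x ∸ h - y ∸ h ∣ ≡ (y ∸ h) ∸ (x ∸ h)
  eq = ℕ.m≤n⇒∣m-n∣≡n∸m (ℕ.∸-monoˡ-≤ h (ℕ.<⇒≤ x<y))

-- Clique vertices have positions 0 and 1 only; two clones share a position and are told apart by
-- the first term.
L-clique : ∀ h {x y} → x ℕ.< y → y ℕ.≤ suc h → L h x y ≡ 1
L-clique h {x} {y} x<y y≤1+h = ℕ.≤-antisym
  (ℕ.⊔-lub (ℕ.m⊓n≤m 1 ∣ x - y ∣)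
    (ℕ.≤-trans (ℕ.∣m-n∣≤m⊔n (x ∸ h) (y ∸ h))
      (ℕ.⊔-lub (small (ℕ.≤-trans (ℕ.<⇒≤ x<y) y≤1+h)) (small y≤1+h))))
  (ℕ.≤-trans (ℕ.⊓-glb ℕ.≤-refl (subst (1 ℕ.≤_) (sym (ℕ.m≤n⇒∣m-n∣≡n∸m (ℕ.<⇒≤ x<y))) (ℕ.m<n⇒0<n∸m x<y)))
    (ℕ.m≤m⊔n (1 ⊓ ∣ x - y ∣) ∣ x ∸ h - y ∸ h ∣))
  where
  small : ∀ {z} → z ℕ.≤ suc h → z ∸ h ℕ.≤ 1
  small z≤1+h = ℕ.≤-trans (ℕ.∸-monoˡ-≤ h z≤1+h) (ℕ.≤-reflexive (ℕ.m+n∸n≡m 1 h))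

-- From the last clone, number `h`, onwards the numbering is an isometry with a line. Hence a link
-- at that clone can be treated like a link on the integers.
L-line : ∀ h {l} → h ℕ.≤ l → ∀ a e → L h (l ℕ.+ a) (l ℕ.+ (a ℕ.+ e)) ≡ e
L-line h {l} h≤l a zero = trans (cong (λ b → L h (l ℕ.+ a) (l ℕ.+ b)) (ℕ.+-identityʳ a)) (L-refl h (l ℕ.+ a))
L-line h {l} h≤l a (suc e) = trans
  (L-< h (ℕ.+-monoʳ-< l (ℕ.m<m+n a (s≤s z≤n)))
         (ℕ.≤-<-trans h≤l (ℕ.m<m+n l (ℕ.<-≤-trans (s≤s z≤n) (ℕ.m≤n+m (suc e) a)))))
  (trans (cong₂ _∸_ (ℕ.+-∸-comm (a ℕ.+ suc e) h≤l) (ℕ.+-∸-comm a h≤l))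
    (trans (ℕ.[m+n]∸[m+o]≡n∸o (l ∸ h) (a ℕ.+ suc e) a) (ℕ.m+n∸m≡n a (suc e))))

L-line-∣-∣ : ∀ h {l} → h ℕ.≤ l → ∀ a b → L h (l ℕ.+ a) (l ℕ.+ b) ≡ ∣ a - b ∣
L-line-∣-∣ h {l} h≤l a b with ℕ.≤-total a b
... | inj₁ a≤b = trans (subst (λ c → L h (l ℕ.+ a) (l ℕ.+ c) ≡ b ∸ a) (ℕ.m+[n∸m]≡n a≤b) (L-line h h≤l a (b ∸ a)))
                       (sym (ℕ.m≤n⇒∣m-n∣≡n∸m a≤b))
... | inj₂ b≤a = trans (L-sym h (l ℕ.+ a) (l ℕ.+ b))
                   (trans (subst (λ c → L h (l ℕ.+ b) (l ℕ.+ c) ≡ a ∸ b) (ℕ.m+[n∸m]≡n b≤a) (L-line h h≤l b (a ∸ b)))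
                          (sym (ℕ.m≤n⇒∣n-m∣≡n∸m b≤a)))

module _ (h n : ℕ) where
  private
    G = lollipop (2 ℕ.+ h) n
    N = 2 ℕ.+ h ℕ.+ n
    module G = Graph G

  D : Fin N → Fin N → ℕ
  D x y = L h (toℕ x) (toℕ y)

  adj-next : ∀ {x y : Fin (2 ℕ.+ h ℕ.+ n)} → h ℕ.≤ toℕ x → toℕ y ≡ suc (toℕ x) → Graph.Adj (lollipop (2 ℕ.+ h) n) x y
  adj-next {x} {y} h≤x eq with ℕ.<-cmp (toℕ x) (suc h)
  ... | tri< x<1+h _ _ = inj₁ (inj₁ (s≤s (subst (toℕ x ℕ.<_) (sym eq) ℕ.≤-refl)
                                   , s≤s (subst (ℕ._≤ suc h) (sym eq) x<1+h)))
  ... | tri≈ _ x≡1+h _ = inj₁ (inj₂ (inj₁ (cong suc x≡1+h , cong suc (trans eq (cong suc x≡1+h)))))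
  ... | tri> _ _ 1+h<x = inj₁ (inj₂ (inj₂ (s≤s 1+h<x , cong suc eq)))

  private
    line : ∀ e {x y : Fin N} → h ℕ.≤ toℕ x → toℕ y ≡ toℕ x ℕ.+ e → Walk G e x y
    line zero    h≤x eq = toℕ-injective (sym (trans eq (ℕ.+-identityʳ _)))
    line (suc e) {x} {y} h≤x eq =
      l , adj-next h≤x toℕ-l , line e (subst (h ℕ.≤_) (sym toℕ-l) (ℕ.m≤n⇒m≤1+n h≤x))
                                  (trans eq′ (cong (ℕ._+ e) (sym toℕ-l)))
      where
      eq′ : toℕ y ≡ suc (toℕ x) ℕ.+ e
      eq′ = trans eq (ℕ.+-suc (toℕ x) e)
      1+x<N : suc (toℕ x) ℕ.< N
      1+x<N = ℕ.≤-<-trans (subst (suc (toℕ x) ℕ.≤_) (sym eq′) (ℕ.m≤m+n (suc (toℕ x)) e)) (toℕ<n y)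
      l = fromℕ< 1+x<N
      toℕ-l : toℕ l ≡ suc (toℕ x)
      toℕ-l = toℕ-fromℕ< 1+x<N

    walk-< : ∀ {x y : Fin N} → toℕ x ℕ.< toℕ y → Walk G (D x y) x y
    walk-< {x} {y} x<y with toℕ y ℕ.≤? suc h
    ... | yes y≤1+h = subst (λ k → Walk G k x y) (sym (L-clique h x<y y≤1+h))
                        (y , inj₁ (inj₁ (s≤s x<y , s≤s y≤1+h)) , refl)
    ... | no  y≰1+h with h ℕ.≤? toℕ x
    ...   | yes h≤x = subst (λ k → Walk G k x y)
            (sym (trans (L-< h x<y (ℕ.<-trans ℕ.≤-refl (ℕ.≰⇒> y≰1+h)))
                   (trans (ℕ.∸-+-assoc (toℕ y) h (toℕ x ∸ h))
                     (cong (toℕ y ∸_) (ℕ.m+[n∸m]≡n h≤x)))))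
            (line (toℕ y ∸ toℕ x) h≤x (sym (ℕ.m+[n∸m]≡n (ℕ.<⇒≤ x<y))))
    -- An earlier clone steps to the bridge end `suc h` first and then follows the line.
    ...   | no  h≰x = subst (λ k → Walk G k x y) (sym eq)
            (l , inj₁ (inj₁ (subst (λ z → suc (toℕ x) ℕ.< suc z) (sym toℕ-l) (s≤s (ℕ.m<n⇒m<1+n (ℕ.≰⇒> h≰x)))
                            , s≤s (ℕ.≤-reflexive toℕ-l)))
               , line (toℕ y ∸ suc h) (subst (h ℕ.≤_) (sym toℕ-l) (ℕ.n≤1+n h))
                   (trans (sym (ℕ.m+[n∸m]≡n (ℕ.<⇒≤ 1+h<y))) (cong (ℕ._+ (toℕ y ∸ suc h)) (sym toℕ-l))))
            where
            1+h<y = ℕ.≰⇒> y≰1+h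
            l = fromℕ< (ℕ.<-trans 1+h<y (toℕ<n y))
            toℕ-l : toℕ l ≡ suc h
            toℕ-l = toℕ-fromℕ< (ℕ.<-trans 1+h<y (toℕ<n y))
            eq : D x y ≡ suc (toℕ y ∸ suc h)
            eq = trans (L-< h x<y (ℕ.<-trans ℕ.≤-refl 1+h<y))
                   (trans (cong ((toℕ y ∸ h) ∸_) (ℕ.m≤n⇒m∸n≡0 (ℕ.<⇒≤ (ℕ.≰⇒> h≰x))))
                     (ℕ.+-∸-assoc 1 (ℕ.<⇒≤ 1+h<y)))

    walk : ∀ x y → Walk G (D x y) x y
    walk x y with ℕ.<-cmp (toℕ x) (toℕ y)
    ... | tri< x<y _ _ = walk-< x<y
    ... | tri≈ _ x≡y _ rewrite toℕ-injective x≡y = subst (λ k → Walk G k y y) (sym (L-refl h (toℕ y))) refl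
    ... | tri> _ _ y<x = subst (λ k → Walk G k x y) (L-sym h (toℕ y) (toℕ x))
                           (walk-reverse G (D y x) (walk-< y<x))

    consecutive : ∀ {x} → h ℕ.≤ x → ∣ x ∸ h - suc x ∸ h ∣ ℕ.≤ 1
    consecutive {x} h≤x rewrite ℕ.+-∸-assoc 1 h≤x =
      ℕ.≤-reflexive (trans (cong ∣ x ∸ h -_∣ (ℕ.+-comm 1 (x ∸ h))) (ℕ.∣m-m+n∣≡n (x ∸ h) 1))

    positions : ∀ {x y} → Link (2 ℕ.+ h) (suc x) (suc y) → ∣ x ∸ h - y ∸ h ∣ ℕ.≤ 1
    positions {x} {y} (inj₁ (x<y , y≤m)) =
      ℕ.≤-trans (ℕ.m≤n⊔m (1 ⊓ ∣ x - y ∣) ∣ x ∸ h - y ∸ h ∣)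
                (ℕ.≤-reflexive (L-clique h (s≤s⁻¹ x<y) (s≤s⁻¹ y≤m)))
    positions (inj₂ (inj₁ (refl , refl))) = consecutive (ℕ.n≤1+n h)
    positions (inj₂ (inj₂ (m<x , refl)))  = consecutive (ℕ.<⇒≤ (ℕ.<-trans ℕ.≤-refl (s≤s⁻¹ m<x)))

  -- No link moves the position by more than one, so the position term obeys the triangle inequality
  -- along links; the other term is at most one anyway.
  L-isDistance : IsDistance G D
  L-isDistance = record
    { walk    = walk
    ; minimal = lipschitz⇒minimal G D (λ x → L-refl h (toℕ x)) step
    }
    where
    adj-positions : ∀ {x y} → G.Adj x y → ∣ toℕ x ∸ h - toℕ y ∸ h ∣ ℕ.≤ 1
    adj-positions (inj₁ e) = positions e
    adj-positions {x} {y} (inj₂ e) = subst (ℕ._≤ 1) (ℕ.∣-∣-comm (toℕ y ∸ h) (toℕ x ∸ h)) (positions e)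

    step : ∀ {x y} z → G.Adj x y → D x z ℕ.≤ suc (D y z)
    step {x} {y} z e = ℕ.⊔-lub
      (ℕ.≤-trans (ℕ.m⊓n≤m 1 ∣ toℕ x - toℕ z ∣) (s≤s z≤n))
      (ℕ.≤-trans (ℕ.∣-∣-triangle (toℕ x ∸ h) (toℕ y ∸ h) (toℕ z ∸ h))
        (ℕ.+-mono-≤ (adj-positions {x} {y} e) (ℕ.m≤n⊔m (1 ⊓ ∣ toℕ y - toℕ z ∣) ∣ toℕ y ∸ h - toℕ z ∸ h ∣)))

-- A cycle with a tail

∑-rev′ : ∀ n f → ∑ n (λ x → f (n ∸ suc x)) ≡ ∑ n f
∑-rev′ zero    f = refl
∑-rev′ (suc n) f = ∑-rev n f

-- The row of `x` is a partial sum of `f` with `n ∸ x` terms; reversing the order of the rows lists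
-- the partial sums by length.
pairs-∸ : ∀ n (f : ℕ → ℚ) → pairs (suc n) (λ x y → f (y ∸ x)) ≡ ∑ (suc n) (λ j → ∑ j (f ∘ suc))
pairs-∸ n f = trans (lem n) (∑-rev n (λ j → ∑ j (f ∘ suc)))
  where
  lem : ∀ n → pairs (suc n) (λ x y → f (y ∸ x)) ≡ ∑ (suc n) (λ j → ∑ (n ∸ j) (f ∘ suc))
  lem zero    = refl
  lem (suc n) = +-congˡ (∑ (suc n) (f ∘ suc)) (lem n)

-- The closeness of a vertex of a cycle of length k + 1; it equals c k.
C : ℕ → ℚ
C k = ∑ k λ d → w (suc d ⊓ (k ∸ d))

-- The two neighbours contribute ½ each. Deleting them and closing the cycle brings every other
-- vertex nearer by one.
C-+2 : ∀ k → C (2 ℕ.+ k) ≡ 1ℚ + ½ * C k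
C-+2 k = begin
  ½ * 1ℚ + ∑ (suc k) (λ d → w (suc (suc d) ⊓ (suc k ∸ d)))
    ≡⟨ +-congˡ (½ * 1ℚ) (∑-snoc k (λ d → w (suc (suc d) ⊓ (suc k ∸ d)))) ⟩
  ½ * 1ℚ + (∑ k (λ d → w (suc (suc d) ⊓ (suc k ∸ d))) + w (suc (suc k) ⊓ (suc k ∸ k)))
    ≡⟨ cong₂ (λ a b → ½ * 1ℚ + (a + w (suc (suc k) ⊓ b)))
         (trans (∑-cong k λ d d<k → cong (λ z → w (suc (suc d) ⊓ z)) (ℕ.+-∸-assoc 1 (ℕ.<⇒≤ d<k)))
                (∑-*ˡ k (λ d → w (suc d ⊓ (k ∸ d))) ½))
         (ℕ.m+n∸n≡m 1 k) ⟩
  ½ * 1ℚ + (½ * C k + ½ * w (suc k ⊓ 0))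
    ≡⟨ cong (λ z → ½ * 1ℚ + (½ * C k + ½ * w z)) (ℕ.⊓-zeroʳ (suc k)) ⟩
  ½ * 1ℚ + (½ * C k + ½ * 1ℚ)
    ≡⟨ lem (C k) ⟩
  1ℚ + ½ * C k ∎
  where
  open ≡-Reasoning
  lem : ∀ x → ½ * 1ℚ + (½ * x + ½ * 1ℚ) ≡ 1ℚ + ½ * x
  lem = solve-∀ ring

c-+2 : ∀ k → c (2 ℕ.+ k) ≡ 1ℚ + ½ * c k
-- The decision for `2 + k` computes to the one for `k`, so a single case split serves both sides.
c-+2 k with does (2 ∣? k)
... | true  = trans (cong (λ x → ι 2 - x) (2^k-n 1 (suc ⌈ k /2⌉)))
                (trans (even (w ⌈ k /2⌉)) (cong (λ x → 1ℚ + ½ * (ι 2 - x)) (sym (2^k-n 1 ⌈ k /2⌉))))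
  where
  even : ∀ x → ι 2 - ι 2 * (½ * x) ≡ 1ℚ + ½ * (ι 2 - ι 2 * x)
  even = solve-∀ ring
... | false = trans (cong (λ x → ι 2 - ι 3 * x) (2^neg≡w (suc ⌈ k /2⌉)))
                (trans (odd (w ⌈ k /2⌉)) (cong (λ x → 1ℚ + ½ * (ι 2 - ι 3 * x)) (sym (2^neg≡w ⌈ k /2⌉))))
  where
  odd : ∀ x → ι 2 - ι 3 * (½ * x) ≡ 1ℚ + ½ * (ι 2 - ι 3 * x)
  odd = solve-∀ ring

C≡c : ∀ k → C k ≡ c k
C≡c zero          = refl
C≡c (suc zero)    = refl
C≡c (suc (suc k)) = trans (C-+2 k) (trans (cong (λ x → 1ℚ + ½ * x) (C≡c k)) (sym (c-+2 k)))

-- Averaging the partial sums with their reversal: going round the other way turns a distance d into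
-- k + 1 - d, so the partial sums of lengths `j` and `k ∸ j` together cover all other vertices once
-- and add up to `C k`.
cycle-pairs : ∀ k → pairs (suc k) (λ x y → w ((y ∸ x) ⊓ (suc k ∸ (y ∸ x)))) ≡ ½ * ι (suc k) * C k
cycle-pairs k = begin
  pairs (suc k) (λ x y → f (y ∸ x))
    ≡⟨ pairs-∸ k f ⟩
  ∑ (suc k) T
    ≡⟨ halve (∑ (suc k) T) ⟩
  ½ * (∑ (suc k) T + ∑ (suc k) T)
    ≡⟨ cong (λ x → ½ * (∑ (suc k) T + x)) (∑-rev k T) ⟨
  ½ * (∑ (suc k) T + ∑ (suc k) (λ j → T (k ∸ j)))
    ≡⟨ cong (½ *_) (∑-+ (suc k) T (λ j → T (k ∸ j))) ⟨
  ½ * ∑ (suc k) (λ j → T j + T (k ∸ j))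
    ≡⟨ cong (½ *_) (trans (∑-cong (suc k) λ j j≤k → complement j (s≤s⁻¹ j≤k)) (∑-const (suc k) (T k))) ⟩
  ½ * (ι (suc k) * T k)
    ≡⟨ ℚ.*-assoc ½ (ι (suc k)) (T k) ⟨
  ½ * ι (suc k) * T k ∎
  where
  open ≡-Reasoning
  f g T : ℕ → ℚ
  f d = w (d ⊓ (suc k ∸ d))
  g   = f ∘ suc
  T j = ∑ j g

  halve : ∀ x → x ≡ ½ * (x + x)
  halve = solve-∀ ring

  g-sym : ∀ d d′ → d ℕ.+ suc d′ ≡ k → g d ≡ g d′
  g-sym d d′ refl = cong w (trans
    (cong (suc d ⊓_) (ℕ.m+n∸m≡n d (suc d′)))
    (trans (ℕ.⊓-comm (suc d) (suc d′))
      (cong (suc d′ ⊓_) (sym (trans (cong (_∸ d′) (ℕ.+-suc d d′)) (ℕ.m+n∸n≡m (suc d) d′))))))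

  complement : ∀ j → j ℕ.≤ k → T j + T (k ∸ j) ≡ T k
  complement j j≤k = sym (trans (cong T (sym (ℕ.m+[n∸m]≡n j≤k)))
    (trans (∑-++ j (k ∸ j) g)
      (+-congˡ (T j)
        (trans (sym (∑-rev′ (k ∸ j) (λ x → g (j ℕ.+ x))))
          (∑-cong (k ∸ j) λ x x<k∸j → g-sym (j ℕ.+ (k ∸ j ∸ suc x)) x
            (trans (ℕ.+-assoc j (k ∸ j ∸ suc x) (suc x))
              (trans (cong (j ℕ.+_) (ℕ.m∸n+n≡m x<k∸j)) (ℕ.m+[n∸m]≡n j≤k))))))))

∑-cycle : ∀ k → ∑ (suc k) (λ b → w (b ⊓ (suc k ∸ b))) ≡ 1ℚ + C k
∑-cycle k = refl

-- The row of the cycle vertex `k`, from which the tail hangs. The vertex itself counts with weight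
-- 1.
∑-cycle-end : ∀ k → ∑ (suc k) (λ a → w ((k ∸ a) ⊓ suc a)) ≡ 1ℚ + C k
∑-cycle-end k = trans (∑-snoc k (λ a → w ((k ∸ a) ⊓ suc a)))
  (trans (cong₂ _+_ (∑-cong k λ a _ → cong w (ℕ.⊓-comm (k ∸ a) (suc a)))
                    (cong (λ z → w (z ⊓ suc k)) (ℕ.n∸n≡0 k)))
         (ℚ.+-comm (C k) 1ℚ))

∑-w-suc : ∀ r → ∑ r (w ∘ suc) ≡ 1ℚ - w r
∑-w-suc zero    = refl
∑-w-suc (suc r) = trans (+-congˡ (½ * 1ℚ) (trans (∑-*ˡ r (w ∘ suc) ½) (cong (½ *_) (∑-w-suc r)))) (lem (w r))
  where
  lem : ∀ x → ½ * 1ℚ + ½ * (1ℚ - x) ≡ 1ℚ - ½ * x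
  lem = solve-∀ ring

∑-w-∸ : ∀ i → ∑ i (λ b → w (i ∸ b)) ≡ 1ℚ - w i
∑-w-∸ zero    = refl
∑-w-∸ (suc i) = trans (+-congˡ (½ * w i) (∑-w-∸ i)) (lem (w i))
  where
  lem : ∀ x → ½ * x + (1ℚ - x) ≡ 1ℚ - ½ * x
  lem = solve-∀ ring

pairs-path : ∀ r → pairs r (λ x y → w (y ∸ x)) ≡ ι r - ι 2 + ι 2 * w r
pairs-path zero    = refl
pairs-path (suc r) = trans (cong₂ _+_ (∑-w-suc r) (pairs-path r))
  (trans (lem (w r) (ι r)) (cong (λ x → x - ι 2 + ι 2 * (½ * w r)) (sym (ι-suc r))))
  where
  lem : ∀ x r → 1ℚ - x + (r - ι 2 + ι 2 * x) ≡ 1ℚ + r - ι 2 + ι 2 * (½ * x)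
  lem = solve-∀ ring

private
  ∣a-a+e∣ : ∀ a e → ∣ a - a ℕ.+ e ∣ ≡ e
  ∣a-a+e∣ = ℕ.∣m-m+n∣≡n

  ∣a+e-a∣ : ∀ a e → ∣ a ℕ.+ e - a ∣ ≡ e
  ∣a+e-a∣ a e = trans (ℕ.∣-∣-comm (a ℕ.+ e) a) (∣a-a+e∣ a e)

-- On the line of integers with the extra link from 0 to k: the cycle
-- 0, …, k and the tail k + 1, k + 2, ….
via-cycle : ∀ k {a b} → a ℕ.< b → b ℕ.≤ k → via ∣_-_∣ 0 k a b ≡ (b ∸ a) ⊓ (suc k ∸ (b ∸ a))
via-cycle k {a} {b} a<b b≤k = subst₂ P (ℕ.m+[n∸m]≡n (ℕ.<⇒≤ a<b)) refl (param a (b ∸ a) (k ∸ b)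
    (trans (cong (ℕ._+ (k ∸ b)) (ℕ.m+[n∸m]≡n (ℕ.<⇒≤ a<b))) (ℕ.m+[n∸m]≡n b≤k)))
  where
  P : ℕ → ℕ → Set
  P b k = via ∣_-_∣ 0 k a b ≡ (b ∸ a) ⊓ (suc k ∸ (b ∸ a))
  param : ∀ a e f → a ℕ.+ e ℕ.+ f ≡ k → via ∣_-_∣ 0 k a (a ℕ.+ e) ≡ (a ℕ.+ e ∸ a) ⊓ (suc k ∸ (a ℕ.+ e ∸ a))
  param a e f refl rewrite ℕ.∣-∣-identityʳ a | ∣a-a+e∣ a e | ∣a+e-a∣ (a ℕ.+ e) f | ℕ.m+n∸m≡n a e
    | ℕ.+-assoc a e f | ∣a-a+e∣ a (e ℕ.+ f) = begin
    e ⊓ ((a ℕ.+ suc f) ⊓ (e ℕ.+ f ℕ.+ suc (a ℕ.+ e)))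
      ≡⟨ cong (e ⊓_) (ℕ.⊓-comm (a ℕ.+ suc f) _) ⟩
    e ⊓ ((e ℕ.+ f ℕ.+ suc (a ℕ.+ e)) ⊓ (a ℕ.+ suc f))
      ≡⟨ ℕ.⊓-assoc e _ _ ⟨
    (e ⊓ (e ℕ.+ f ℕ.+ suc (a ℕ.+ e))) ⊓ (a ℕ.+ suc f)
      ≡⟨ cong (_⊓ (a ℕ.+ suc f)) (ℕ.m≤n⇒m⊓n≡m (ℕ.≤-trans (ℕ.m≤m+n e f) (ℕ.m≤m+n (e ℕ.+ f) _))) ⟩
    e ⊓ (a ℕ.+ suc f)
      ≡⟨ cong (e ⊓_) (ℕ.m+n∸m≡n e (a ℕ.+ suc f)) ⟨
    e ⊓ (e ℕ.+ (a ℕ.+ suc f) ∸ e)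
      ≡⟨ cong (λ z → e ⊓ (z ∸ e)) (sum-eq a e f) ⟩
    e ⊓ (suc (a ℕ.+ (e ℕ.+ f)) ∸ e) ∎
    where
    open ≡-Reasoning
    sum-eq : ∀ a e f → e ℕ.+ (a ℕ.+ suc f) ≡ suc (a ℕ.+ (e ℕ.+ f))
    sum-eq a e f = trans (sym (ℕ.+-assoc e a (suc f))) (trans (cong (ℕ._+ suc f) (ℕ.+-comm e a))
      (trans (ℕ.+-suc (a ℕ.+ e) f) (cong suc (ℕ.+-assoc a e f))))

-- Every route into the tail passes through `k`: the distance to `k` on the cycle, then `suc c`
-- further steps.
via-cycle-tail : ∀ k {a} c → a ℕ.≤ k → via ∣_-_∣ 0 k a (suc k ℕ.+ c) ≡ ((k ∸ a) ⊓ suc a) ℕ.+ suc c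
via-cycle-tail k {a} c a≤k = param a (k ∸ a) (ℕ.m+[n∸m]≡n a≤k)
  where
  param : ∀ a f → a ℕ.+ f ≡ k → via ∣_-_∣ 0 k a (suc k ℕ.+ c) ≡ (f ⊓ suc a) ℕ.+ suc c
  param a f refl rewrite ℕ.∣-∣-identityʳ a | sym (ℕ.+-suc (a ℕ.+ f) c) | ∣a-a+e∣ (a ℕ.+ f) (suc c)
    | ℕ.+-assoc a f (suc c) | ∣a-a+e∣ a (f ℕ.+ suc c) | ∣a-a+e∣ a f = begin
    (f ℕ.+ suc c) ⊓ ((a ℕ.+ suc (suc c)) ⊓ (f ℕ.+ suc (a ℕ.+ (f ℕ.+ suc c))))
      ≡⟨ cong ((f ℕ.+ suc c) ⊓_) (ℕ.⊓-comm (a ℕ.+ suc (suc c)) _) ⟩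
    (f ℕ.+ suc c) ⊓ ((f ℕ.+ suc (a ℕ.+ (f ℕ.+ suc c))) ⊓ (a ℕ.+ suc (suc c)))
      ≡⟨ ℕ.⊓-assoc (f ℕ.+ suc c) _ _ ⟨
    ((f ℕ.+ suc c) ⊓ (f ℕ.+ suc (a ℕ.+ (f ℕ.+ suc c)))) ⊓ (a ℕ.+ suc (suc c))
      ≡⟨ cong₂ _⊓_ (ℕ.m≤n⇒m⊓n≡m (ℕ.≤-trans (ℕ.≤-trans (ℕ.m≤n+m _ a) (ℕ.n≤1+n _)) (ℕ.m≤n+m _ f))) (ℕ.+-suc a (suc c)) ⟩
    (f ℕ.+ suc c) ⊓ (suc a ℕ.+ suc c)
      ≡⟨ ℕ.+-distribʳ-⊓ (suc c) f (suc a) ⟨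
    (f ⊓ suc a) ℕ.+ suc c ∎
    where open ≡-Reasoning

via-tail : ∀ k {c d} → c ℕ.< d → via ∣_-_∣ 0 k (suc k ℕ.+ c) (suc k ℕ.+ d) ≡ d ∸ c
via-tail k {c} {d} c<d = trans
  (cong (λ z → z ⊓ ((∣ suc k ℕ.+ c - 0 ∣ ℕ.+ suc ∣ k - suc k ℕ.+ d ∣) ⊓ (∣ suc k ℕ.+ c - k ∣ ℕ.+ suc (suc k ℕ.+ d)))) eq)
  (ℕ.m≤n⇒m⊓n≡m (ℕ.⊓-glb {y = ∣ suc k ℕ.+ c - 0 ∣ ℕ.+ suc ∣ k - suc k ℕ.+ d ∣}
    (ℕ.≤-trans d∸c≤ (ℕ.≤-trans (ℕ.n≤1+n _) (ℕ.m≤n+m _ ∣ suc k ℕ.+ c - 0 ∣)))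
    (ℕ.≤-trans (ℕ.≤-trans (ℕ.m∸n≤m d c) (ℕ.≤-trans (ℕ.m≤n+m d (suc (suc k))) ℕ.≤-refl)) (ℕ.m≤n+m _ ∣ suc k ℕ.+ c - k ∣))))
  where
  eq : ∣ suc k ℕ.+ c - suc k ℕ.+ d ∣ ≡ d ∸ c
  eq = trans (ℕ.∣m+n-m+o∣≡∣n-o∣ (suc k) c d) (ℕ.m≤n⇒∣m-n∣≡n∸m (ℕ.<⇒≤ c<d))
  d∸c≤ : d ∸ c ℕ.≤ ∣ k - suc k ℕ.+ d ∣
  d∸c≤ = ℕ.≤-trans (ℕ.m∸n≤m d c) (subst (d ℕ.≤_)
    (sym (trans (cong (λ z → ∣ k - z ∣) (sym (ℕ.+-suc k d))) (∣a-a+e∣ k (suc d)))) (ℕ.n≤1+n d))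

-- The summands are the cycle, the cycle against the tail, and the tail. The middle one factors
-- because `k` is a cut vertex.
pairs-cycle-tail : ∀ k r → pairs (suc k ℕ.+ r) (λ x y → w (via ∣_-_∣ 0 k x y)) ≡
  ½ * ι (suc k) * C k + (1ℚ + C k) * (1ℚ - w r) + (ι r - ι 2 + ι 2 * w r)
pairs-cycle-tail k r = trans (pairs-++ (suc k) r (λ x y → w (via ∣_-_∣ 0 k x y)))
  (cong₂ _+_ (cong₂ _+_
    (trans (pairs-cong (suc k) λ x y x<y y≤k → cong w (via-cycle k x<y (s≤s⁻¹ y≤k))) (cycle-pairs k))
    (trans (∑∑-cong (suc k) r λ x y x≤k _ → trans (cong w (via-cycle-tail k y (s≤s⁻¹ x≤k)))
                                              (w-+ ((k ∸ x) ⊓ suc x) (suc y)))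
      (trans (∑∑-product (suc k) r (λ x → w ((k ∸ x) ⊓ suc x)) (w ∘ suc))
        (cong₂ _*_ (∑-cycle-end k) (∑-w-suc r)))))
    (trans (pairs-cong r λ x y x<y _ → cong w (via-tail k x<y)) (pairs-path r)))

-- Closeness of the lollipop with an extra link

via-sym : ∀ {A : Set} (D : A → A → ℕ) → (∀ x y → D x y ≡ D y x) →
          ∀ p q x y → via D p q x y ≡ via D p q y x
via-sym D D-sym p q x y = cong₂ _⊓_ (D-sym x y)
  (trans (ℕ.⊓-comm (D x p ℕ.+ suc (D q y)) (D x q ℕ.+ suc (D p y))) (cong₂ _⊓_ (exchange q p) (exchange p q)))
  where
  exchange : ∀ r s → D x r ℕ.+ suc (D s y) ≡ D y s ℕ.+ suc (D r x)
  exchange r s = trans (ℕ.+-suc (D x r) (D s y)) (trans (ℕ.+-comm (suc (D x r)) (D s y))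
    (cong₂ (λ a b → a ℕ.+ suc b) (D-sym s y) (D-sym x r)))

via-swap : ∀ {A : Set} (D : A → A → ℕ) p q x y → via D p q x y ≡ via D q p x y
via-swap D p q x y = cong (D x y ⊓_) (ℕ.⊓-comm (D x p ℕ.+ suc (D q y)) (D x q ℕ.+ suc (D p y)))

weights : ℕ → ℕ → ℕ → ℕ → ℕ → ℚ
weights h p q x y = if does (x ℕ.≟ y) then 0ℚ else w (via (L h) p q x y)

weights-≢ : ∀ h p q {x y} → x ≢ y → weights h p q x y ≡ w (via (L h) p q x y)
weights-≢ h p q {x} {y} x≢y rewrite dec-false (x ℕ.≟ y) x≢y = refl

linkPairs : ℕ → ℕ → ℕ → ℕ → ℚ
linkPairs h N p q = pairs N λ x y → w (via (L h) p q x y)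

closeness-distance : ∀ {n} (G : Graph n) {D} → IsDistance G D →
  closeness G ≡ sum {n} λ i → sum {n} λ j → if does (i Fin.≟ j) then 0ℚ else w (D i j)
closeness-distance {n} G {D} isD = sum-cong-≗ {n} λ i → sum-cong-≗ {n} λ j →
  cong (λ d → if does (i Fin.≟ j) then 0ℚ else d)
       (trans (cong weight (IsDistance.dist≡ isD i j)) (2^neg≡w (D i j)))

module _ (h n : ℕ) where
  private N = 2 ℕ.+ h ℕ.+ n

  closeness≡sum : (p q : Fin N) (p≢q : p ≢ q) → closeness (addLink (lollipop (2 ℕ.+ h) n) p q p≢q) ≡
    sum {N} λ i → sum {N} λ j → weights h (toℕ p) (toℕ q) (toℕ i) (toℕ j)
  closeness≡sum p q p≢q = trans
    (closeness-distance (addLink (lollipop (2 ℕ.+ h) n) p q p≢q)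
      (via-isDistance (lollipop (2 ℕ.+ h) n) p q p≢q (L-isDistance h n)))
    (sum-cong-≗ {N} λ i → sum-cong-≗ {N} λ j → entry i j (i Fin.≟ j))
    where
    entry : ∀ i j (i≟j : Dec (i ≡ j)) →
            (if does i≟j then 0ℚ else w (via (L h) (toℕ p) (toℕ q) (toℕ i) (toℕ j)))
            ≡ weights h (toℕ p) (toℕ q) (toℕ i) (toℕ j)
    entry i j (yes i≡j) rewrite dec-true (toℕ i ℕ.≟ toℕ j) (cong toℕ i≡j) = refl
    entry i j (no  i≢j) = sym (weights-≢ h (toℕ p) (toℕ q) (i≢j ∘ toℕ-injective))

  closeness≡pairs : (p q : Fin N) (p≢q : p ≢ q) → closeness (addLink (lollipop (2 ℕ.+ h) n) p q p≢q) ≡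
    linkPairs h N (toℕ p) (toℕ q) + linkPairs h N (toℕ p) (toℕ q)
  closeness≡pairs p q p≢q = begin
    closeness (addLink (lollipop (2 ℕ.+ h) n) p q p≢q)
      ≡⟨ closeness≡sum p q p≢q ⟩
    sum {N} (λ i → sum {N} λ j → F (toℕ i) (toℕ j))
      ≡⟨ sum-cong-≗ {N} (λ i → sum≡∑ N (F (toℕ i))) ⟩
    sum {N} (λ i → ∑ N (F (toℕ i)))
      ≡⟨ sum≡∑ N (λ x → ∑ N (F x)) ⟩
    ∑∑ N N F
      ≡⟨ ∑∑≡pairs N F F-diagonal F-sym ⟩
    pairs N F + pairs N F
      ≡⟨ cong (λ s → s + s) (pairs-cong N λ x y x<y _ → weights-≢ h (toℕ p) (toℕ q) (ℕ.<⇒≢ x<y)) ⟩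
    linkPairs h N (toℕ p) (toℕ q) + linkPairs h N (toℕ p) (toℕ q) ∎
    where
    open ≡-Reasoning
    F = weights h (toℕ p) (toℕ q)
    F-diagonal : ∀ x → F x x ≡ 0ℚ
    F-diagonal x rewrite dec-true (x ℕ.≟ x) refl = refl
    F-sym : ∀ x y → F x y ≡ F y x
    F-sym x y = by-cases (x ℕ.≟ y)
      where
      by-cases : Dec (x ≡ y) → F x y ≡ F y x
      by-cases (yes refl) = refl
      by-cases (no  x≢y)  = trans (weights-≢ h (toℕ p) (toℕ q) x≢y)
        (trans (cong w (via-sym (L h) (L-sym h) (toℕ p) (toℕ q) x y))
          (sym (weights-≢ h (toℕ p) (toℕ q) (x≢y ∘ sym))))

linkPairs-swap : ∀ h N p q → linkPairs h N p q ≡ linkPairs h N q p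
linkPairs-swap h N p q = pairs-cong N λ x y _ _ → cong w (via-swap (L h) p q x y)

L≥1 : ∀ h {x y} → x ℕ.< y → 1 ℕ.≤ L h x y
L≥1 h {x} {y} x<y = ℕ.≤-trans
  (ℕ.⊓-glb ℕ.≤-refl (subst (1 ℕ.≤_) (sym (ℕ.m≤n⇒∣m-n∣≡n∸m (ℕ.<⇒≤ x<y))) (ℕ.m<n⇒0<n∸m x<y)))
  (ℕ.m≤m⊔n (1 ⊓ ∣ x - y ∣) ∣ x ∸ h - y ∸ h ∣)

L-mono : ∀ h {x y z} → x ℕ.< y → y ℕ.≤ z → h ℕ.< z → L h x y ℕ.≤ L h x z
L-mono h {x} {y} {z} x<y y≤z h<z with h ℕ.<? y
... | yes h<y = subst₂ ℕ._≤_ (sym (L-< h x<y h<y)) (sym (L-< h (ℕ.<-≤-trans x<y y≤z) h<z))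
                  (ℕ.∸-monoˡ-≤ (x ∸ h) (ℕ.∸-monoˡ-≤ h y≤z))
... | no  h≮y = subst (ℕ._≤ L h x z) (sym (L-clique h x<y (ℕ.m≤n⇒m≤1+n (ℕ.≮⇒≥ h≮y))))
                  (L≥1 h (ℕ.<-≤-trans x<y y≤z))

L-clone : ∀ h {x} b → x ℕ.≤ h → L h x (suc h ℕ.+ b) ≡ suc b
L-clone h {x} b x≤h = trans (L-< h (s≤s (ℕ.≤-trans x≤h (ℕ.m≤m+n h b))) (s≤s (ℕ.m≤m+n h b)))
  (cong₂ _∸_ (trans (cong (_∸ h) (sym (ℕ.+-suc h b))) (ℕ.m+n∸m≡n h (suc b))) (ℕ.m≤n⇒m∸n≡0 x≤h))

L-+ : ∀ h {x l} e → x ℕ.< l → h ℕ.< l → L h x (l ℕ.+ e) ≡ L h x l ℕ.+ e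
L-+ h {x} {l} e x<l h<l = trans
  (L-< h (ℕ.<-≤-trans x<l (ℕ.m≤m+n l e)) (ℕ.<-≤-trans h<l (ℕ.m≤m+n l e)))
  (trans (cong (_∸ (x ∸ h)) (ℕ.+-∸-comm e (ℕ.<⇒≤ h<l)))
    (trans (ℕ.+-∸-comm e (ℕ.∸-monoˡ-≤ h (ℕ.<⇒≤ x<l))) (cong (ℕ._+ e) (sym (L-< h x<l h<l)))))

via-line : ∀ h {l} → h ℕ.≤ l → ∀ k x y →
           via (L h) l (l ℕ.+ k) (l ℕ.+ x) (l ℕ.+ y) ≡ via ∣_-_∣ 0 k x y
via-line h {l} h≤l k x y = cong₂ _⊓_ (L-line-∣-∣ h h≤l x y)
  (cong₂ _⊓_ (cong₂ (λ a b → a ℕ.+ suc b) at-0 (L-line-∣-∣ h h≤l k y))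
             (cong₂ (λ a b → a ℕ.+ suc b) (L-line-∣-∣ h h≤l x k) from-0))
  where
  at-0 : L h (l ℕ.+ x) l ≡ ∣ x - 0 ∣
  at-0 = trans (cong (L h (l ℕ.+ x)) (sym (ℕ.+-identityʳ l))) (L-line-∣-∣ h h≤l x 0)
  from-0 : L h l (l ℕ.+ y) ≡ ∣ 0 - y ∣
  from-0 = trans (cong (λ z → L h z (l ℕ.+ y)) (sym (ℕ.+-identityʳ l))) (L-line-∣-∣ h h≤l 0 y)

∑-row : ∀ k r → 1 ℕ.≤ k → ∑ (suc k ℕ.+ r) (λ y → w (via ∣_-_∣ 0 k 0 y)) ≡ 1ℚ + C k + ½ * (1ℚ - w r)
∑-row k r 1≤k = trans (∑-++ (suc k) r (λ y → w (via ∣_-_∣ 0 k 0 y)))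
  (cong₂ _+_
    (trans (∑-cong (suc k) {g = λ y → w (y ⊓ (suc k ∸ y))} cycle) (∑-cycle k))
    (trans (∑-cong r λ c _ → cong w (trans (via-cycle-tail k c z≤n) (cong (ℕ._+ suc c) (ℕ.m≥n⇒m⊓n≡n 1≤k))))
      (trans (∑-*ˡ r (w ∘ suc) ½) (cong (½ *_) (∑-w-suc r)))))
  where
  cycle : ∀ y → y ℕ.< suc k → w (via ∣_-_∣ 0 k 0 y) ≡ w (y ⊓ (suc k ∸ y))
  cycle zero    _         = refl
  cycle (suc y) (s≤s y<k) = cong w (via-cycle k (s≤s z≤n) y<k)

-- The near end `l` of the link is a cut vertex, so `L h x l` can be taken out of all three terms of
-- the minimum.
via-left : ∀ h {l} → h ℕ.< l → ∀ k {x} y → x ℕ.< l →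
           via (L h) l (l ℕ.+ k) x (l ℕ.+ y) ≡ L h x l ℕ.+ via ∣_-_∣ 0 k 0 y
via-left h {l} h<l k {x} y x<l = trans
  (cong₂ _⊓_ (L-+ h y x<l h<l) (cong₂ _⊓_
    (cong (λ a → X ℕ.+ suc a) (L-line-∣-∣ h (ℕ.<⇒≤ h<l) k y))
    (trans (cong₂ (λ a b → a ℕ.+ suc b) (L-+ h k x<l h<l) from-0) (ℕ.+-assoc X k (suc y)))))
  (trans (cong ((X ℕ.+ y) ⊓_) (sym (ℕ.+-distribˡ-⊓ X (suc ∣ k - y ∣) (k ℕ.+ suc y))))
         (sym (ℕ.+-distribˡ-⊓ X y (suc ∣ k - y ∣ ⊓ (k ℕ.+ suc y)))))
  where
  X = L h x l
  from-0 : L h l (l ℕ.+ y) ≡ y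
  from-0 = trans (cong (λ z → L h z (l ℕ.+ y)) (sym (ℕ.+-identityʳ l))) (L-line h (ℕ.<⇒≤ h<l) 0 y)

-- A detour over the new link first has to reach `l` or `l + k`, which is already no nearer to `x`
-- than `y` is.
via-left-left : ∀ h {l} → h ℕ.< l → ∀ k {x y} → x ℕ.< y → y ℕ.< l →
                via (L h) l (l ℕ.+ k) x y ≡ L h x y
via-left-left h {l} h<l k x<y y<l = ℕ.m≤n⇒m⊓n≡m (ℕ.⊓-glb
  (ℕ.≤-trans (L-mono h x<y (ℕ.<⇒≤ y<l) h<l) (ℕ.m≤m+n _ _))
  (ℕ.≤-trans (L-mono h x<y (ℕ.≤-trans (ℕ.<⇒≤ y<l) (ℕ.m≤m+n l k)) (ℕ.<-≤-trans h<l (ℕ.m≤m+n l k))) (ℕ.m≤m+n _ _)))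

pairs-left : ∀ h i → pairs (suc h ℕ.+ i) (λ x y → w (L h x y)) ≡
  ι (suc h) * (ι (suc h) - 1ℚ) * ½ * ½ + ι (suc h) * (1ℚ - w i) + (ι i - ι 2 + ι 2 * w i)
pairs-left h i = trans (pairs-++ (suc h) i (λ x y → w (L h x y)))
  (cong₂ _+_ (cong₂ _+_
    (trans (pairs-cong (suc h) λ x y x<y y<1+h → cong w (L-clique h x<y (ℕ.<⇒≤ y<1+h))) (pairs-const (suc h) ½))
    (trans (∑∑-cong (suc h) i λ x y x<1+h _ → cong w (L-clone h y (s≤s⁻¹ x<1+h)))
      (trans (∑-const (suc h) (∑ i (w ∘ suc))) (cong (ι (suc h) *_) (∑-w-suc i)))))
    (trans (pairs-cong i λ x y x<y _ → cong w (line x<y)) (pairs-path i)))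
  where
  line : ∀ {x y} → x ℕ.< y → L h (suc h ℕ.+ x) (suc h ℕ.+ y) ≡ y ∸ x
  line {x} {y} x<y = trans (L-line-∣-∣ h (ℕ.n≤1+n h) x y) (ℕ.m≤n⇒∣m-n∣≡n∸m (ℕ.<⇒≤ x<y))

∑-left : ∀ h i → ∑ (suc h ℕ.+ i) (λ x → w (L h x (suc h ℕ.+ i))) ≡ ι (suc h) * (½ * w i) + (1ℚ - w i)
∑-left h i = trans (∑-++ (suc h) i (λ x → w (L h x (suc h ℕ.+ i))))
  (cong₂ _+_
    (trans (∑-cong (suc h) λ x x<1+h → cong w (L-clone h i (s≤s⁻¹ x<1+h))) (∑-const (suc h) (w (suc i))))
    (trans (∑-cong i λ b b<i → cong w (trans (L-line-∣-∣ h (ℕ.n≤1+n h) b i) (ℕ.m≤n⇒∣m-n∣≡n∸m (ℕ.<⇒≤ b<i))))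
           (∑-w-∸ i)))

-- The graph is cut at `l`, the near end of the link: the vertices before it, their pairs with the
-- rest as a product through `l`, and a cycle with a tail.
linkPairs-path : ∀ h i k r → 1 ℕ.≤ k →
  linkPairs h (suc h ℕ.+ i ℕ.+ (suc k ℕ.+ r)) (suc h ℕ.+ i) (suc h ℕ.+ i ℕ.+ k) ≡
    (ι (suc h) * (ι (suc h) - 1ℚ) * ½ * ½ + ι (suc h) * (1ℚ - w i) + (ι i - ι 2 + ι 2 * w i))
  + (ι (suc h) * (½ * w i) + (1ℚ - w i)) * (1ℚ + C k + ½ * (1ℚ - w r))
  + (½ * ι (suc k) * C k + (1ℚ + C k) * (1ℚ - w r) + (ι r - ι 2 + ι 2 * w r))
linkPairs-path h i k r 1≤k = trans (pairs-++ l (suc k ℕ.+ r) (λ x y → w (via (L h) l (l ℕ.+ k) x y)))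
  (cong₂ _+_ (cong₂ _+_
    (trans (pairs-cong l λ x y x<y y<l → cong w (via-left-left h h<l k x<y y<l)) (pairs-left h i))
    (trans (∑∑-cong l (suc k ℕ.+ r) λ x y x<l _ → trans (cong w (via-left h h<l k y x<l))
                                                         (w-+ (L h x l) (via ∣_-_∣ 0 k 0 y)))
      (trans (∑∑-product l (suc k ℕ.+ r) (λ x → w (L h x l)) (λ y → w (via ∣_-_∣ 0 k 0 y)))
        (cong₂ _*_ (∑-left h i) (∑-row k r 1≤k)))))
    (trans (pairs-cong (suc k ℕ.+ r) λ x y _ _ → cong w (via-line h (ℕ.<⇒≤ h<l) k x y)) (pairs-cycle-tail k r)))
  where
  l = suc h ℕ.+ i
  h<l : h ℕ.< l
  h<l = s≤s (ℕ.m≤m+n h i)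

via-clones : ∀ h q {x y} → x ℕ.< y → y ℕ.< h → via (L h) h q x y ≡ 1
via-clones h q {x} {y} x<y y<h = trans
  (cong (λ z → z ⊓ ((L h x h ℕ.+ suc (L h q y)) ⊓ (L h x q ℕ.+ suc (L h h y))))
    (L-clique h x<y (ℕ.≤-trans (ℕ.<⇒≤ y<h) (ℕ.n≤1+n h))))
  (ℕ.m≤n⇒m⊓n≡m (ℕ.⊓-glb (ℕ.≤-trans (s≤s z≤n) (ℕ.m≤n+m (suc (L h q y)) (L h x h)))
                         (ℕ.≤-trans (s≤s z≤n) (ℕ.m≤n+m (suc (L h h y)) (L h x q)))))

L-h : ∀ h y → L h h (suc h ℕ.+ y) ≡ suc y
L-h h y = L-clone h y ℕ.≤-refl

via-clone-first : ∀ h q {x} → x ℕ.< h → via (L h) h q x h ≡ 1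
via-clone-first h q {x} x<h = trans
  (cong (λ z → z ⊓ ((L h x h ℕ.+ suc (L h q h)) ⊓ (L h x q ℕ.+ suc (L h h h)))) (L-clique h x<h (ℕ.n≤1+n h)))
  (ℕ.m≤n⇒m⊓n≡m (ℕ.⊓-glb (ℕ.≤-trans (s≤s z≤n) (ℕ.m≤n+m (suc (L h q h)) (L h x h)))
                         (ℕ.≤-trans (s≤s z≤n) (ℕ.m≤n+m (suc (L h h h)) (L h x q)))))

-- An earlier clone reaches the far end in two steps through `h`, just as if the link started at the
-- bridge end `suc h`. Its row therefore sees a cycle on `k + 1` vertices, although the link closes
-- one on `k + 2`.
via-clone : ∀ h k {x} y → x ℕ.< h →
            via (L h) h (suc h ℕ.+ k) x (suc h ℕ.+ y) ≡ suc (via ∣_-_∣ 0 k 0 y)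
via-clone h k {x} y x<h = trans
  (cong₂ _⊓_ (L-clone h y (ℕ.<⇒≤ x<h)) (cong₂ _⊓_
    (cong₂ (λ a b → a ℕ.+ suc b) (L-clique h x<h (ℕ.n≤1+n h)) (L-line-∣-∣ h (ℕ.n≤1+n h) k y))
    (cong₂ (λ a b → a ℕ.+ suc b) (L-clone h k (ℕ.<⇒≤ x<h)) (L-h h y))))
  (cong suc (trans (drop-third (k ℕ.+ suc (suc y)) (ℕ.≤-trans (ℕ.≤-trans (ℕ.n≤1+n y) (ℕ.n≤1+n _)) (ℕ.m≤n+m _ k)))
                   (sym (drop-third (k ℕ.+ suc y) (ℕ.≤-trans (ℕ.n≤1+n y) (ℕ.m≤n+m _ k))))))
  where
  -- The route to the far end and back over the link is never the shortest. It is one longer on one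
  -- side than on the other, so it has to go before the sides can agree.
  drop-third : ∀ t → y ℕ.≤ t → y ⊓ (suc ∣ k - y ∣ ⊓ t) ≡ y ⊓ suc ∣ k - y ∣
  drop-third t y≤t = trans (cong (y ⊓_) (ℕ.⊓-comm (suc ∣ k - y ∣) t))
    (trans (sym (ℕ.⊓-assoc y t (suc ∣ k - y ∣))) (cong (_⊓ suc ∣ k - y ∣) (ℕ.m≤n⇒m⊓n≡m y≤t)))

-- The blocks are the `h` earlier clones among themselves, their rows, and the line from clone `h`
-- on, which with the link is a cycle on `k + 2` vertices with a tail.
linkPairs-clone : ∀ h k r → 1 ℕ.≤ k →
  linkPairs h (h ℕ.+ (suc (suc k) ℕ.+ r)) h (h ℕ.+ suc k) ≡
    ι h * (ι h - 1ℚ) * ½ * ½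
  + ι h * (½ + ½ * (1ℚ + C k + ½ * (1ℚ - w r)))
  + (½ * ι (suc (suc k)) * C (suc k) + (1ℚ + C (suc k)) * (1ℚ - w r) + (ι r - ι 2 + ι 2 * w r))
linkPairs-clone h k r 1≤k = trans (pairs-++ h (suc (suc k) ℕ.+ r) (λ x y → w (via (L h) h (h ℕ.+ suc k) x y)))
  (cong₂ _+_ (cong₂ _+_
    (trans (pairs-cong h λ x y x<y y<h → cong w (via-clones h (h ℕ.+ suc k) x<y y<h)) (pairs-const h ½))
    (trans (∑-cong h λ x x<h → row x x<h) (∑-const h _)))
    (trans (pairs-cong (suc (suc k) ℕ.+ r) λ x y _ _ → cong w (via-line h ℕ.≤-refl (suc k) x y))
           (pairs-cycle-tail (suc k) r)))
  where
  row : ∀ x → x ℕ.< h → ∑ (suc (suc k) ℕ.+ r) (λ y → w (via (L h) h (h ℕ.+ suc k) x (h ℕ.+ y)))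
                        ≡ ½ + ½ * (1ℚ + C k + ½ * (1ℚ - w r))
  row x x<h = cong₂ _+_
    (cong w (trans (cong (via (L h) h (h ℕ.+ suc k) x) (ℕ.+-identityʳ h)) (via-clone-first h (h ℕ.+ suc k) x<h)))
    (trans (∑-cong (suc k ℕ.+ r) λ y _ → cong w
             (trans (cong₂ (λ a b → via (L h) h a x b) (ℕ.+-suc h k) (ℕ.+-suc h y)) (via-clone h k y x<h)))
      (trans (∑-*ˡ (suc k ℕ.+ r) (λ y → w (via ∣_-_∣ 0 k 0 y)) ½) (cong (½ *_) (∑-row k r 1≤k))))

-- Comparison of the closed forms

-- Closed forms over any type with ring operations, so that they can be
-- evaluated both in ℚ and in the polynomials of the ring solver.
record Arithmetic (A : Set) : Set where
  infixl 6 _⊕_ _⊖_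
  infixl 7 _⊗_
  field
    _⊕_ _⊖_ _⊗_ : A → A → A
    κ           : ℚ → A

  tailF : (r y : A) → A
  tailF r y = r ⊖ κ (ι 2) ⊕ κ (ι 2) ⊗ y

  cycleF : (K c y r : A) → A
  cycleF K c y r = κ ½ ⊗ K ⊗ c ⊕ (κ 1ℚ ⊕ c) ⊗ (κ 1ℚ ⊖ y) ⊕ tailF r y

  cloneRowF : (c y : A) → A
  cloneRowF c y = κ 1ℚ ⊕ c ⊕ κ ½ ⊗ (κ 1ℚ ⊖ y)

  pathF : (M x i K c y r : A) → A
  pathF M x i K c y r =
      (M ⊗ (M ⊖ κ 1ℚ) ⊗ κ ½ ⊗ κ ½ ⊕ M ⊗ (κ 1ℚ ⊖ x) ⊕ tailF i x)
    ⊕ (M ⊗ (κ ½ ⊗ x) ⊕ (κ 1ℚ ⊖ x)) ⊗ cloneRowF c y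
    ⊕ cycleF K c y r

  cloneF : (h K c c′ y r : A) → A
  cloneF h K c c′ y r =
    h ⊗ (h ⊖ κ 1ℚ) ⊗ κ ½ ⊗ κ ½ ⊕ h ⊗ (κ ½ ⊕ κ ½ ⊗ cloneRowF c y) ⊕ cycleF K c′ y r

  aF : (m n k x z c : A) → A
  aF m n k x z c =
      (m ⊕ κ 1ℚ ⊖ x) ⊗ ((m ⊖ κ 1ℚ) ⊗ κ ½) ⊕ κ (ι 2) ⊗ (n ⊖ k) ⊖ κ (ι 2) ⊕ z
    ⊕ (k ⊕ m ⊕ κ (ι 2) ⊖ z) ⊗ c

ℚ-arithmetic : Arithmetic ℚ
ℚ-arithmetic = record { _⊕_ = _+_ ; _⊖_ = _-_ ; _⊗_ = _*_ ; κ = id }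

polynomials : ∀ {n} → Arithmetic (Polynomial n)
polynomials = record { _⊕_ = _:+_ ; _⊖_ = _:-_ ; _⊗_ = _:*_ ; κ = con }

open Arithmetic ℚ-arithmetic using (pathF; cloneF; aF)
module P {n} = Arithmetic (polynomials {n})

-- Half the closeness of the lollipop with the extra link v_(m+i) v_(m+i+k),
-- where n = i + k + r; for clone it joins v_(m+k) and a clique vertex other
-- than v_m, and n = k + r.
opaque
  path : (h i k r : ℕ) → ℚ
  path h i k r = pathF (ι (suc h)) (w i) (ι i) (ι (suc k)) (C k) (w r) (ι r)

  clone : (h k r : ℕ) → ℚ
  clone h k r = cloneF (ι h) (ι (suc (suc k))) (C k) (C (suc k)) (w r) (ι r)

2^k-[k+r] : ∀ k r → 2^ (+ k ℤ.- + (k ℕ.+ r)) ≡ w r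
2^k-[k+r] k r = begin
  2^ (+ k ℤ.- + (k ℕ.+ r)) ≡⟨ 2^k-n k (k ℕ.+ r) ⟩
  2^ (+ k) * w (k ℕ.+ r)   ≡⟨ cong (2^ (+ k) *_) (w-+ k r) ⟩
  2^ (+ k) * (w k * w r)   ≡⟨ ℚ.*-assoc (2^ (+ k)) (w k) (w r) ⟨
  2^ (+ k) * w k * w r     ≡⟨ cong (_* w r) (2^*w k) ⟩
  1ℚ * w r                 ≡⟨ ℚ.*-identityˡ (w r) ⟩
  w r                      ∎
  where open ≡-Reasoning

2^1+k-n : ∀ k n → 2^ (+ 1 ℤ.+ + k ℤ.- + n) ≡ ι 2 * 2^ (+ k ℤ.- + n)
2^1+k-n k n = trans (cong 2^_ (ℤ.+-assoc (+ 1) (+ k) (ℤ.- (+ n)))) (2^-+ (+ 1) (+ k ℤ.- + n))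

opaque
  unfolding path

  path-a : ∀ h k r → path h 0 k r + path h 0 k r ≡ a (2 ℕ.+ h) (k ℕ.+ r) k
  path-a h k r = begin
    path h 0 k r + path h 0 k r
      ≡⟨ cong₂ (λ M K → f M K + f M K) (ι-suc h) (ι-suc k) ⟩
    f (1ℚ + ι h) (1ℚ + ι k) + f (1ℚ + ι h) (1ℚ + ι k)
      ≡⟨ identity (ι h) (ι k) (C k) (w r) (ι r) ⟩
    aF (ι 2 + ι h) (ι k + ι r) (ι k) (w r) (ι 2 * w r) (C k)
      ≡⟨ cong₂ (λ m n → aF m n (ι k) (w r) (ι 2 * w r) (C k)) (sym (ι-+ 2 h)) (sym (ι-+ k r)) ⟩
    aF (ι (2 ℕ.+ h)) (ι (k ℕ.+ r)) (ι k) (w r) (ι 2 * w r) (C k)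
      ≡⟨ cong₂ (λ x z → aF (ι (2 ℕ.+ h)) (ι (k ℕ.+ r)) (ι k) x z (C k))
           (sym (2^k-[k+r] k r))
           (sym (trans (2^1+k-n k (k ℕ.+ r)) (cong (ι 2 *_) (2^k-[k+r] k r)))) ⟩
    aF (ι (2 ℕ.+ h)) (ι (k ℕ.+ r)) (ι k) (2^ (+ k ℤ.- + (k ℕ.+ r)))
       (2^ (+ 1 ℤ.+ + k ℤ.- + (k ℕ.+ r))) (C k)
      ≡⟨ cong (aF (ι (2 ℕ.+ h)) (ι (k ℕ.+ r)) (ι k) (2^ (+ k ℤ.- + (k ℕ.+ r)))
                  (2^ (+ 1 ℤ.+ + k ℤ.- + (k ℕ.+ r)))) (C≡c k) ⟩
    a (2 ℕ.+ h) (k ℕ.+ r) k ∎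
    where
    open ≡-Reasoning
    f : ℚ → ℚ → ℚ
    f M K = pathF M 1ℚ 0ℚ K (C k) (w r) (ι r)
    identity : ∀ h k c y r →
      pathF (1ℚ + h) 1ℚ 0ℚ (1ℚ + k) c y r + pathF (1ℚ + h) 1ℚ 0ℚ (1ℚ + k) c y r ≡
      aF (ι 2 + h) (k + r) k y (ι 2 * y) c
    identity = solveℚ 5 (λ h k c y r →
      let s = P.pathF (con 1ℚ :+ h) (con 1ℚ) (con 0ℚ) (con 1ℚ :+ k) c y r in
      s :+ s := P.aF (con (ι 2) :+ h) (k :+ r) k y (con (ι 2) :* y) c) refl

0≤C : ∀ k → 0ℚ ≤ C k
0≤C zero          = ℚ.≤-refl
0≤C (suc zero)    = 0≤p (C 1)
0≤C (suc (suc k)) = subst (0ℚ ≤_) (sym (C-+2 k)) (+-nonneg (0≤p 1ℚ) (*-nonneg (0≤p ½) (0≤C k)))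

½≤C : ∀ {k} → 1 ℕ.≤ k → ½ ≤ C k
½≤C {suc zero}    _ = ℚ.≤-refl
½≤C {suc (suc k)} _ = ≤-by (½ + ½ * C k) (+-nonneg (0≤p ½) (*-nonneg (0≤p ½) (0≤C k)))
  (trans (lem (C k)) (sym (C-+2 k)))
  where
  lem : ∀ x → ½ + (½ + ½ * x) ≡ 1ℚ + ½ * x
  lem = solve-∀ ring

0≤1-w : ∀ r → 0ℚ ≤ 1ℚ - w r
0≤1-w r = 0≤q-p (w≤1 r)

opaque
  unfolding path

  -- Sliding the cycle one step towards the clique, while its length is kept.
  path-slide : ∀ h i k r → 1 ℕ.≤ h → 1 ℕ.≤ k → path h (suc i) k r ≤ path h i k (suc r)
  path-slide h i k r 1≤h 1≤k = ≤-by
    ((½ * ½ * ((ι h - 1ℚ) * w i) + ½ * w r) * (C k - ½))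
    (*-nonneg
      (+-nonneg (*-nonneg (0≤p (½ * ½)) (*-nonneg (0≤q-p (ι-mono-≤ 1≤h)) (0≤w i))) (*-nonneg (0≤p ½) (0≤w r)))
      (0≤q-p (½≤C 1≤k)))
    (trans
      (cong₂ (λ M j → pathF M (½ * w i) j (ι (suc k)) (C k) (w r) (ι r) + d) (ι-suc h) (ι-suc i))
      (trans (identity (ι h) (w i) (ι i) (ι (suc k)) (C k) (w r) (ι r))
        (cong₂ (λ M j → pathF M (w i) (ι i) (ι (suc k)) (C k) (½ * w r) j) (sym (ι-suc h)) (sym (ι-suc r)))))
    where
    d : ℚ
    d = (½ * ½ * ((ι h - 1ℚ) * w i) + ½ * w r) * (C k - ½)
    identity : ∀ h x i K c y r →
      pathF (1ℚ + h) (½ * x) (1ℚ + i) K c y r + (½ * ½ * ((h - 1ℚ) * x) + ½ * y) * (c - ½) ≡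
      pathF (1ℚ + h) x i K c (½ * y) (1ℚ + r)
    identity = solveℚ 7 (λ h x i K c y r →
      P.pathF (con 1ℚ :+ h) (con ½ :* x) (con 1ℚ :+ i) K c y r
        :+ (con ½ :* con ½ :* ((h :- con 1ℚ) :* x) :+ con ½ :* y) :* (c :- con ½) :=
      P.pathF (con 1ℚ :+ h) x i K c (con ½ :* y) (con 1ℚ :+ r)) refl

-- Each slide turns one vertex before the cycle into one of the tail, hence the tail length `i + r`
-- in the end.
path-≤ : ∀ h i k r → 1 ℕ.≤ h → 1 ℕ.≤ k → path h i k r ≤ path h 0 k (i ℕ.+ r)
path-≤ h zero    k r 1≤h 1≤k = ℚ.≤-refl
path-≤ h (suc i) k r 1≤h 1≤k = ℚ.≤-trans (path-slide h i k r 1≤h 1≤k)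
  (subst (λ s → path h i k (suc r) ≤ path h 0 k s) (ℕ.+-suc i r) (path-≤ h i k (suc r) 1≤h 1≤k))

Δ : ℕ → ℚ
Δ k = C (suc k) - C k

opaque
  unfolding clone

  -- The `h` other clones contribute equally to both sides, so the balance does not depend on m. It
  -- compares a single clone as a vertex of the cycle on `k + 2` vertices with the same clone hung
  -- onto a cycle on `k + 1` vertices.
  clone-path : ∀ h k r → clone h k r + (½ + ½ * ½ * (1ℚ - w r)) ≡
    path h 0 k r + (½ * (ι 2 + ι k) + (1ℚ - w r)) * Δ k
  clone-path h k r = trans
    (cong (λ K → cloneF (ι h) K (C k) (C (suc k)) (w r) (ι r) + (½ + ½ * ½ * (1ℚ - w r))) (ι-+ 2 k))
    (trans (identity (ι h) (ι k) (C k) (C (suc k)) (w r) (ι r))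
      (cong₂ (λ M K → pathF M 1ℚ 0ℚ K (C k) (w r) (ι r) + (½ * (ι 2 + ι k) + (1ℚ - w r)) * Δ k)
        (sym (ι-suc h)) (sym (ι-suc k))))
    where
    identity : ∀ h k c c′ y r →
      cloneF h (ι 2 + k) c c′ y r + (½ + ½ * ½ * (1ℚ - y)) ≡
      pathF (1ℚ + h) 1ℚ 0ℚ (1ℚ + k) c y r + (½ * (ι 2 + k) + (1ℚ - y)) * (c′ - c)
    identity = solveℚ 6 (λ h k c c′ y r →
      P.cloneF h (con (ι 2) :+ k) c c′ y r :+ (con ½ :+ con ½ :* con ½ :* (con 1ℚ :- y)) :=
      P.pathF (con 1ℚ :+ h) (con 1ℚ) (con 0ℚ) (con 1ℚ :+ k) c y r
        :+ (con ½ :* (con (ι 2) :+ k) :+ (con 1ℚ :- y)) :* (c′ :- c)) refl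

Δ-+2 : ∀ k → Δ (2 ℕ.+ k) ≡ ½ * Δ k
Δ-+2 k = trans (cong₂ _-_ (C-+2 (suc k)) (C-+2 k)) (lem (C (suc k)) (C k))
  where
  lem : ∀ x y → 1ℚ + ½ * x - (1ℚ + ½ * y) ≡ ½ * (x - y)
  lem = solve-∀ ring

-- The upper bounds keep the gain in `clone-path` below the loss, term by term: ½ against ½, and ¼
-- against ¼ as coefficients of `1ℚ - w r`. Nonnegativity carries the induction.
SmallΔ : ℕ → Set
SmallΔ k = 0ℚ ≤ Δ k × Δ k ≤ ½ * ½ × (ι 2 + ι k) * Δ k ≤ 1ℚ

smallΔ-+2 : ∀ k → SmallΔ k → SmallΔ (2 ℕ.+ k)
smallΔ-+2 k (0≤Δ , Δ≤¼ , kΔ≤1) =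
    subst (0ℚ ≤_) (sym (Δ-+2 k)) 0≤½Δ
  , ℚ.≤-trans (≤-by (½ * Δ k) 0≤½Δ (trans (cong (_+ ½ * Δ k) (Δ-+2 k)) (halves (Δ k)))) Δ≤¼
  , ℚ.≤-trans
      (≤-by (½ * (ι k * Δ k)) (*-nonneg (0≤p ½) (*-nonneg (0≤ι k) 0≤Δ))
        (trans (cong₂ (λ K δ → (ι 2 + K) * δ + ½ * (ι k * Δ k)) (ι-+ 2 k) (Δ-+2 k)) (lem (ι k) (Δ k))))
      kΔ≤1
  where
  0≤½Δ = *-nonneg (0≤p ½) 0≤Δ
  halves : ∀ x → ½ * x + ½ * x ≡ x
  halves = solve-∀ ring
  lem : ∀ k δ → (ι 2 + (ι 2 + k)) * (½ * δ) + ½ * (k * δ) ≡ (ι 2 + k) * δ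
  lem = solve-∀ ring

smallΔ : ∀ k → 2 ℕ.≤ k → k ≢ 3 → SmallΔ k
smallΔ 2 _ _ = 0≤p (Δ 2) , ℚ.≤-refl , ℚ.≤-refl
smallΔ 3 _ 3≢3 = contradiction refl 3≢3
smallΔ 4 _ _ = smallΔ-+2 2 (smallΔ 2 (s≤s (s≤s z≤n)) λ ())
-- The odd numbers start at 5 because `(ι 2 + ι 3) * Δ 3` is 5/4.
smallΔ 5 _ _ = 0≤p (Δ 5) , ≤-by (½ * ½ * ½) (0≤p _) refl , ≤-by (½ * ½ * ½) (0≤p _) refl
smallΔ (suc (suc k@(suc (suc (suc (suc _)))))) _ _ = smallΔ-+2 k (smallΔ k (s≤s (s≤s z≤n)) λ ())
smallΔ zero () _
smallΔ (suc zero) (s≤s ()) _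

clone-≤ : ∀ h k r → 2 ℕ.≤ k → k ≢ 3 → clone h k r ≤ path h 0 k r
clone-≤ h k r 2≤k k≢3 with 0≤Δ , Δ≤¼ , kΔ≤1 ← smallΔ k 2≤k k≢3 = ≤-by
  (½ * (1ℚ - (ι 2 + ι k) * Δ k) + (1ℚ - w r) * (½ * ½ - Δ k))
  (+-nonneg (*-nonneg (0≤p ½) (0≤q-p kΔ≤1)) (*-nonneg (0≤1-w r) (0≤q-p Δ≤¼)))
  (trans (lem₁ (clone h k r) (½ + ½ * ½ * (1ℚ - w r)) (½ * (1ℚ - (ι 2 + ι k) * Δ k) + (1ℚ - w r) * (½ * ½ - Δ k)))
    (trans (cong (_+ (½ * (1ℚ - (ι 2 + ι k) * Δ k) + (1ℚ - w r) * (½ * ½ - Δ k) - (½ + ½ * ½ * (1ℚ - w r))))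
             (clone-path h k r))
      (lem₂ (path h 0 k r) (ι k) (w r) (Δ k))))
  where
  lem₁ : ∀ c s d → c + d ≡ c + s + (d - s)
  lem₁ = solve-∀ ring
  lem₂ : ∀ p k y δ → p + (½ * (ι 2 + k) + (1ℚ - y)) * δ
    + (½ * (1ℚ - (ι 2 + k) * δ) + (1ℚ - y) * (½ * ½ - δ) - (½ + ½ * ½ * (1ℚ - y))) ≡ p
  lem₂ = solve-∀ ring

⅛ : ℚ
⅛ = ½ * ½ * ½

-- With `Δ 3` equal to ¼ the terms in `w r` cancel in `clone-path`, leaving 5/8 against ½.
clone-3 : ∀ h r → clone h 3 r ≡ path h 0 3 r + ⅛
clone-3 h r = trans (lem₁ (clone h 3 r) (½ + ½ * ½ * (1ℚ - w r)))
  (trans (cong (_- (½ + ½ * ½ * (1ℚ - w r))) (clone-path h 3 r)) (lem₂ (path h 0 3 r) (w r)))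
  where
  lem₁ : ∀ c s → c ≡ c + s - s
  lem₁ = solve-∀ ring
  lem₂ : ∀ p y → p + (½ * (ι 2 + ι 3) + (1ℚ - y)) * Δ 3 - (½ + ½ * ½ * (1ℚ - y)) ≡ p + ⅛
  lem₂ = solve-∀ ring

opaque
  unfolding clone

  -- Both links close a triangle. The one at the bridge end has its triangle one step further along
  -- the path and a tail shorter by one.
  clone-1 : ∀ h r → clone h 1 (suc r) ≤ path h 0 2 r
  clone-1 h r = ≤-by
    (½ * ½ * (ι h * (1ℚ - w r)) + ½ * ½ * ½ * (ι h * w r) + ½ * ½ * (1ℚ - w r))
    (+-nonneg (+-nonneg (*-nonneg (0≤p (½ * ½)) (*-nonneg (0≤ι h) (0≤1-w r)))
                        (*-nonneg (0≤p ⅛) (*-nonneg (0≤ι h) (0≤w r))))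
              (*-nonneg (0≤p (½ * ½)) (0≤1-w r)))
    (trans (cong (λ j → cloneF (ι h) (ι 3) (C 1) (C 2) (½ * w r) j + d) (ι-suc r))
      (trans (identity (ι h) (w r) (ι r))
        (cong (λ M → pathF M 1ℚ 0ℚ (ι 3) (C 2) (w r) (ι r)) (sym (ι-suc h)))))
    where
    d : ℚ
    d = ½ * ½ * (ι h * (1ℚ - w r)) + ½ * ½ * ½ * (ι h * w r) + ½ * ½ * (1ℚ - w r)
    identity : ∀ h y r → cloneF h (ι 3) (C 1) (C 2) (½ * y) (1ℚ + r)
        + (½ * ½ * (h * (1ℚ - y)) + ½ * ½ * ½ * (h * y) + ½ * ½ * (1ℚ - y)) ≡
      pathF (1ℚ + h) 1ℚ 0ℚ (ι 3) (C 2) y r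
    identity = solveℚ 3 (λ h y r → P.cloneF h (con (ι 3)) (con (C 1)) (con (C 2)) (con ½ :* y) (con 1ℚ :+ r)
        :+ (con ½ :* con ½ :* (h :* (con 1ℚ :- y)) :+ con ½ :* con ½ :* con ½ :* (h :* y)
            :+ con ½ :* con ½ :* (con 1ℚ :- y)) :=
      P.pathF (con 1ℚ :+ h) (con 1ℚ) (con 0ℚ) (con (ι 3)) (con (C 2)) y r) refl

  -- The ⅛ is the surplus from `clone-3`. The inequality is tightest at r = 0, where 1/16 is left
  -- for every `h`.
  path-3-5 : ∀ h r → path h 0 3 (2 ℕ.+ r) + ⅛ ≤ path h 0 5 r
  path-3-5 h r = ≤-by
    (ι 3 * (½ * ⅛) * (ι h * (1ℚ - w r)) + ι 3 * (½ * ½) * (1ℚ - w r) + ½ * ⅛)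
    (+-nonneg (+-nonneg (*-nonneg (0≤p (ι 3 * (½ * ⅛))) (*-nonneg (0≤ι h) (0≤1-w r)))
                        (*-nonneg (0≤p (ι 3 * (½ * ½))) (0≤1-w r)))
              (0≤p (½ * ⅛)))
    (trans (cong₂ (λ M j → pathF M 1ℚ 0ℚ (ι 4) (C 3) (½ * (½ * w r)) j + ⅛ + d) (ι-suc h) (ι-+ 2 r))
      (trans (identity (ι h) (w r) (ι r))
        (cong (λ M → pathF M 1ℚ 0ℚ (ι 6) (C 5) (w r) (ι r)) (sym (ι-suc h)))))
    where
    d : ℚ
    d = ι 3 * (½ * ⅛) * (ι h * (1ℚ - w r)) + ι 3 * (½ * ½) * (1ℚ - w r) + ½ * ⅛
    identity : ∀ h y r → pathF (1ℚ + h) 1ℚ 0ℚ (ι 4) (C 3) (½ * (½ * y)) (ι 2 + r) + ⅛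
        + (ι 3 * (½ * ⅛) * (h * (1ℚ - y)) + ι 3 * (½ * ½) * (1ℚ - y) + ½ * ⅛) ≡
      pathF (1ℚ + h) 1ℚ 0ℚ (ι 6) (C 5) y r
    identity = solveℚ 3 (λ h y r →
      P.pathF (con 1ℚ :+ h) (con 1ℚ) (con 0ℚ) (con (ι 4)) (con (C 3)) (con ½ :* (con ½ :* y)) (con (ι 2) :+ r) :+ con ⅛
        :+ (con (ι 3) :* (con ½ :* con ⅛) :* (h :* (con 1ℚ :- y)) :+ con (ι 3) :* (con ½ :* con ½) :* (con 1ℚ :- y)
            :+ con ½ :* con ⅛) :=
      P.pathF (con 1ℚ :+ h) (con 1ℚ) (con 0ℚ) (con (ι 6)) (con (C 5)) y r) refl

-- Symmetry of the clones and classification of the new links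

L-cong : ∀ h {x y x′ y′} → (x ≡ y → x′ ≡ y′) → (x′ ≡ y′ → x ≡ y) →
         x ∸ h ≡ x′ ∸ h → y ∸ h ≡ y′ ∸ h → L h x y ≡ L h x′ y′
L-cong h {x} {y} {x′} {y′} to from px py =
  cong₂ _⊔_ (by-cases (x ℕ.≟ y)) (cong₂ ∣_-_∣ px py)
  where
  distinct : ∀ {x y} → x ≢ y → 1 ⊓ ∣ x - y ∣ ≡ 1
  distinct x≢y = ℕ.m≤n⇒m⊓n≡m (ℕ.n≢0⇒n>0 (x≢y ∘ ℕ.∣m-n∣≡0⇒m≡n))
  by-cases : Dec (x ≡ y) → 1 ⊓ ∣ x - y ∣ ≡ 1 ⊓ ∣ x′ - y′ ∣
  by-cases (yes x≡y) = trans (cong (1 ⊓_) (ℕ.m≡n⇒∣m-n∣≡0 x≡y)) (cong (1 ⊓_) (sym (ℕ.m≡n⇒∣m-n∣≡0 (to x≡y))))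
  by-cases (no  x≢y) = trans (distinct x≢y) (sym (distinct (x≢y ∘ from)))

sum-sum-permute : ∀ {N} (V W : Fin N → Fin N → ℚ) (π : Permutation N N) →
  (∀ i j → V i j ≡ W (π ⟨$⟩ʳ i) (π ⟨$⟩ʳ j)) →
  sum {N} (λ i → sum {N} λ j → V i j) ≡ sum {N} (λ i → sum {N} λ j → W i j)
sum-sum-permute {N} V W π V≡W = trans
  (sum-cong-≗ {N} λ i → trans (sum-cong-≗ {N} (V≡W i)) (sym (sum-permute (W (π ⟨$⟩ʳ i)) π)))
  (sym (sum-permute (λ i → sum {N} λ j → W i j) π))

module _ {N : ℕ} (p q : Fin N) where
  private π = Perm.transpose p q

  transpose-fst : π ⟨$⟩ʳ p ≡ q
  transpose-fst rewrite dec-true (p Fin.≟ p) refl = refl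

  transpose-other : ∀ {r} → r ≢ p → r ≢ q → π ⟨$⟩ʳ r ≡ r
  transpose-other {r} r≢p r≢q rewrite dec-false (r Fin.≟ p) r≢p | dec-false (r Fin.≟ q) r≢q = refl

  transpose-cases : ∀ r → (r ≡ p × π ⟨$⟩ʳ r ≡ q) ⊎ (r ≡ q × π ⟨$⟩ʳ r ≡ p) ⊎ π ⟨$⟩ʳ r ≡ r
  transpose-cases r with r Fin.≟ p
  ... | yes r≡p = inj₁ (r≡p , refl)
  ... | no  _ with r Fin.≟ q
  ...   | yes r≡q = inj₂ (inj₁ (r≡q , refl))
  ...   | no  _   = inj₂ (inj₂ refl)

opaque
  unfolding path clone

  linkPairs≡path : ∀ h i k r → 1 ℕ.≤ k →
    linkPairs h (suc h ℕ.+ i ℕ.+ (suc k ℕ.+ r)) (suc h ℕ.+ i) (suc h ℕ.+ i ℕ.+ k) ≡ path h i k r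
  linkPairs≡path = linkPairs-path

  linkPairs≡clone : ∀ h k r → 1 ℕ.≤ k →
    linkPairs h (h ℕ.+ (suc (suc k) ℕ.+ r)) h (h ℕ.+ suc k) ≡ clone h k r
  linkPairs≡clone = linkPairs-clone

module _ (h n : ℕ) where
  private
    N = 2 ℕ.+ h ℕ.+ n
    G = lollipop (2 ℕ.+ h) n
    module G = Graph G

  closeness-path : ∀ i k r → n ≡ i ℕ.+ k ℕ.+ r → 1 ℕ.≤ k → (p q : Fin N) (p≢q : p ≢ q) →
    toℕ p ≡ suc h ℕ.+ i → toℕ q ≡ suc h ℕ.+ i ℕ.+ k →
    closeness (addLink G p q p≢q) ≡ path h i k r + path h i k r
  closeness-path i k r n≡ 1≤k p q p≢q p≡ q≡ = trans (closeness≡pairs h n p q p≢q)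
    (cong (λ s → s + s) (trans (cong₂ (linkPairs h N) p≡ q≡)
      (trans (cong (λ M → linkPairs h M (suc h ℕ.+ i) (suc h ℕ.+ i ℕ.+ k)) size) (linkPairs≡path h i k r 1≤k))))
    where
    open ≡-Reasoning
    size : N ≡ suc h ℕ.+ i ℕ.+ (suc k ℕ.+ r)
    size = cong suc (begin
      suc (h ℕ.+ n)                 ≡⟨ ℕ.+-suc h n ⟨
      h ℕ.+ suc n                   ≡⟨ cong (λ z → h ℕ.+ suc z) (trans n≡ (ℕ.+-assoc i k r)) ⟩
      h ℕ.+ suc (i ℕ.+ (k ℕ.+ r))   ≡⟨ cong (h ℕ.+_) (ℕ.+-suc i (k ℕ.+ r)) ⟨
      h ℕ.+ (i ℕ.+ (suc k ℕ.+ r))   ≡⟨ ℕ.+-assoc h i (suc k ℕ.+ r) ⟨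
      h ℕ.+ i ℕ.+ (suc k ℕ.+ r)     ∎)

  private
    -- `L` depends only on equality and on positions, so exchanging two clones is an isometry; it
    -- fixes `q`, which is not a clone.
    closeness-transpose : (p q : Fin N) (p≢q : p ≢ q) → toℕ p ℕ.≤ h → h ℕ.< toℕ q →
      ∀ p′ → toℕ p′ ≡ h → ∀ p′≢q →
      closeness (addLink G p q p≢q) ≡ closeness (addLink G p′ q p′≢q)
    closeness-transpose p q p≢q p≤h h<q p′ p′≡h p′≢q = begin
      closeness (addLink G p q p≢q)
        ≡⟨ closeness≡sum h n p q p≢q ⟩
      sum {N} (λ i → sum {N} λ j → weights h (toℕ p) (toℕ q) (toℕ i) (toℕ j))
        ≡⟨ sum-sum-permute (λ i j → weights h (toℕ p) (toℕ q) (toℕ i) (toℕ j)) W π (λ i j → entry i j (i Fin.≟ j)) ⟩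
      sum {N} (λ i → sum {N} λ j → W i j)
        ≡⟨ closeness≡sum h n p′ q p′≢q ⟨
      closeness (addLink G p′ q p′≢q) ∎
      where
      open ≡-Reasoning
      π = Perm.transpose p p′
      W : Fin N → Fin N → ℚ
      W i j = weights h (toℕ p′) (toℕ q) (toℕ i) (toℕ j)

      π-injective : ∀ {i j} → π ⟨$⟩ʳ i ≡ π ⟨$⟩ʳ j → i ≡ j
      π-injective eq = trans (sym (Perm.inverseˡ π)) (trans (cong (π ⟨$⟩ˡ_) eq) (Perm.inverseˡ π))

      p∼p′ : toℕ p ∸ h ≡ toℕ p′ ∸ h
      p∼p′ = trans (ℕ.m≤n⇒m∸n≡0 p≤h) (sym (ℕ.m≤n⇒m∸n≡0 (ℕ.≤-reflexive p′≡h)))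

      position : ∀ i → toℕ i ∸ h ≡ toℕ (π ⟨$⟩ʳ i) ∸ h
      position i with transpose-cases p p′ i
      ... | inj₁ (refl , eq)        = trans p∼p′ (cong (λ x → toℕ x ∸ h) (sym eq))
      ... | inj₂ (inj₁ (refl , eq)) = trans (sym p∼p′) (cong (λ x → toℕ x ∸ h) (sym eq))
      ... | inj₂ (inj₂ eq)          = cong (λ x → toℕ x ∸ h) (sym eq)

      L-π : ∀ i j → L h (toℕ i) (toℕ j) ≡ L h (toℕ (π ⟨$⟩ʳ i)) (toℕ (π ⟨$⟩ʳ j))
      L-π i j = L-cong h (cong (toℕ ∘ (π ⟨$⟩ʳ_)) ∘ toℕ-injective) (cong toℕ ∘ π-injective ∘ toℕ-injective)
                  (position i) (position j)

      πp : π ⟨$⟩ʳ p ≡ p′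
      πp = transpose-fst p p′
      πq : π ⟨$⟩ʳ q ≡ q
      πq = transpose-other p p′ (p≢q ∘ sym) (p′≢q ∘ sym)

      entry : ∀ i j → Dec (i ≡ j) → weights h (toℕ p) (toℕ q) (toℕ i) (toℕ j) ≡ W (π ⟨$⟩ʳ i) (π ⟨$⟩ʳ j)
      entry i j (yes refl)
        rewrite dec-true (toℕ i ℕ.≟ toℕ i) refl | dec-true (toℕ (π ⟨$⟩ʳ i) ℕ.≟ toℕ (π ⟨$⟩ʳ i)) refl = refl
      entry i j (no  i≢j) = trans (weights-≢ h (toℕ p) (toℕ q) (i≢j ∘ toℕ-injective))
        (trans (cong w (cong₂ _⊓_ (L-π i j) (cong₂ _⊓_
                 (cong₂ (λ x y → x ℕ.+ suc y) (trans (L-π i p) (cong (L h (toℕ (π ⟨$⟩ʳ i)) ∘ toℕ) πp))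
                                              (trans (L-π q j) (cong (λ x → L h (toℕ x) (toℕ (π ⟨$⟩ʳ j))) πq)))
                 (cong₂ (λ x y → x ℕ.+ suc y) (trans (L-π i q) (cong (L h (toℕ (π ⟨$⟩ʳ i)) ∘ toℕ) πq))
                                              (trans (L-π p j) (cong (λ x → L h (toℕ x) (toℕ (π ⟨$⟩ʳ j))) πp))))))
          (sym (weights-≢ h (toℕ p′) (toℕ q) (i≢j ∘ π-injective ∘ toℕ-injective))))

    closeness-last-clone : ∀ k r → n ≡ k ℕ.+ r → 1 ℕ.≤ k → (p q : Fin N) (p≢q : p ≢ q) →
      toℕ p ≡ h → toℕ q ≡ suc h ℕ.+ k →
      closeness (addLink G p q p≢q) ≡ clone h k r + clone h k r
    closeness-last-clone k r n≡ 1≤k p q p≢q p≡ q≡ = trans (closeness≡pairs h n p q p≢q)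
      (cong (λ s → s + s) (trans (cong₂ (linkPairs h N) p≡ (trans q≡ (sym (ℕ.+-suc h k))))
        (trans (cong (λ M → linkPairs h M h (h ℕ.+ suc k)) size) (linkPairs≡clone h k r 1≤k))))
      where
      size : N ≡ h ℕ.+ (suc (suc k) ℕ.+ r)
      size = trans (cong (λ z → suc (suc (h ℕ.+ z))) n≡)
        (trans (cong suc (sym (ℕ.+-suc h (k ℕ.+ r)))) (sym (ℕ.+-suc h (suc k ℕ.+ r))))

  -- The line of integers starts at the last clone, so the link is first moved there by a
  -- transposition.
  closeness-clone : ∀ k r → n ≡ k ℕ.+ r → 1 ℕ.≤ k → (p q : Fin N) (p≢q : p ≢ q) →
    toℕ p ℕ.≤ h → toℕ q ≡ suc h ℕ.+ k →
    closeness (addLink G p q p≢q) ≡ clone h k r + clone h k r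
  closeness-clone k r n≡ 1≤k p q p≢q p≤h q≡ = via-last (fromℕ< h<N) (toℕ-fromℕ< h<N)
    where
    h<q : h ℕ.< toℕ q
    h<q = subst (h ℕ.<_) (sym q≡) (s≤s (ℕ.m≤m+n h k))
    h<N : h ℕ.< N
    h<N = s≤s (ℕ.≤-trans (ℕ.m≤m+n h n) (ℕ.n≤1+n _))
    via-last : ∀ p′ → toℕ p′ ≡ h → closeness (addLink G p q p≢q) ≡ clone h k r + clone h k r
    via-last p′ p′≡h = trans (closeness-transpose p q p≢q p≤h h<q p′ p′≡h p′≢q)
                             (closeness-last-clone k r n≡ 1≤k p′ q p′≢q p′≡h q≡)
      where
      p′≢q : p′ ≢ q
      p′≢q eq = ℕ.<-irrefl (trans (sym p′≡h) (cong toℕ eq)) h<q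

  -- Up to the order of the ends, either no end is a clone or exactly one is. Clones are adjacent to
  -- each other and to the bridge end, whence `1 ≤ k` in the second case; consecutive vertices of
  -- the line are adjacent, whence `2 ≤ k` in the first.
  data Shape (x : ℚ) : Set where
    on-path : ∀ i k r → n ≡ i ℕ.+ k ℕ.+ r → 2 ℕ.≤ k → x ≡ path h i k r + path h i k r → Shape x
    on-clone : ∀ k r → n ≡ k ℕ.+ r → 1 ℕ.≤ k → x ≡ clone h k r + clone h k r → Shape x

  private
    shape-< : ∀ p q p≢q → ¬ G.Adj p q → toℕ p ℕ.< toℕ q → Shape (closeness (addLink G p q p≢q))
    shape-< p q p≢q ¬adj p<q = by-cases (toℕ p ℕ.≤? h)
      where
      1+h<q : suc h ℕ.< toℕ q
      1+h<q = ℕ.≰⇒> λ q≤1+h → ¬adj (inj₁ (inj₁ (s≤s p<q , s≤s q≤1+h)))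

      at-clone : toℕ p ℕ.≤ h → Shape (closeness (addLink G p q p≢q))
      at-clone p≤h = on-clone k (n ∸ k) n≡ 1≤k
        (closeness-clone k (n ∸ k) n≡ 1≤k p q p≢q p≤h (sym (ℕ.m+[n∸m]≡n (ℕ.<⇒≤ 1+h<q))))
        where
        k = toℕ q ∸ suc h
        1≤k : 1 ℕ.≤ k
        1≤k = ℕ.m<n⇒0<n∸m 1+h<q
        k≤n : k ℕ.≤ n
        k≤n = ℕ.≤-trans (ℕ.∸-monoˡ-≤ (suc h) (s≤s⁻¹ (toℕ<n q))) (ℕ.≤-reflexive (ℕ.m+n∸m≡n (suc h) n))
        n≡ : n ≡ k ℕ.+ (n ∸ k)
        n≡ = sym (ℕ.m+[n∸m]≡n k≤n)

      at-path : h ℕ.< toℕ p → Shape (closeness (addLink G p q p≢q))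
      at-path h<p = on-path i k (n ∸ (i ℕ.+ k)) n≡ 2≤k
        (closeness-path i k (n ∸ (i ℕ.+ k)) n≡ (ℕ.<⇒≤ 2≤k) p q p≢q (sym p≡) (sym (trans (cong (ℕ._+ k) p≡) q≡)))
        where
        i = toℕ p ∸ suc h
        k = toℕ q ∸ toℕ p
        p≡ : suc h ℕ.+ i ≡ toℕ p
        p≡ = ℕ.m+[n∸m]≡n h<p
        q≡ : toℕ p ℕ.+ k ≡ toℕ q
        q≡ = ℕ.m+[n∸m]≡n (ℕ.<⇒≤ p<q)
        i+k≤n : i ℕ.+ k ℕ.≤ n
        i+k≤n = ℕ.+-cancelˡ-≤ (suc h) (i ℕ.+ k) n (subst (ℕ._≤ suc h ℕ.+ n)
          (trans (sym q≡) (trans (cong (ℕ._+ k) (sym p≡)) (ℕ.+-assoc (suc h) i k))) (s≤s⁻¹ (toℕ<n q)))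
        n≡ : n ≡ i ℕ.+ k ℕ.+ (n ∸ (i ℕ.+ k))
        n≡ = sym (ℕ.m+[n∸m]≡n i+k≤n)
        2≤k : 2 ℕ.≤ k
        2≤k = ℕ.≤∧≢⇒< (ℕ.m<n⇒0<n∸m p<q) λ 1≡k → ¬adj (adj-next h n (ℕ.<⇒≤ h<p)
          (trans (sym q≡) (trans (cong (toℕ p ℕ.+_) (sym 1≡k)) (ℕ.+-comm (toℕ p) 1))))

      by-cases : Dec (toℕ p ℕ.≤ h) → Shape (closeness (addLink G p q p≢q))
      by-cases (yes p≤h) = at-clone p≤h
      by-cases (no  p≰h) = at-path (ℕ.≰⇒> p≰h)

    closeness-swap : ∀ p q p≢q q≢p → closeness (addLink G q p q≢p) ≡ closeness (addLink G p q p≢q)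
    closeness-swap p q p≢q q≢p = doubles (closeness≡pairs h n q p q≢p) (closeness≡pairs h n p q p≢q)
                                         (linkPairs-swap h N (toℕ q) (toℕ p))
      where
      doubles : ∀ {x y s t : ℚ} → x ≡ s + s → y ≡ t + t → s ≡ t → x ≡ y
      doubles refl refl refl = refl

  shape : ∀ p q p≢q → ¬ G.Adj p q → Shape (closeness (addLink G p q p≢q))
  shape p q p≢q ¬adj = by-cases (ℕ.<-cmp (toℕ p) (toℕ q))
    where
    by-cases : Tri (toℕ p ℕ.< toℕ q) (toℕ p ≡ toℕ q) (toℕ q ℕ.< toℕ p) → Shape (closeness (addLink G p q p≢q))
    by-cases (tri< p<q _ _) = shape-< p q p≢q ¬adj p<q
    by-cases (tri≈ _ p≡q _) = contradiction (toℕ-injective p≡q) p≢q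
    by-cases (tri> _ _ q<p) = subst Shape (closeness-swap p q p≢q q≢p) (shape-< q p q≢p (¬adj ∘ swap) q<p)
      where
      q≢p : q ≢ p
      q≢p = p≢q ∘ sym

-- Upper bounds by links at the bridge end, and attained values

¼ : ℚ
¼ = ½ * ½

opaque
  hubLink : (h n k : ℕ) → ℚ
  hubLink h n k = a (2 ℕ.+ h) n k

  hubLink≡a : ∀ h n k → hubLink h n k ≡ a (2 ℕ.+ h) n k
  hubLink≡a h n k = refl

  path≡hubLink : ∀ h n k r → n ≡ k ℕ.+ r → path h 0 k r + path h 0 k r ≡ hubLink h n k
  path≡hubLink h n k r refl = path-a h k r

Attained : ∀ {N} → Graph N → ℚ → Set
Attained {N} G x = ∃[ p ] ∃[ q ] Σ[ p≢q ∈ p ≢ q ] ¬ Graph.Adj G p q × x ≡ closeness (addLink G p q p≢q)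

module _ (h n : ℕ) where
  private
    m = 2 ℕ.+ h
    N = 2 ℕ.+ h ℕ.+ n
    G = lollipop (2 ℕ.+ h) n

  -- The clone link with k = 3 is recorded exactly instead of being bounded: for n = 3 it is the
  -- maximum, and for n = 4 it ties with a(4).
  bound : 1 ℕ.≤ h → 2 ℕ.≤ n → ∀ {x} → Shape h n x →
    ∃[ k ] 2 ℕ.≤ k × k ℕ.≤ n × (x ≤ hubLink h n k ⊎ (k ≡ 3 × x ≡ hubLink h n 3 + ¼))
  bound 1≤h 2≤n (on-path i k r n≡ 2≤k refl) = k , 2≤k , k≤n , inj₁
    (subst (path h i k r + path h i k r ≤_) (path≡hubLink h n k (i ℕ.+ r) n≡′)
      (ℚ.+-mono-≤ (path-≤ h i k r 1≤h 1≤k) (path-≤ h i k r 1≤h 1≤k)))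
    where
    1≤k = ℕ.<⇒≤ 2≤k
    n≡′ : n ≡ k ℕ.+ (i ℕ.+ r)
    n≡′ = trans n≡ (trans (cong (ℕ._+ r) (ℕ.+-comm i k)) (ℕ.+-assoc k i r))
    k≤n : k ℕ.≤ n
    k≤n = subst (k ℕ.≤_) (sym n≡′) (ℕ.m≤m+n k (i ℕ.+ r))
  bound 1≤h 2≤n (on-clone 1 (suc r) n≡ _ refl) = 2 , ℕ.≤-refl , 2≤n , inj₁
    (subst (clone h 1 (suc r) + clone h 1 (suc r) ≤_) (path≡hubLink h n 2 r n≡)
      (ℚ.+-mono-≤ (clone-1 h r) (clone-1 h r)))
  bound 1≤h (s≤s ()) (on-clone 1 zero refl _ refl)
  bound 1≤h 2≤n (on-clone k@(suc (suc k-2)) r n≡ _ refl) with k ℕ.≟ 3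
  ... | yes refl = 3 , s≤s (s≤s z≤n) , subst (3 ℕ.≤_) (sym n≡) (ℕ.m≤m+n 3 r) , inj₂ (refl ,
    trans (cong (λ c → c + c) (clone-3 h r))
      (trans (halves (path h 0 3 r)) (cong (_+ ¼) (path≡hubLink h n 3 r n≡))))
    where
    halves : ∀ p → (p + ⅛) + (p + ⅛) ≡ p + p + ¼
    halves = solve-∀ ring
  ... | no k≢3 = k , 2≤k , subst (k ℕ.≤_) (sym n≡) (ℕ.m≤m+n k r) , inj₁
    (subst (clone h k r + clone h k r ≤_) (path≡hubLink h n k r n≡)
      (ℚ.+-mono-≤ (clone-≤ h k r 2≤k k≢3) (clone-≤ h k r 2≤k k≢3)))
    where 2≤k = s≤s (s≤s z≤n)

  closeness-a : ∀ k → 2 ℕ.≤ k → k ℕ.≤ n → (p q : Fin N) (p≢q : p ≢ q) →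
    label p ≡ m → label q ≡ m ℕ.+ k → closeness (addLink G p q p≢q) ≡ hubLink h n k
  closeness-a k 2≤k k≤n p q p≢q p≡ q≡ = trans
    (closeness-path h n 0 k (n ∸ k) n≡ (ℕ.<⇒≤ 2≤k) p q p≢q
      (trans (ℕ.suc-injective p≡) (cong suc (sym (ℕ.+-identityʳ h))))
      (trans (ℕ.suc-injective q≡) (cong (λ z → suc z ℕ.+ k) (sym (ℕ.+-identityʳ h)))))
    (path≡hubLink h n k (n ∸ k) n≡)
    where
    n≡ : n ≡ k ℕ.+ (n ∸ k)
    n≡ = sym (ℕ.m+[n∸m]≡n k≤n)

  private
    link-cases : ∀ {x y} → Link m x y → x ℕ.< y × (y ℕ.≤ m ⊎ (m ℕ.≤ x × y ≡ suc x))
    link-cases (inj₁ (x<y , y≤m))            = x<y , inj₁ y≤m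
    link-cases (inj₂ (inj₁ (refl , refl)))   = ℕ.≤-refl , inj₂ (ℕ.≤-refl , refl)
    link-cases (inj₂ (inj₂ (m<x , refl)))    = ℕ.≤-refl , inj₂ (ℕ.<⇒≤ m<x , refl)

    nonadjacent : ∀ p q → label p ℕ.< label q → m ℕ.< label q → (m ℕ.≤ label p → suc (label p) ≢ label q) →
                  ¬ Graph.Adj G p q
    nonadjacent p q p<q m<q far (inj₁ e) with link-cases e
    ... | _ , inj₁ q≤m           = ℕ.<⇒≱ m<q q≤m
    ... | _ , inj₂ (m≤p , q≡1+p) = far m≤p (sym q≡1+p)
    nonadjacent p q p<q m<q far (inj₂ e) = ℕ.<-asym p<q (proj₁ (link-cases e))

    vertex : ∀ x → x ℕ.< N → ∃[ i ] toℕ {N} i ≡ x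
    vertex x x<N = fromℕ< x<N , toℕ-fromℕ< x<N

    hub+ : ∀ {k} → k ℕ.≤ n → suc h ℕ.+ k ℕ.< N
    hub+ k≤n = ℕ.+-monoʳ-≤ (2 ℕ.+ h) k≤n

  attained-a : ∀ k → 2 ℕ.≤ k → k ℕ.≤ n → Attained G (hubLink h n k)
  attained-a k 2≤k k≤n = build (vertex (suc h) (ℕ.m≤m+n m n))
                               (vertex (suc h ℕ.+ k) (hub+ k≤n))
    where
    build : ∃[ i ] toℕ {N} i ≡ suc h → ∃[ j ] toℕ {N} j ≡ suc h ℕ.+ k → Attained G (hubLink h n k)
    build (p , p≡) (q , q≡) = p , q , p≢q
      , nonadjacent p q p<q (subst (ℕ._< label q) (cong suc p≡) p<q) (λ _ 2+p≡1+q → ℕ.<-irrefl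
          (trans (cong suc (sym p≡)) (trans (ℕ.suc-injective 2+p≡1+q) q≡))
          (subst (ℕ._≤ suc h ℕ.+ k) (ℕ.+-comm (suc h) 2) (ℕ.+-monoʳ-≤ (suc h) 2≤k)))
      , sym (closeness-a k 2≤k k≤n p q p≢q (cong suc p≡) (cong suc q≡))
      where
      p<q : label p ℕ.< label q
      p<q = s≤s (subst₂ ℕ._<_ (sym p≡) (sym q≡) (ℕ.m<m+n (suc h) (ℕ.<⇒≤ 2≤k)))
      p≢q : p ≢ q
      p≢q refl = ℕ.<-irrefl refl p<q

  attained-clone : ∀ k r → n ≡ k ℕ.+ r → 1 ℕ.≤ k → Attained G (clone h k r + clone h k r)
  attained-clone k r n≡ 1≤k = build (vertex 0 (s≤s z≤n)) (vertex (suc h ℕ.+ k) (hub+ k≤n))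
    where
    k≤n : k ℕ.≤ n
    k≤n = subst (k ℕ.≤_) (sym n≡) (ℕ.m≤m+n k r)
    build : ∃[ i ] toℕ {N} i ≡ 0 → ∃[ j ] toℕ {N} j ≡ suc h ℕ.+ k → Attained G (clone h k r + clone h k r)
    build (p , p≡) (q , q≡) = p , q , p≢q
      , nonadjacent p q p<q m<q (λ m≤p _ → ℕ.<⇒≱ (s≤s (s≤s z≤n)) (subst (m ℕ.≤_) (cong suc p≡) m≤p))
      , sym (closeness-clone h n k r n≡ 1≤k p q p≢q (subst (ℕ._≤ h) (sym p≡) z≤n) q≡)
      where
      m<q : m ℕ.< label q
      m<q = s≤s (subst (m ℕ.≤_) (sym q≡) (ℕ.m<m+n (suc h) 1≤k))
      p<q : label p ℕ.< label q
      p<q = ℕ.≤-<-trans (subst (ℕ._≤ m) (cong suc (sym p≡)) (s≤s z≤n)) m<q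
      p≢q : p ≢ q
      p≢q refl = ℕ.<-irrefl refl p<q

bound-5 : ∀ h n → 1 ℕ.≤ h → 5 ℕ.≤ n → ∀ {x} → Shape h n x →
  ∃[ k ] 2 ℕ.≤ k × k ℕ.≤ n × x ≤ hubLink h n k
bound-5 h n 1≤h 5≤n {x} shape = by-cases (bound h n 1≤h (ℕ.≤-trans (s≤s (s≤s z≤n)) 5≤n) shape)
  where
  r = n ∸ 5
  n≡ : n ≡ 5 ℕ.+ r
  n≡ = sym (ℕ.m+[n∸m]≡n 5≤n)
  halves : ∀ p → (p + ⅛) + (p + ⅛) ≡ p + p + ¼
  halves = solve-∀ ring
  3≤5 : hubLink h n 3 + ¼ ≤ hubLink h n 5
  3≤5 = subst₂ _≤_ (trans (halves (path h 0 3 (2 ℕ.+ r))) (cong (_+ ¼) (path≡hubLink h n 3 (2 ℕ.+ r) n≡)))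
                   (path≡hubLink h n 5 r n≡)
          (ℚ.+-mono-≤ (path-3-5 h r) (path-3-5 h r))
  by-cases : ∃[ k ] 2 ℕ.≤ k × k ℕ.≤ n × (x ≤ hubLink h n k ⊎ (k ≡ 3 × x ≡ hubLink h n 3 + ¼)) →
             ∃[ k ] 2 ℕ.≤ k × k ℕ.≤ n × x ≤ hubLink h n k
  by-cases (k , 2≤k , k≤n , inj₁ x≤a)      = k , 2≤k , k≤n , x≤a
  by-cases (_ , _ , _ , inj₂ (_ , x≡a+¼)) = 5 , s≤s (s≤s z≤n) , 5≤n , ℚ.≤-trans (ℚ.≤-reflexive x≡a+¼) 3≤5

additional : ∀ h n {x} → Attained (lollipop (2 ℕ.+ h) n) x → (∀ {y} → Shape h n y → y ≤ x) →
  IsAdditionalCloseness (lollipop (2 ℕ.+ h) n) x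
additional h n attained upper = attained , λ where
  y (p , q , p≢q , ¬adj , y≡) → upper (subst (Shape h n) (sym y≡) (shape h n p q p≢q ¬adj))

-- a as a polynomial in ι h, for fixed k and n = k + r.
a-at : ∀ {n} → ℕ → ℕ → Polynomial n → Polynomial n
a-at k r h = s :+ s
  where s = P.pathF (con 1ℚ :+ h) (con 1ℚ) (con 0ℚ) (con (ι (suc k))) (con (C k)) (con (w r)) (con (ι r))

opaque
  unfolding path

  a-value : ∀ h k r → hubLink h (k ℕ.+ r) k ≡
    (let s = pathF (1ℚ + ι h) 1ℚ 0ℚ (ι (suc k)) (C k) (w r) (ι r) in s + s)
  a-value h k r = trans (sym (path≡hubLink h (k ℕ.+ r) k r refl))
    (cong (λ M → let s = pathF M 1ℚ 0ℚ (ι (suc k)) (C k) (w r) (ι r) in s + s) (ι-suc h))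

opaque
  unfolding clone

  clone-1-0 : ∀ h → clone h 1 0 + clone h 1 0 ≡ (ι 2 + ι h) * (ι 2 + ι h) * ½ + 1ℚ
  clone-1-0 h = identity (ι h)
    where
    identity : ∀ h → cloneF h (ι 3) (C 1) (C 2) 1ℚ 0ℚ + cloneF h (ι 3) (C 1) (C 2) 1ℚ 0ℚ
                     ≡ (ι 2 + h) * (ι 2 + h) * ½ + 1ℚ
    identity = solveℚ 1 (λ h →
      let s = P.cloneF h (con (ι 3)) (con (C 1)) (con (C 2)) (con 1ℚ) (con 0ℚ) in
      s :+ s := (con (ι 2) :+ h) :* (con (ι 2) :+ h) :* con ½ :+ con 1ℚ) refl

-- The cases n ≤ 4

module Small (h : ℕ) (1≤h : 1 ℕ.≤ h) where
  private m = 2 ℕ.+ h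

  -- The only missing links join a clone to the single path vertex, and by symmetry they all give
  -- the same closeness.
  additional-1 : IsAdditionalCloseness (lollipop m 1) (ι m * ι m * ½ + 1ℚ)
  additional-1 = additional h 1
    (subst (Attained (lollipop m 1)) value (attained-clone h 1 1 0 refl ℕ.≤-refl))
    upper
    where
    value : clone h 1 0 + clone h 1 0 ≡ ι m * ι m * ½ + 1ℚ
    value = trans (clone-1-0 h) (cong (λ z → z * z * ½ + 1ℚ) (sym (ι-+ 2 h)))

    upper : ∀ {y} → Shape h 1 y → y ≤ ι m * ι m * ½ + 1ℚ
    upper (on-path zero (suc (suc _)) _ () _ _)
    upper (on-path zero (suc zero) _ _ (s≤s ()) _)
    upper (on-path (suc zero) (suc _) _ () _ _)
    upper (on-path (suc (suc _)) _ _ () _ _)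
    upper (on-clone 1 zero _ _ y≡) = ℚ.≤-reflexive (trans y≡ value)
    upper (on-clone (suc (suc _)) _ () _ _)

  additional-2 : IsAdditionalCloseness (lollipop m 2) (ι m * (ι m + 1ℚ) * ½ + ι 2)
  additional-2 = additional h 2
    (subst (Attained (lollipop m 2)) value (attained-a h 2 2 ℕ.≤-refl ℕ.≤-refl)) upper
    where
    value : hubLink h 2 2 ≡ ι m * (ι m + 1ℚ) * ½ + ι 2
    value = trans (a-value h 2 0) (trans (identity (ι h)) (cong (λ z → z * (z + 1ℚ) * ½ + ι 2) (sym (ι-+ 2 h))))
      where
      identity : ∀ h → pathF (1ℚ + h) 1ℚ 0ℚ (ι 3) (C 2) 1ℚ 0ℚ + pathF (1ℚ + h) 1ℚ 0ℚ (ι 3) (C 2) 1ℚ 0ℚ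
                       ≡ (ι 2 + h) * (ι 2 + h + 1ℚ) * ½ + ι 2
      identity = solveℚ 1 (λ h → a-at 2 0 h :=
        (con (ι 2) :+ h) :* (con (ι 2) :+ h :+ con 1ℚ) :* con ½ :+ con (ι 2)) refl
    upper : ∀ {y} → Shape h 2 y → y ≤ ι m * (ι m + 1ℚ) * ½ + ι 2
    upper {y} shape = by-cases (bound h 2 1≤h ℕ.≤-refl shape)
      where
      by-cases : ∃[ k ] 2 ℕ.≤ k × k ℕ.≤ 2 × (y ≤ hubLink h 2 k ⊎ (k ≡ 3 × y ≡ hubLink h 2 3 + ¼)) → y ≤ ι m * (ι m + 1ℚ) * ½ + ι 2
      by-cases (2 , _ , _ , inj₁ y≤a) = subst (_ ≤_) value y≤a
      by-cases (2 , _ , _ , inj₂ (() , _))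
      by-cases (0 , () , _)
      by-cases (1 , s≤s () , _)
      by-cases (suc (suc (suc _)) , _ , s≤s (s≤s ()) , _)

  -- Here a clone link wins: a(2) and a(3) both fall short by ¼.
  additional-3 : IsAdditionalCloseness (lollipop m 3) (ι m * (ι 2 * ι m + ι 3) * (+ 1 / 4) + ι 4)
  additional-3 = additional h 3
    (subst (Attained (lollipop m 3)) value-clone (attained-clone h 3 3 0 refl (s≤s z≤n))) upper
    where
    target = ι m * (ι 2 * ι m + ι 3) * (+ 1 / 4) + ι 4
    value-2 : hubLink h 3 2 + ¼ ≡ target
    value-2 = trans (cong (_+ ¼) (a-value h 2 1))
      (trans (identity (ι h)) (cong (λ z → z * (ι 2 * z + ι 3) * (+ 1 / 4) + ι 4) (sym (ι-+ 2 h))))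
      where
      identity : ∀ h → pathF (1ℚ + h) 1ℚ 0ℚ (ι 3) (C 2) (w 1) (ι 1) + pathF (1ℚ + h) 1ℚ 0ℚ (ι 3) (C 2) (w 1) (ι 1) + ¼
                       ≡ (ι 2 + h) * (ι 2 * (ι 2 + h) + ι 3) * (+ 1 / 4) + ι 4
      identity = solveℚ 1 (λ h → a-at 2 1 h :+ con ¼ :=
        (con (ι 2) :+ h) :* (con (ι 2) :* (con (ι 2) :+ h) :+ con (ι 3)) :* con (+ 1 / 4) :+ con (ι 4)) refl
    value-3 : hubLink h 3 3 + ¼ ≡ target
    value-3 = trans (cong (_+ ¼) (a-value h 3 0))
      (trans (identity (ι h)) (cong (λ z → z * (ι 2 * z + ι 3) * (+ 1 / 4) + ι 4) (sym (ι-+ 2 h))))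
      where
      identity : ∀ h → pathF (1ℚ + h) 1ℚ 0ℚ (ι 4) (C 3) (w 0) (ι 0) + pathF (1ℚ + h) 1ℚ 0ℚ (ι 4) (C 3) (w 0) (ι 0) + ¼
                       ≡ (ι 2 + h) * (ι 2 * (ι 2 + h) + ι 3) * (+ 1 / 4) + ι 4
      identity = solveℚ 1 (λ h → a-at 3 0 h :+ con ¼ :=
        (con (ι 2) :+ h) :* (con (ι 2) :* (con (ι 2) :+ h) :+ con (ι 3)) :* con (+ 1 / 4) :+ con (ι 4)) refl
    value-clone : clone h 3 0 + clone h 3 0 ≡ target
    value-clone = trans (cong (λ s → s + s) (clone-3 h 0))
      (trans (halves (path h 0 3 0)) (trans (cong (_+ ¼) (path≡hubLink h 3 3 0 refl)) value-3))
      where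
      halves : ∀ p → (p + ⅛) + (p + ⅛) ≡ p + p + ¼
      halves = solve-∀ ring
    upper : ∀ {y} → Shape h 3 y → y ≤ target
    upper {y} shape = by-cases (bound h 3 1≤h (s≤s (s≤s z≤n)) shape)
      where
      by-cases : ∃[ k ] 2 ℕ.≤ k × k ℕ.≤ 3 × (y ≤ hubLink h 3 k ⊎ (k ≡ 3 × y ≡ hubLink h 3 3 + ¼)) → y ≤ target
      by-cases (2 , _ , _ , inj₁ y≤a) = ℚ.≤-trans y≤a (≤-by ¼ (0≤p ¼) value-2)
      by-cases (3 , _ , _ , inj₁ y≤a) = ℚ.≤-trans y≤a (≤-by ¼ (0≤p ¼) value-3)
      by-cases (3 , _ , _ , inj₂ (_ , y≡a+¼)) = ℚ.≤-reflexive (trans y≡a+¼ value-3)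
      by-cases (2 , _ , _ , inj₂ (() , _))
      by-cases (0 , () , _)
      by-cases (1 , s≤s () , _)
      by-cases (suc (suc (suc (suc _))) , _ , s≤s (s≤s (s≤s ())) , _)

  -- The surplus ¼ of the clone link with k = 3 lifts it exactly to a(4), while a(2) stays (m + 3)/8
  -- below.
  additional-4 : IsAdditionalCloseness (lollipop m 4) (ι m * (ι m + ι 2) * ½ + ι 6)
  additional-4 = additional h 4
    (subst (Attained (lollipop m 4)) value-4 (attained-a h 4 4 (s≤s (s≤s z≤n)) ℕ.≤-refl)) upper
    where
    target = ι m * (ι m + ι 2) * ½ + ι 6
    value-2 : hubLink h 4 2 + ⅛ * (ι 5 + ι h) ≡ target
    value-2 = trans (cong (_+ ⅛ * (ι 5 + ι h)) (a-value h 2 2))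
      (trans (identity (ι h)) (cong (λ z → z * (z + ι 2) * ½ + ι 6) (sym (ι-+ 2 h))))
      where
      identity : ∀ h → pathF (1ℚ + h) 1ℚ 0ℚ (ι 3) (C 2) (w 2) (ι 2) + pathF (1ℚ + h) 1ℚ 0ℚ (ι 3) (C 2) (w 2) (ι 2)
                       + ⅛ * (ι 5 + h) ≡ (ι 2 + h) * (ι 2 + h + ι 2) * ½ + ι 6
      identity = solveℚ 1 (λ h → a-at 2 2 h :+ con ⅛ :* (con (ι 5) :+ h) :=
        (con (ι 2) :+ h) :* (con (ι 2) :+ h :+ con (ι 2)) :* con ½ :+ con (ι 6)) refl
    value-3 : hubLink h 4 3 + ¼ ≡ target
    value-3 = trans (cong (_+ ¼) (a-value h 3 1))
      (trans (identity (ι h)) (cong (λ z → z * (z + ι 2) * ½ + ι 6) (sym (ι-+ 2 h))))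
      where
      identity : ∀ h → pathF (1ℚ + h) 1ℚ 0ℚ (ι 4) (C 3) (w 1) (ι 1) + pathF (1ℚ + h) 1ℚ 0ℚ (ι 4) (C 3) (w 1) (ι 1) + ¼
                       ≡ (ι 2 + h) * (ι 2 + h + ι 2) * ½ + ι 6
      identity = solveℚ 1 (λ h → a-at 3 1 h :+ con ¼ :=
        (con (ι 2) :+ h) :* (con (ι 2) :+ h :+ con (ι 2)) :* con ½ :+ con (ι 6)) refl
    value-4 : hubLink h 4 4 ≡ target
    value-4 = trans (a-value h 4 0)
      (trans (identity (ι h)) (cong (λ z → z * (z + ι 2) * ½ + ι 6) (sym (ι-+ 2 h))))
      where
      identity : ∀ h → pathF (1ℚ + h) 1ℚ 0ℚ (ι 5) (C 4) (w 0) (ι 0) + pathF (1ℚ + h) 1ℚ 0ℚ (ι 5) (C 4) (w 0) (ι 0)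
                       ≡ (ι 2 + h) * (ι 2 + h + ι 2) * ½ + ι 6
      identity = solveℚ 1 (λ h → a-at 4 0 h :=
        (con (ι 2) :+ h) :* (con (ι 2) :+ h :+ con (ι 2)) :* con ½ :+ con (ι 6)) refl
    upper : ∀ {y} → Shape h 4 y → y ≤ target
    upper {y} shape = by-cases (bound h 4 1≤h (s≤s (s≤s z≤n)) shape)
      where
      by-cases : ∃[ k ] 2 ℕ.≤ k × k ℕ.≤ 4 × (y ≤ hubLink h 4 k ⊎ (k ≡ 3 × y ≡ hubLink h 4 3 + ¼)) → y ≤ target
      by-cases (2 , _ , _ , inj₁ y≤a) = ℚ.≤-trans y≤a
        (≤-by _ (*-nonneg (0≤p ⅛) (+-nonneg (0≤p (ι 5)) (0≤ι h))) value-2)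
      by-cases (3 , _ , _ , inj₁ y≤a) = ℚ.≤-trans y≤a (≤-by ¼ (0≤p ¼) value-3)
      by-cases (4 , _ , _ , inj₁ y≤a) = subst (_ ≤_) value-4 y≤a
      by-cases (3 , _ , _ , inj₂ (_ , y≡a+¼)) = ℚ.≤-reflexive (trans y≡a+¼ value-3)
      by-cases (2 , _ , _ , inj₂ (() , _))
      by-cases (4 , _ , _ , inj₂ (() , _))
      by-cases (0 , () , _)
      by-cases (1 , s≤s () , _)
      by-cases (suc (suc (suc (suc (suc _)))) , _ , s≤s (s≤s (s≤s (s≤s ()))) , _)

-- The maximum over k

1/-antimono : ∀ {k l} .{{_ : ℕ.NonZero k}} .{{_ : ℕ.NonZero l}} → k ℕ.≤ l → + 1 / l ≤ + 1 / k
1/-antimono {suc k} {suc l} k≤l = ℚ.toℚᵘ-cancel-≤ (begin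
  toℚᵘ (fromℚᵘ (mkℚᵘ (+ 1) l)) ≃⟨ ℚ.toℚᵘ-fromℚᵘ (mkℚᵘ (+ 1) l) ⟩
  mkℚᵘ (+ 1) l                 ≤⟨ *≤* (ℤ.*-monoˡ-≤-nonNeg (+ 1) (ℤ.+≤+ k≤l)) ⟩
  mkℚᵘ (+ 1) k                 ≃⟨ ℚ.toℚᵘ-fromℚᵘ (mkℚᵘ (+ 1) k) ⟨
  toℚᵘ (fromℚᵘ (mkℚᵘ (+ 1) k)) ∎)
  where open ℚᵘ.≤-Reasoning

sum-≥ : ∀ n (f : Fin n → ℚ) x → (∀ i → x ≤ f i) → ι n * x ≤ sum {n} f
sum-≥ zero    f x x≤f = ℚ.≤-reflexive (ℚ.*-zeroˡ x)
sum-≥ (suc n) f x x≤f = subst (_≤ sum f) (sym (trans (cong (_* x) (ι-suc n)) (lem (ι n) x)))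
  (ℚ.+-mono-≤ (x≤f Fin.zero) (sum-≥ n (f ∘ Fin.suc) x (x≤f ∘ Fin.suc)))
  where
  lem : ∀ n x → (1ℚ + n) * x ≡ x + n * x
  lem = solve-∀ ring

-- Each of the `suc N` terms is at least the reciprocal of twice `suc N`. This crude bound ln 2 ≥ ½
-- is the source of 2 / ln 2 ≤ 4.
½≤upperSum : ∀ N → ½ ≤ upperSum N
½≤upperSum N = subst (_≤ upperSum N) half (sum-≥ (suc N) _ (+ 1 / (suc N ℕ.+ suc N))
  λ i → 1/-antimono (ℕ.+-monoʳ-≤ (suc N) (ℕ.<⇒≤ (toℕ<n i))))
  where
  half : ι (suc N) * (+ 1 / (suc N ℕ.+ suc N)) ≡ ½
  half = trans (sym (fromℚᵘ-* (mkℚᵘ (+ suc N) 0) (mkℚᵘ (+ 1) (N ℕ.+ suc N))))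
    (ℚ.fromℚᵘ-cong {mkℚᵘ (+ suc N) 0 ℚᵘ.* mkℚᵘ (+ 1) (N ℕ.+ suc N)} {mkℚᵘ (+ 1) 1}
      (*≡* (cong +_ (nat N))))
    where
    nat : ∀ N → suc N ℕ.* 1 ℕ.* 2 ≡ 1 ℕ.* (1 ℕ.* (suc N ℕ.+ suc N))
    nat = ℕSolver.solve-∀

<2/ln2⇒≤4 : ∀ {x} → x <2/ln2 → x ≤ ι 4
<2/ln2⇒≤4 {x} (u , (N , ∑<u) , xu<2) = ℚ.≮⇒≥ λ 4<x → ℚ.<-irrefl refl (ℚ.≤-<-trans
  (≤-by ((x - ι 4) * u + ι 4 * (u - ½))
    (+-nonneg (*-nonneg (0≤q-p (ℚ.<⇒≤ 4<x)) (ℚ.≤-trans (0≤p ½) ½≤u))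
              (*-nonneg (0≤p (ι 4)) (0≤q-p ½≤u)))
    (lem x u))
  xu<2)
  where
  ½≤u : ½ ≤ u
  ½≤u = ℚ.≤-trans (½≤upperSum N) (ℚ.<⇒≤ ∑<u)
  lem : ∀ x u → ι 2 + ((x - ι 4) * u + ι 4 * (u - ½)) ≡ x * u
  lem = solve-∀ ring

<2⇒<2/ln2 : ∀ {x} → x < ι 2 → x <2/ln2
-- That ln 2 < 1 is witnessed by the upper sum with two parts, 1/2 + 1/3.
<2⇒<2/ln2 {x} x<2 = 1ℚ , (1 , toWitness {a? = upperSum 1 ℚ.<? 1ℚ} _) , subst (_< ι 2) (sym (ℚ.*-identityʳ x)) x<2

≮2/ln2⇒2≤ : ∀ {x} → ¬ x <2/ln2 → ι 2 ≤ x
≮2/ln2⇒2≤ x≮ = ℚ.≮⇒≥ (x≮ ∘ <2⇒<2/ln2)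

-- A sequence whose increments have the signs of E, where E changes its
-- sign once, next to s.
module Unimodal (f E γ : ℕ → ℚ)
  (f-suc  : ∀ p → 1 ℕ.≤ p → f (suc p) ≡ f p + γ p * E p)
  (0≤γ    : ∀ p → 0ℚ ≤ γ p)
  (E-up   : ∀ p → 1 ℕ.≤ p → E p ≤ 0ℚ → E (suc p) ≤ 0ℚ)
  (E-down : ∀ p → 1 ℕ.≤ p → 0ℚ ≤ E (suc p) → 0ℚ ≤ E p)
  (s : ℕ) (1≤s : 1 ℕ.≤ s) (Es≤0 : E (suc s) ≤ 0ℚ)
  (0≤Es : ∀ t → s ≡ suc t → 1 ℕ.≤ t → 0ℚ ≤ E t)
  where

  private
    decreasing : ∀ d → E (d ℕ.+ suc s) ≤ 0ℚ × f (d ℕ.+ suc s) ≤ f (suc s)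
    decreasing zero    = Es≤0 , ℚ.≤-refl
    decreasing (suc d) with E≤0 , f≤f ← decreasing d = E-up (d ℕ.+ suc s) 1≤ E≤0 , ℚ.≤-trans
      (≤-by (γ (d ℕ.+ suc s) * (0ℚ - E (d ℕ.+ suc s))) (*-nonneg (0≤γ (d ℕ.+ suc s)) (0≤q-p E≤0))
        (trans (cong (_+ γ (d ℕ.+ suc s) * (0ℚ - E (d ℕ.+ suc s))) (f-suc (d ℕ.+ suc s) 1≤))
          (lem (f (d ℕ.+ suc s)) (γ (d ℕ.+ suc s)) (E (d ℕ.+ suc s))))) f≤f
      where
      1≤ : 1 ℕ.≤ d ℕ.+ suc s
      1≤ = ℕ.≤-trans (s≤s z≤n) (ℕ.m≤n+m (suc s) d)
      lem : ∀ f g e → f + g * e + g * (0ℚ - e) ≡ f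
      lem = solve-∀ ring

    increasing : ∀ d q → 1 ℕ.≤ q → d ℕ.+ q ≡ s → f q ≤ f s × (∀ t → q ≡ suc t → 1 ℕ.≤ t → 0ℚ ≤ E t)
    increasing zero    q 1≤q refl = ℚ.≤-refl , 0≤Es
    increasing (suc d) q 1≤q eq with f≤f , 0≤E ← increasing d (suc q) (s≤s z≤n) (trans (ℕ.+-suc d q) eq) =
        ℚ.≤-trans (≤-by (γ q * E q) (*-nonneg (0≤γ q) (0≤E q refl 1≤q)) (sym (f-suc q 1≤q))) f≤f
      , λ t q≡1+t 1≤t → E-down t 1≤t (subst (λ z → 0ℚ ≤ E z) q≡1+t (0≤E q refl 1≤q))

  -- Nothing is known about the sign of `E s`, so both `s` and `suc s` stay in play. The side on
  -- which `q` lies is kept in order to bound the candidate by n afterwards.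
  maximum : ∀ q → 1 ℕ.≤ q → (suc s ℕ.≤ q × f q ≤ f (suc s)) ⊎ (q ℕ.≤ s × f q ≤ f s)
  maximum q 1≤q with ℕ.<-≤-connex s q
  ... | inj₁ s<q = inj₁ (s<q , subst (λ z → f z ≤ f (suc s)) (ℕ.m∸n+n≡m s<q) (proj₂ (decreasing (q ∸ suc s))))
  ... | inj₂ q≤s = inj₂ (q≤s , proj₁ (increasing (s ∸ q) q 1≤q (ℕ.m∸n+n≡m q≤s)))

-- The increments of a(k) along each parity

module Exponents (n : ℕ) where

  -- Powers 2^(2p-n) come from `a` itself; dividing an increment by its factor 2^(-p) turns some of
  -- them into 2^(3p-n).
  X Y : ℕ → ℚ
  X p = 2^ (+ 2 ℤ.* + p ℤ.- + n)
  Y p = 2^ (+ 3 ℤ.* + p ℤ.- + n)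

  power : ∀ j p → 2^ (+ j ℤ.* + p ℤ.- + n) ≡ 2^ (+ (j ℕ.* p)) * w n
  power j p = trans (cong (λ i → 2^ (i ℤ.- + n)) (sym (ℤ.pos-* j p))) (2^k-n (j ℕ.* p) n)

  power-suc : ∀ j p → 2^ (+ j ℤ.* + suc p ℤ.- + n) ≡ 2^ (+ j) * 2^ (+ j ℤ.* + p ℤ.- + n)
  power-suc j p = trans (power j (suc p)) (trans
    (cong (_* w n) (trans (cong (λ e → 2^ (+ e)) (ℕ.*-suc j p)) (2^-+ (+ j) (+ (j ℕ.* p)))))
    (trans (ℚ.*-assoc (2^ (+ j)) (2^ (+ (j ℕ.* p))) (w n)) (cong (2^ (+ j) *_) (sym (power j p)))))

  X-suc : ∀ p → X (suc p) ≡ ι 4 * X p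
  X-suc = power-suc 2

  Y-suc : ∀ p → Y (suc p) ≡ ι 8 * Y p
  Y-suc = power-suc 3

  Y≡2^p*X : ∀ p → Y p ≡ 2^ (+ p) * X p
  Y≡2^p*X p = trans (power 3 p) (trans (cong (_* w n) (2^-+ (+ p) (+ (2 ℕ.* p))))
    (trans (ℚ.*-assoc (2^ (+ p)) (2^ (+ (2 ℕ.* p))) (w n)) (cong (2^ (+ p) *_) (sym (power 2 p)))))

  X≡w*Y : ∀ p → X p ≡ w p * Y p
  X≡w*Y p = sym (trans (cong (w p *_) (Y≡2^p*X p)) (trans (lem (w p) (2^ (+ p)) (X p))
    (trans (cong (_* X p) (2^*w p)) (ℚ.*-identityˡ (X p)))))
    where
    lem : ∀ a b c → a * (b * c) ≡ b * a * c
    lem = solve-∀ ring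

  0≤X : ∀ p → 0ℚ ≤ X p
  0≤X p = 0≤2^ (+ 2 ℤ.* + p ℤ.- + n)

  2≤X : ∀ p → n ℕ.< 2 ℕ.* p → ι 2 ≤ X p
  2≤X p n<2p = subst (ι 2 ≤_) (sym X≡) (ι-mono-≤ (ℕ.^-monoʳ-≤ 2 {1} (ℕ.m<n⇒0<n∸m n<2p)))
    where
    e = 2 ℕ.* p ∸ n
    X≡ : X p ≡ 2^ (+ e)
    X≡ = trans (power 2 p) (trans
      (cong (λ k → 2^ (+ k) * w n) (sym (ℕ.m+[n∸m]≡n (ℕ.<⇒≤ n<2p))))
      (trans (cong (_* w n) (2^-+ (+ n) (+ e))) (trans (lem (2^ (+ n)) (2^ (+ e)) (w n))
        (trans (cong (_* 2^ (+ e)) (2^*w n)) (ℚ.*-identityˡ (2^ (+ e)))))))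
      where
      lem : ∀ a b c → a * b * c ≡ a * c * b
      lem = solve-∀ ring

  2^[3p-n-1] : ∀ p → 2^ (+ 3 ℤ.* + p ℤ.- + n ℤ.- + 1) ≡ ½ * Y p
  2^[3p-n-1] p = trans (2^-+ (+ 3 ℤ.* + p ℤ.- + n) (ℤ.- (+ 1))) (ℚ.*-comm (Y p) ½)

  2^[1+2p-n] : ∀ p → 2^ (+ 1 ℤ.+ + 2 ℤ.* + p ℤ.- + n) ≡ ι 2 * X p
  2^[1+2p-n] p = trans (cong 2^_ (ℤ.+-assoc (+ 1) (+ 2 ℤ.* + p) (ℤ.- (+ n))))
                     (2^-+ (+ 1) (+ 2 ℤ.* + p ℤ.- + n))

-- It fails for t = 1 and t = 2. Where it is used, 5 ≤ n < 2t provides 3 ≤ t.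
1+2t≤2^t : ∀ {t} → 3 ℕ.≤ t → 1 ℕ.+ 2 ℕ.* t ℕ.≤ 2 ℕ.^ t
1+2t≤2^t {t} 3≤t = subst (λ t → 1 ℕ.+ 2 ℕ.* t ℕ.≤ 2 ℕ.^ t) (ℕ.m∸n+n≡m 3≤t) (go (t ∸ 3))
  where
  go : ∀ d → 1 ℕ.+ 2 ℕ.* (d ℕ.+ 3) ℕ.≤ 2 ℕ.^ (d ℕ.+ 3)
  go zero    = ℕ.n≤1+n 7
  go (suc d) = begin
    1 ℕ.+ 2 ℕ.* suc (d ℕ.+ 3)                     ≡⟨ cong suc (ℕ.*-suc 2 (d ℕ.+ 3)) ⟩
    3 ℕ.+ 2 ℕ.* (d ℕ.+ 3)                         ≡⟨ ℕ.+-comm 2 _ ⟩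
    1 ℕ.+ 2 ℕ.* (d ℕ.+ 3) ℕ.+ 2                   ≤⟨ ℕ.+-mono-≤ (go d) (ℕ.^-monoʳ-≤ 2 {1} (ℕ.m≤n⇒m≤o+n d (s≤s z≤n))) ⟩
    2 ℕ.^ (d ℕ.+ 3) ℕ.+ 2 ℕ.^ (d ℕ.+ 3)           ≡⟨ cong (2 ℕ.^ (d ℕ.+ 3) ℕ.+_) (ℕ.+-identityʳ _) ⟨
    2 ℕ.^ (suc d ℕ.+ 3)                           ∎
    where open ℕ.≤-Reasoning

c-odd : ∀ q → c (suc (2 ℕ.* q)) ≡ ι 2 - ι 3 * w (suc q)
c-odd zero    = refl
c-odd (suc q) = trans (cong (c ∘ suc) (ℕ.*-suc 2 q)) (trans (c-+2 (suc (2 ℕ.* q)))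
  (trans (cong (λ x → 1ℚ + ½ * x) (c-odd q)) (lem (w (suc q)))))
  where
  lem : ∀ x → 1ℚ + ½ * (ι 2 - ι 3 * x) ≡ ι 2 - ι 3 * (½ * x)
  lem = solve-∀ ring

c-even : ∀ q → c (2 ℕ.* q) ≡ ι 2 - ι 2 * w q
c-even zero    = refl
c-even (suc q) = trans (cong c (ℕ.*-suc 2 q)) (trans (c-+2 (2 ℕ.* q))
  (trans (cong (λ x → 1ℚ + ½ * x) (c-even q)) (lem (w q))))
  where
  lem : ∀ x → 1ℚ + ½ * (ι 2 - ι 2 * x) ≡ ι 2 - ι 2 * (½ * x)
  lem = solve-∀ ring

module Parity (h n : ℕ) (1≤h : 1 ℕ.≤ h) where
  open Exponents n

  private
    m : ℚ
    m = ι (2 ℕ.+ h)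
    3≤m : ι 3 ≤ m
    3≤m = ι-mono-≤ (s≤s (s≤s 1≤h))
    0≤m-3 : 0ℚ ≤ m - ι 3
    0≤m-3 = 0≤q-p 3≤m
    1≤ι : ∀ {p} → 1 ℕ.≤ p → 0ℚ ≤ ι p - 1ℚ
    1≤ι 1≤p = 0≤q-p (ι-mono-≤ 1≤p)

    -- 2p + m - 5
    slack : ℕ → ℚ
    slack p = ι 2 * (ι p - 1ℚ) + (m - ι 3)
    0≤slack : ∀ {p} → 1 ℕ.≤ p → 0ℚ ≤ slack p
    0≤slack 1≤p = +-nonneg (*-nonneg (0≤p (ι 2)) (1≤ι 1≤p)) 0≤m-3

  odd even : ℕ → ℚ
  odd  p = hubLink h n (2 ℕ.* p ∸ 1)
  even p = hubLink h n (2 ℕ.* p)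

  -- The signs of the increments of odd and even.
  E₁ E₂ : ℕ → ℚ
  E₁ p = ι 2 * ι p + m - 1ℚ + ι 2 * X p - ½ * (m + ι 3) * Y p
  E₂ p = ι 2 * ι p + m + ι 4 * X p - ι 3 * ½ * (m + ι 3) * Y p

  opaque
    unfolding hubLink

    -- `X p` appears as `w p * Y p`, so that the increment is a polynomial identity in which the
    -- factor `w p` can be split off.
    odd-formula : ∀ p → 1 ℕ.≤ p →
      odd p ≡ aF m (ι n) (ι 2 * ι p - 1ℚ) (½ * (w p * Y p)) (w p * Y p) (ι 2 - ι 3 * w p)
    odd-formula (suc q) _ = begin
      aF m (ι n) (ι k) (2^ (+ k ℤ.- + n)) (2^ (+ 1 ℤ.+ + k ℤ.- + n)) (c k)
        ≡⟨ cong₂ (λ x z → aF m (ι n) (ι k) x z (c k)) (trans (halve (2^ (+ k ℤ.- + n)))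
             (cong (½ *_) (trans (sym (2^1+k-n k n)) X≡))) X≡ ⟩
      aF m (ι n) (ι k) (½ * (w p * Y p)) (w p * Y p) (c k)
        ≡⟨ cong₂ (λ κ c → aF m (ι n) κ (½ * (w p * Y p)) (w p * Y p) c) ι-k
             (trans (cong c (cong (_∸ 1) (ℕ.*-suc 2 q))) (c-odd q)) ⟩
      aF m (ι n) (ι 2 * ι p - 1ℚ) (½ * (w p * Y p)) (w p * Y p) (ι 2 - ι 3 * w p) ∎
      where
      open ≡-Reasoning
      p k : ℕ
      p = suc q
      k = 2 ℕ.* p ∸ 1
      X≡ : 2^ (+ suc k ℤ.- + n) ≡ w p * Y p
      X≡ = trans (cong (λ i → 2^ (i ℤ.- + n)) (ℤ.pos-* 2 p)) (X≡w*Y p)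
      halve : ∀ x → x ≡ ½ * (ι 2 * x)
      halve = solve-∀ ring
      ι-k : ι k ≡ ι 2 * ι p - 1ℚ
      ι-k = trans (lem (ι k)) (cong (_- 1ℚ) (trans (sym (ι-suc k)) (ι-* 2 p)))
        where
        lem : ∀ x → x ≡ 1ℚ + x - 1ℚ
        lem = solve-∀ ring

    even-formula : ∀ p →
      even p ≡ aF m (ι n) (ι 2 * ι p) (w p * Y p) (ι 2 * (w p * Y p)) (ι 2 - ι 2 * w p)
    even-formula p = begin
      aF m (ι n) (ι k) (2^ (+ k ℤ.- + n)) (2^ (+ 1 ℤ.+ + k ℤ.- + n)) (c k)
        ≡⟨ cong₂ (λ x z → aF m (ι n) (ι k) x z (c k)) X≡ (trans (2^1+k-n k n) (cong (ι 2 *_) X≡)) ⟩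
      aF m (ι n) (ι k) (w p * Y p) (ι 2 * (w p * Y p)) (c k)
        ≡⟨ cong₂ (λ κ c → aF m (ι n) κ (w p * Y p) (ι 2 * (w p * Y p)) c) (ι-* 2 p) (c-even p) ⟩
      aF m (ι n) (ι 2 * ι p) (w p * Y p) (ι 2 * (w p * Y p)) (ι 2 - ι 2 * w p) ∎
      where
      open ≡-Reasoning
      k : ℕ
      k = 2 ℕ.* p
      X≡ : 2^ (+ k ℤ.- + n) ≡ w p * Y p
      X≡ = trans (cong (λ i → 2^ (i ℤ.- + n)) (ℤ.pos-* 2 p)) (X≡w*Y p)

  odd-suc : ∀ p → 1 ℕ.≤ p → odd (suc p) ≡ odd p + ι 3 * ½ * w p * E₁ p
  odd-suc p 1≤p = begin
    odd (suc p)
      ≡⟨ odd-formula (suc p) (s≤s z≤n) ⟩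
    aF m (ι n) (ι 2 * ι (suc p) - 1ℚ) (½ * (½ * w p * Y (suc p))) (½ * w p * Y (suc p)) (ι 2 - ι 3 * (½ * w p))
      ≡⟨ cong₂ (λ P y → aF m (ι n) (ι 2 * P - 1ℚ) (½ * (½ * w p * y)) (½ * w p * y) (ι 2 - ι 3 * (½ * w p)))
               (ι-suc p) (Y-suc p) ⟩
    aF m (ι n) (ι 2 * (1ℚ + ι p) - 1ℚ) (½ * (½ * w p * (ι 8 * Y p))) (½ * w p * (ι 8 * Y p)) (ι 2 - ι 3 * (½ * w p))
      ≡⟨ identity m (ι n) (ι p) (w p) (Y p) ⟩
    aF m (ι n) (ι 2 * ι p - 1ℚ) (½ * (w p * Y p)) (w p * Y p) (ι 2 - ι 3 * w p)
      + ι 3 * ½ * w p * (ι 2 * ι p + m - 1ℚ + ι 2 * (w p * Y p) - ½ * (m + ι 3) * Y p)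
      ≡⟨ cong₂ (λ f x → f + ι 3 * ½ * w p * (ι 2 * ι p + m - 1ℚ + ι 2 * x - ½ * (m + ι 3) * Y p))
               (sym (odd-formula p 1≤p)) (sym (X≡w*Y p)) ⟩
    odd p + ι 3 * ½ * w p * E₁ p ∎
    where
    open ≡-Reasoning
    identity : ∀ m n p v y →
      aF m n (ι 2 * (1ℚ + p) - 1ℚ) (½ * (½ * v * (ι 8 * y))) (½ * v * (ι 8 * y)) (ι 2 - ι 3 * (½ * v)) ≡
      aF m n (ι 2 * p - 1ℚ) (½ * (v * y)) (v * y) (ι 2 - ι 3 * v)
        + ι 3 * ½ * v * (ι 2 * p + m - 1ℚ + ι 2 * (v * y) - ½ * (m + ι 3) * y)
    identity = solveℚ 5 (λ m n p v y →
      P.aF m n (con (ι 2) :* (con 1ℚ :+ p) :- con 1ℚ) (con ½ :* (con ½ :* v :* (con (ι 8) :* y)))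
           (con ½ :* v :* (con (ι 8) :* y)) (con (ι 2) :- con (ι 3) :* (con ½ :* v)) :=
      P.aF m n (con (ι 2) :* p :- con 1ℚ) (con ½ :* (v :* y)) (v :* y) (con (ι 2) :- con (ι 3) :* v)
        :+ con (ι 3) :* con ½ :* v :* (con (ι 2) :* p :+ m :- con 1ℚ :+ con (ι 2) :* (v :* y)
                                        :- con ½ :* (m :+ con (ι 3)) :* y)) refl

  even-suc : ∀ p → 1 ℕ.≤ p → even (suc p) ≡ even p + w p * E₂ p
  even-suc p _ = begin
    even (suc p)
      ≡⟨ even-formula (suc p) ⟩
    aF m (ι n) (ι 2 * ι (suc p)) (½ * w p * Y (suc p)) (ι 2 * (½ * w p * Y (suc p))) (ι 2 - ι 2 * (½ * w p))
      ≡⟨ cong₂ (λ P y → aF m (ι n) (ι 2 * P) (½ * w p * y) (ι 2 * (½ * w p * y)) (ι 2 - ι 2 * (½ * w p)))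
               (ι-suc p) (Y-suc p) ⟩
    aF m (ι n) (ι 2 * (1ℚ + ι p)) (½ * w p * (ι 8 * Y p)) (ι 2 * (½ * w p * (ι 8 * Y p))) (ι 2 - ι 2 * (½ * w p))
      ≡⟨ identity m (ι n) (ι p) (w p) (Y p) ⟩
    aF m (ι n) (ι 2 * ι p) (w p * Y p) (ι 2 * (w p * Y p)) (ι 2 - ι 2 * w p)
      + w p * (ι 2 * ι p + m + ι 4 * (w p * Y p) - ι 3 * ½ * (m + ι 3) * Y p)
      ≡⟨ cong₂ (λ f x → f + w p * (ι 2 * ι p + m + ι 4 * x - ι 3 * ½ * (m + ι 3) * Y p))
               (sym (even-formula p)) (sym (X≡w*Y p)) ⟩
    even p + w p * E₂ p ∎
    where
    open ≡-Reasoning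
    identity : ∀ m n p v y →
      aF m n (ι 2 * (1ℚ + p)) (½ * v * (ι 8 * y)) (ι 2 * (½ * v * (ι 8 * y))) (ι 2 - ι 2 * (½ * v)) ≡
      aF m n (ι 2 * p) (v * y) (ι 2 * (v * y)) (ι 2 - ι 2 * v)
        + v * (ι 2 * p + m + ι 4 * (v * y) - ι 3 * ½ * (m + ι 3) * y)
    identity = solveℚ 5 (λ m n p v y →
      P.aF m n (con (ι 2) :* (con 1ℚ :+ p)) (con ½ :* v :* (con (ι 8) :* y))
           (con (ι 2) :* (con ½ :* v :* (con (ι 8) :* y))) (con (ι 2) :- con (ι 2) :* (con ½ :* v)) :=
      P.aF m n (con (ι 2) :* p) (v :* y) (con (ι 2) :* (v :* y)) (con (ι 2) :- con (ι 2) :* v)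
        :+ v :* (con (ι 2) :* p :+ m :+ con (ι 4) :* (v :* y) :- con (ι 3) :* con ½ :* (m :+ con (ι 3)) :* y)) refl

  private
    E₁-suc : ∀ p → E₁ (suc p) ≡ ι 2 * (1ℚ + ι p) + m - 1ℚ + ι 2 * (ι 4 * X p) - ½ * (m + ι 3) * (ι 8 * Y p)
    E₁-suc p = trans (cong (λ P → ι 2 * P + m - 1ℚ + ι 2 * X (suc p) - ½ * (m + ι 3) * Y (suc p)) (ι-suc p))
      (cong₂ (λ x y → ι 2 * (1ℚ + ι p) + m - 1ℚ + ι 2 * x - ½ * (m + ι 3) * y) (X-suc p) (Y-suc p))

    E₂-suc : ∀ p → E₂ (suc p) ≡ ι 2 * (1ℚ + ι p) + m + ι 4 * (ι 4 * X p) - ι 3 * ½ * (m + ι 3) * (ι 8 * Y p)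
    E₂-suc p = trans (cong (λ P → ι 2 * P + m + ι 4 * X (suc p) - ι 3 * ½ * (m + ι 3) * Y (suc p)) (ι-suc p))
      (cong₂ (λ x y → ι 2 * (1ℚ + ι p) + m + ι 4 * x - ι 3 * ½ * (m + ι 3) * y) (X-suc p) (Y-suc p))

  -- From p to p + 1 the term in `Y` grows by the factor 8. So the next value differs from 8 ·
  -- `E₁ p` by terms without `Y`, all of the required sign. The same identity divided by 8 gives
  -- `E₁-down`, and `E₂` behaves alike.
  E₁-up : ∀ p → 1 ℕ.≤ p → E₁ p ≤ 0ℚ → E₁ (suc p) ≤ 0ℚ
  E₁-up p 1≤p E≤0 = ≤-by (ι 8 * (0ℚ - E₁ p) + (ι 7 * slack p + ι 26 + ι 8 * X p))
    (+-nonneg (*-nonneg (0≤p (ι 8)) (0≤q-p E≤0))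
      (+-nonneg (+-nonneg (*-nonneg (0≤p (ι 7)) (0≤slack 1≤p)) (0≤p (ι 26))) (*-nonneg (0≤p (ι 8)) (0≤X p))))
    (trans (cong (_+ (ι 8 * (0ℚ - E₁ p) + (ι 7 * slack p + ι 26 + ι 8 * X p))) (E₁-suc p)) (lem m (ι p) (X p) (Y p)))
    where
    lem : ∀ m p x y → ι 2 * (1ℚ + p) + m - 1ℚ + ι 2 * (ι 4 * x) - ½ * (m + ι 3) * (ι 8 * y)
      + (ι 8 * (0ℚ - (ι 2 * p + m - 1ℚ + ι 2 * x - ½ * (m + ι 3) * y))
      + (ι 7 * (ι 2 * (p - 1ℚ) + (m - ι 3)) + ι 26 + ι 8 * x)) ≡ 0ℚ
    lem = solve-∀ ring

  E₁-down : ∀ p → 1 ℕ.≤ p → 0ℚ ≤ E₁ (suc p) → 0ℚ ≤ E₁ p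
  E₁-down p 1≤p 0≤E = subst (0ℚ ≤_)
    (trans (cong (λ e → ⅛ * e + (ι 7 * ⅛ * slack p + ι 26 * ⅛ + X p)) (E₁-suc p)) (lem m (ι p) (X p) (Y p)))
    (+-nonneg (*-nonneg (0≤p ⅛) 0≤E)
      (+-nonneg (+-nonneg (*-nonneg (0≤p (ι 7 * ⅛)) (0≤slack 1≤p)) (0≤p (ι 26 * ⅛))) (0≤X p)))
    where
    lem : ∀ m p x y → ⅛ * (ι 2 * (1ℚ + p) + m - 1ℚ + ι 2 * (ι 4 * x) - ½ * (m + ι 3) * (ι 8 * y))
      + (ι 7 * ⅛ * (ι 2 * (p - 1ℚ) + (m - ι 3)) + ι 26 * ⅛ + x) ≡
      ι 2 * p + m - 1ℚ + ι 2 * x - ½ * (m + ι 3) * y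
    lem = solve-∀ ring

  E₂-up : ∀ p → 1 ℕ.≤ p → E₂ p ≤ 0ℚ → E₂ (suc p) ≤ 0ℚ
  E₂-up p 1≤p E≤0 = ≤-by (ι 8 * (0ℚ - E₂ p) + (ι 7 * slack p + ι 33 + ι 16 * X p))
    (+-nonneg (*-nonneg (0≤p (ι 8)) (0≤q-p E≤0))
      (+-nonneg (+-nonneg (*-nonneg (0≤p (ι 7)) (0≤slack 1≤p)) (0≤p (ι 33))) (*-nonneg (0≤p (ι 16)) (0≤X p))))
    (trans (cong (_+ (ι 8 * (0ℚ - E₂ p) + (ι 7 * slack p + ι 33 + ι 16 * X p))) (E₂-suc p)) (lem m (ι p) (X p) (Y p)))
    where
    lem : ∀ m p x y → ι 2 * (1ℚ + p) + m + ι 4 * (ι 4 * x) - ι 3 * ½ * (m + ι 3) * (ι 8 * y)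
      + (ι 8 * (0ℚ - (ι 2 * p + m + ι 4 * x - ι 3 * ½ * (m + ι 3) * y))
      + (ι 7 * (ι 2 * (p - 1ℚ) + (m - ι 3)) + ι 33 + ι 16 * x)) ≡ 0ℚ
    lem = solve-∀ ring

  E₂-down : ∀ p → 1 ℕ.≤ p → 0ℚ ≤ E₂ (suc p) → 0ℚ ≤ E₂ p
  E₂-down p 1≤p 0≤E = subst (0ℚ ≤_)
    (trans (cong (λ e → ⅛ * e + (ι 7 * ⅛ * slack p + ι 33 * ⅛ + ι 2 * X p)) (E₂-suc p)) (lem m (ι p) (X p) (Y p)))
    (+-nonneg (*-nonneg (0≤p ⅛) 0≤E)
      (+-nonneg (+-nonneg (*-nonneg (0≤p (ι 7 * ⅛)) (0≤slack 1≤p)) (0≤p (ι 33 * ⅛))) (*-nonneg (0≤p (ι 2)) (0≤X p))))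
    where
    lem : ∀ m p x y → ⅛ * (ι 2 * (1ℚ + p) + m + ι 4 * (ι 4 * x) - ι 3 * ½ * (m + ι 3) * (ι 8 * y))
      + (ι 7 * ⅛ * (ι 2 * (p - 1ℚ) + (m - ι 3)) + ι 33 * ⅛ + ι 2 * x) ≡
      ι 2 * p + m + ι 4 * x - ι 3 * ½ * (m + ι 3) * y
    lem = solve-∀ ring

  -- The left-hand sides of the two conditions, before 2 / ln 2 is subtracted.
  x₁ x₂ : ℕ → ℚ
  x₁ p = ι 2 * ι p + m + 1ℚ + X p - (m * (+ 1 / 3) + 1ℚ) * (½ * Y p)
  x₂ p = ι 2 * ι p + m + ι 2 + ι 2 * X p - (m + ι 3) * (½ * Y p)

  condition₁-lhs : ∀ p →
    ι 2 * ι p + m + 1ℚ + 2^ (+ 2 ℤ.* + p ℤ.- + n)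
      - (+ (2 ℕ.+ h) / 3 + 1ℚ) * 2^ (+ 3 ℤ.* + p ℤ.- + n ℤ.- + 1) ≡ x₁ p
  condition₁-lhs p = cong₂ (λ t y → ι 2 * ι p + m + 1ℚ + X p - (t + 1ℚ) * y)
    (trans (cong (λ k → k / 3) (sym (ℤ.*-identityʳ (+ (2 ℕ.+ h))))) (fromℚᵘ-* (mkℚᵘ (+ (2 ℕ.+ h)) 0) (mkℚᵘ (+ 1) 2)))
    (2^[3p-n-1] p)

  condition₂-lhs : ∀ p →
    ι 2 * ι p + m + ι 2 + 2^ (+ 1 ℤ.+ + 2 ℤ.* + p ℤ.- + n)
      - (m + ι 3) * 2^ (+ 3 ℤ.* + p ℤ.- + n ℤ.- + 1) ≡ x₂ p
  condition₂-lhs p = cong₂ (λ x y → ι 2 * ι p + m + ι 2 + x - (m + ι 3) * y) (2^[1+2p-n] p) (2^[3p-n-1] p)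

  -- The coefficient of `Y p` is (m + 3)/6 in `x₁` and (m + 3)/2 in `E₁`, so the multiplier 3
  -- removes it.
  x₁≤4⇒E₁≤0 : ∀ p → 1 ℕ.≤ p → x₁ p ≤ ι 4 → E₁ p ≤ 0ℚ
  x₁≤4⇒E₁≤0 p 1≤p x≤4 = ≤-by (ι 3 * (ι 4 - x₁ p) + (ι 2 * slack p + ι 2 + X p))
    (+-nonneg (*-nonneg (0≤p (ι 3)) (0≤q-p x≤4))
      (+-nonneg (+-nonneg (*-nonneg (0≤p (ι 2)) (0≤slack 1≤p)) (0≤p (ι 2))) (0≤X p)))
    (lem m (ι p) (X p) (Y p))
    where
    lem : ∀ m p x y → ι 2 * p + m - 1ℚ + ι 2 * x - ½ * (m + ι 3) * y
      + (ι 3 * (ι 4 - (ι 2 * p + m + 1ℚ + x - (m * (+ 1 / 3) + 1ℚ) * (½ * y)))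
      + (ι 2 * (ι 2 * (p - 1ℚ) + (m - ι 3)) + ι 2 + x)) ≡ 0ℚ
    lem = solve-∀ ring

  x₂≤4⇒E₂≤0 : ∀ p → 1 ℕ.≤ p → x₂ p ≤ ι 4 → E₂ p ≤ 0ℚ
  x₂≤4⇒E₂≤0 p 1≤p x≤4 = ≤-by (ι 3 * (ι 4 - x₂ p) + (ι 2 * slack p + ι 4 + ι 2 * X p))
    (+-nonneg (*-nonneg (0≤p (ι 3)) (0≤q-p x≤4))
      (+-nonneg (+-nonneg (*-nonneg (0≤p (ι 2)) (0≤slack 1≤p)) (0≤p (ι 4))) (*-nonneg (0≤p (ι 2)) (0≤X p))))
    (lem m (ι p) (X p) (Y p))
    where
    lem : ∀ m p x y → ι 2 * p + m + ι 4 * x - ι 3 * ½ * (m + ι 3) * y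
      + (ι 3 * (ι 4 - (ι 2 * p + m + ι 2 + ι 2 * x - (m + ι 3) * (½ * y)))
      + (ι 2 * (ι 2 * (p - 1ℚ) + (m - ι 3)) + ι 4 + ι 2 * x)) ≡ 0ℚ
    lem = solve-∀ ring

  -- The multiplier 3/8 removes `Y q`: the ratio 3 of the coefficients, divided by the growth 8 of
  -- `Y` from `q` to `suc q`.
  2≤x₁⇒0≤E₁ : ∀ q → 1 ℕ.≤ q → ι 2 ≤ x₁ (suc q) → 0ℚ ≤ E₁ q
  2≤x₁⇒0≤E₁ q 1≤q 2≤x = subst (0ℚ ≤_)
    (trans (cong (λ x → ι 3 * ⅛ * (x - ι 2) + (ι 5 * ⅛ * slack q + ι 14 * ⅛ + ½ * X q)) x₁-suc)
      (lem m (ι q) (X q) (Y q)))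
    (+-nonneg (*-nonneg (0≤p (ι 3 * ⅛)) (0≤q-p 2≤x))
      (+-nonneg (+-nonneg (*-nonneg (0≤p (ι 5 * ⅛)) (0≤slack 1≤q)) (0≤p (ι 14 * ⅛))) (*-nonneg (0≤p ½) (0≤X q))))
    where
    x₁-suc : x₁ (suc q) ≡ ι 2 * (1ℚ + ι q) + m + 1ℚ + ι 4 * X q - (m * (+ 1 / 3) + 1ℚ) * (½ * (ι 8 * Y q))
    x₁-suc = trans
      (cong (λ P → ι 2 * P + m + 1ℚ + X (suc q) - (m * (+ 1 / 3) + 1ℚ) * (½ * Y (suc q))) (ι-suc q))
      (cong₂ (λ x y → ι 2 * (1ℚ + ι q) + m + 1ℚ + x - (m * (+ 1 / 3) + 1ℚ) * (½ * y)) (X-suc q) (Y-suc q))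
    lem : ∀ m q x y →
      ι 3 * ⅛ * (ι 2 * (1ℚ + q) + m + 1ℚ + ι 4 * x - (m * (+ 1 / 3) + 1ℚ) * (½ * (ι 8 * y)) - ι 2)
      + (ι 5 * ⅛ * (ι 2 * (q - 1ℚ) + (m - ι 3)) + ι 14 * ⅛ + ½ * x) ≡
      ι 2 * q + m - 1ℚ + ι 2 * x - ½ * (m + ι 3) * y
    lem = solve-∀ ring

  2≤x₂⇒0≤E₂ : ∀ q → 1 ℕ.≤ q → ι 2 ≤ x₂ (suc q) → 0ℚ ≤ E₂ q
  2≤x₂⇒0≤E₂ q 1≤q 2≤x = subst (0ℚ ≤_)
    (trans (cong (λ x → ι 3 * ⅛ * (x - ι 2) + (ι 5 * ⅛ * slack q + ι 19 * ⅛ + X q)) x₂-suc)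
      (lem m (ι q) (X q) (Y q)))
    (+-nonneg (*-nonneg (0≤p (ι 3 * ⅛)) (0≤q-p 2≤x))
      (+-nonneg (+-nonneg (*-nonneg (0≤p (ι 5 * ⅛)) (0≤slack 1≤q)) (0≤p (ι 19 * ⅛))) (0≤X q)))
    where
    x₂-suc : x₂ (suc q) ≡ ι 2 * (1ℚ + ι q) + m + ι 2 + ι 2 * (ι 4 * X q) - (m + ι 3) * (½ * (ι 8 * Y q))
    x₂-suc = trans
      (cong (λ P → ι 2 * P + m + ι 2 + ι 2 * X (suc q) - (m + ι 3) * (½ * Y (suc q))) (ι-suc q))
      (cong₂ (λ x y → ι 2 * (1ℚ + ι q) + m + ι 2 + ι 2 * x - (m + ι 3) * (½ * y)) (X-suc q) (Y-suc q))
    lem : ∀ m q x y →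
      ι 3 * ⅛ * (ι 2 * (1ℚ + q) + m + ι 2 + ι 2 * (ι 4 * x) - (m + ι 3) * (½ * (ι 8 * y)) - ι 2)
      + (ι 5 * ⅛ * (ι 2 * (q - 1ℚ) + (m - ι 3)) + ι 19 * ⅛ + x) ≡
      ι 2 * q + m + ι 4 * x - ι 3 * ½ * (m + ι 3) * y
    lem = solve-∀ ring

  module _ (t : ℕ) (3≤t : 3 ℕ.≤ t) (n<2t : n ℕ.< 2 ℕ.* t) where

    private
      U r : ℚ
      U = 2^ (+ t)
      -- Expanded, this is `Y t` - `X t` - 4t; the form chosen shows that it is nonnegative.
      r = ι 2 * (U - (1ℚ + ι 2 * ι t)) + ι 2 * ι t * (X t - ι 2) + (U - (1ℚ + ι 2 * ι t)) * (X t - ι 2)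

      0≤U-1-2t : 0ℚ ≤ U - (1ℚ + ι 2 * ι t)
      0≤U-1-2t = subst (λ x → 0ℚ ≤ U - x) (trans (ι-suc (2 ℕ.* t)) (cong (λ z → 1ℚ + z) (ι-* 2 t)))
        (0≤q-p (ι-mono-≤ (1+2t≤2^t 3≤t)))
      0≤X-2 : 0ℚ ≤ X t - ι 2
      0≤X-2 = 0≤q-p (2≤X t n<2t)
      0≤t-3 : 0ℚ ≤ ι t - ι 3
      0≤t-3 = 0≤q-p (ι-mono-≤ 3≤t)
      0≤r : 0ℚ ≤ r
      0≤r = +-nonneg (+-nonneg (*-nonneg (0≤p (ι 2)) 0≤U-1-2t)
                               (*-nonneg (*-nonneg (0≤p (ι 2)) (0≤ι t)) 0≤X-2))
                     (*-nonneg 0≤U-1-2t 0≤X-2)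
      1<2 : 1ℚ < ι 2
      1<2 = toWitness {a? = 1ℚ ℚ.<? ι 2} _

    -- Out of range the exponential term dominates: by `0≤r`, `Y t` is at least `X t` + 4t. Such a
    -- `t` thus satisfies the condition and cannot be the predecessor of the smallest solution.
    x₁<2 : x₁ t < ι 2
    x₁<2 = ℚ.≤-<-trans
      (≤-by
        (ι 3 + ι 2 * (ι t - ι 3) + r + (m - ι 3) * ((+ 1 / 6) * (ι 8 + (X t - ι 2) + ι 4 * (ι t - ι 3) + r)))
        (+-nonneg (+-nonneg (+-nonneg (0≤p (ι 3)) (*-nonneg (0≤p (ι 2)) 0≤t-3)) 0≤r)
          (*-nonneg 0≤m-3 (*-nonneg (0≤p (+ 1 / 6))
            (+-nonneg (+-nonneg (+-nonneg (0≤p (ι 8)) 0≤X-2) (*-nonneg (0≤p (ι 4)) 0≤t-3)) 0≤r))))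
        (trans (cong (λ y → ι 2 * ι t + m + 1ℚ + X t - (m * (+ 1 / 3) + 1ℚ) * (½ * y)
                 + (ι 3 + ι 2 * (ι t - ι 3) + r + (m - ι 3) * ((+ 1 / 6) * (ι 8 + (X t - ι 2) + ι 4 * (ι t - ι 3) + r))))
                 (Y≡2^p*X t))
          (lem m (ι t) (X t) U)))
      1<2
      where
      lem : ∀ m t x u →
        let r = ι 2 * (u - (1ℚ + ι 2 * t)) + ι 2 * t * (x - ι 2) + (u - (1ℚ + ι 2 * t)) * (x - ι 2) in
        ι 2 * t + m + 1ℚ + x - (m * (+ 1 / 3) + 1ℚ) * (½ * (u * x))
          + (ι 3 + ι 2 * (t - ι 3) + r + (m - ι 3) * ((+ 1 / 6) * (ι 8 + (x - ι 2) + ι 4 * (t - ι 3) + r))) ≡ 1ℚ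
      lem = solveℚ 4 (λ m t x u →
        let r = con (ι 2) :* (u :- (con 1ℚ :+ con (ι 2) :* t)) :+ con (ι 2) :* t :* (x :- con (ι 2))
                :+ (u :- (con 1ℚ :+ con (ι 2) :* t)) :* (x :- con (ι 2)) in
        con (ι 2) :* t :+ m :+ con 1ℚ :+ x :- (m :* con (+ 1 / 3) :+ con 1ℚ) :* (con ½ :* (u :* x))
          :+ (con (ι 3) :+ con (ι 2) :* (t :- con (ι 3)) :+ r
              :+ (m :- con (ι 3)) :* (con (+ 1 / 6) :* (con (ι 8) :+ (x :- con (ι 2)) :+ con (ι 4) :* (t :- con (ι 3)) :+ r)))
        := con 1ℚ) refl

    x₂<2 : x₂ t < ι 2
    x₂<2 = ℚ.≤-<-trans
      (≤-by
        (ι 28 + ι 10 * (ι t - ι 3) + (X t - ι 2) + ι 3 * r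
          + (m - ι 3) * (½ * (ι 12 + (X t - ι 2) + ι 4 * (ι t - ι 3) + r)))
        (+-nonneg (+-nonneg (+-nonneg (+-nonneg (0≤p (ι 28)) (*-nonneg (0≤p (ι 10)) 0≤t-3)) 0≤X-2)
                            (*-nonneg (0≤p (ι 3)) 0≤r))
          (*-nonneg 0≤m-3 (*-nonneg (0≤p ½)
            (+-nonneg (+-nonneg (+-nonneg (0≤p (ι 12)) 0≤X-2) (*-nonneg (0≤p (ι 4)) 0≤t-3)) 0≤r))))
        (trans (cong (λ y → ι 2 * ι t + m + ι 2 + ι 2 * X t - (m + ι 3) * (½ * y)
                 + (ι 28 + ι 10 * (ι t - ι 3) + (X t - ι 2) + ι 3 * r
                   + (m - ι 3) * (½ * (ι 12 + (X t - ι 2) + ι 4 * (ι t - ι 3) + r))))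
                 (Y≡2^p*X t))
          (lem m (ι t) (X t) U)))
      1<2
      where
      lem : ∀ m t x u →
        let r = ι 2 * (u - (1ℚ + ι 2 * t)) + ι 2 * t * (x - ι 2) + (u - (1ℚ + ι 2 * t)) * (x - ι 2) in
        ι 2 * t + m + ι 2 + ι 2 * x - (m + ι 3) * (½ * (u * x))
          + (ι 28 + ι 10 * (t - ι 3) + (x - ι 2) + ι 3 * r
            + (m - ι 3) * (½ * (ι 12 + (x - ι 2) + ι 4 * (t - ι 3) + r))) ≡ 1ℚ
      lem = solveℚ 4 (λ m t x u →
        let r = con (ι 2) :* (u :- (con 1ℚ :+ con (ι 2) :* t)) :+ con (ι 2) :* t :* (x :- con (ι 2))
                :+ (u :- (con 1ℚ :+ con (ι 2) :* t)) :* (x :- con (ι 2)) in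
        con (ι 2) :* t :+ m :+ con (ι 2) :+ con (ι 2) :* x :- (m :+ con (ι 3)) :* (con ½ :* (u :* x))
          :+ (con (ι 28) :+ con (ι 10) :* (t :- con (ι 3)) :+ (x :- con (ι 2)) :+ con (ι 3) :* r
              :+ (m :- con (ι 3)) :* (con ½ :* (con (ι 12) :+ (x :- con (ι 2)) :+ con (ι 4) :* (t :- con (ι 3)) :+ r)))
        := con 1ℚ) refl

argmax : (f : ℕ → ℚ) (b : ℕ) → ∃[ k ] k ℕ.≤ b × (∀ j → j ℕ.≤ b → f j ≤ f k)
argmax f zero    = 0 , z≤n , λ { .0 z≤n → ℚ.≤-refl }
argmax f (suc b) with argmax f b
... | k , k≤b , max with ℚ.≤-total (f k) (f (suc b))
...   | inj₁ fk≤fb = suc b , ℕ.≤-refl , λ j j≤1+b → [ (λ j<1+b → ℚ.≤-trans (max j (s≤s⁻¹ j<1+b)) fk≤fb)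
                                                      , (λ { refl → ℚ.≤-refl }) ]′ (ℕ.m≤n⇒m<n∨m≡n j≤1+b)
...   | inj₂ fb≤fk = k , ℕ.m≤n⇒m≤1+n k≤b , λ j j≤1+b → [ (λ j<1+b → max j (s≤s⁻¹ j<1+b))
                                                      , (λ { refl → fb≤fk }) ]′ (ℕ.m≤n⇒m<n∨m≡n j≤1+b)

parity : ∀ k → ∃[ q ] (k ≡ 2 ℕ.* q ⊎ suc k ≡ 2 ℕ.* q)
parity zero    = 0 , inj₁ refl
parity (suc k) with parity k
... | q , inj₁ k≡2q   = suc q , inj₂ (trans (cong (suc ∘ suc) k≡2q) (sym (ℕ.*-suc 2 q)))
... | q , inj₂ 1+k≡2q = q , inj₁ 1+k≡2q

predecessor-fails : ∀ {P : ℕ → Set} {s} → IsSmallest P (suc s) → ¬ P s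
predecessor-fails (_ , least) Ps = ℕ.<-irrefl refl (least _ Ps)

-- Domination by the four candidates

module Candidates (h n : ℕ) (1≤h : 1 ℕ.≤ h) (5≤n : 5 ℕ.≤ n) where
  open Parity h n 1≤h
  open Exponents n
  private m = 2 ℕ.+ h

  module _ (s : ℕ) (1≤s : 1 ℕ.≤ s) where

    private
      3≤s : n ℕ.< 2 ℕ.* s → 3 ℕ.≤ s
      3≤s n<2s = ℕ.*-cancelˡ-< 2 2 s (ℕ.≤-<-trans (ℕ.≤-trans (ℕ.n≤1+n 4) 5≤n) n<2s)

    -- The formula for a(k) makes sense beyond n, so unimodality is used without an upper limit. A
    -- candidate below or at `q` inherits the bound n from `q`; only the candidate `s` with `q ≤ s`
    -- needs `in-range`.
    odd-maximum : IsSmallest (Condition₁ m n) (suc s) → ∀ q → 2 ℕ.≤ q → 2 ℕ.* q ∸ 1 ℕ.≤ n →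
      (2 ℕ.* suc s ∸ 1 ℕ.≤ n × odd q ≤ odd (suc s)) ⊎ (2 ℕ.≤ s × 2 ℕ.* s ∸ 1 ℕ.≤ n × odd q ≤ odd s)
    odd-maximum smallest@((_ , x<2/ln2) , _) q 2≤q k≤n =
      [ (λ (s<q , f≤f) → inj₁ (ℕ.≤-trans (ℕ.∸-monoˡ-≤ 1 (ℕ.*-monoʳ-≤ 2 s<q)) k≤n , f≤f))
      , (λ (q≤s , f≤f) → inj₂ (ℕ.≤-trans 2≤q q≤s , in-range (2 ℕ.* s ∸ 1 ℕ.≤? n) , f≤f)) ]′
      (maximum q (ℕ.<⇒≤ 2≤q))
      where
      -- Here `s` exceeds 1, so it fails the condition by the inequality and not by `1 < p`.
      0≤E-before : ∀ t → s ≡ suc t → 1 ℕ.≤ t → 0ℚ ≤ E₁ t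
      0≤E-before t refl 1≤t = 2≤x₁⇒0≤E₁ t 1≤t (≮2/ln2⇒2≤ λ x< →
        predecessor-fails smallest (s≤s 1≤t , subst _<2/ln2 (sym (condition₁-lhs s)) x<))
      open Unimodal odd E₁ (λ p → ι 3 * ½ * w p) odd-suc (λ p → *-nonneg (0≤p (ι 3 * ½)) (0≤w p)) E₁-up E₁-down
        s 1≤s (x₁≤4⇒E₁≤0 (suc s) (s≤s z≤n) (<2/ln2⇒≤4 (subst _<2/ln2 (condition₁-lhs (suc s)) x<2/ln2)))
        0≤E-before
      -- Were `s` out of range, it would be at least 3 and satisfy the condition, against the
      -- minimality of `suc s`.
      in-range : Dec (2 ℕ.* s ∸ 1 ℕ.≤ n) → 2 ℕ.* s ∸ 1 ℕ.≤ n
      in-range (yes ≤n) = ≤n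
      in-range (no  ≰n) = contradiction
        (ℕ.<⇒≤ (3≤s n<2s) , subst _<2/ln2 (sym (condition₁-lhs s)) (<2⇒<2/ln2 (x₁<2 s (3≤s n<2s) n<2s)))
        (predecessor-fails smallest)
        where
        n<2s : n ℕ.< 2 ℕ.* s
        n<2s = ℕ.<-≤-trans (ℕ.≰⇒> ≰n) (ℕ.m∸n≤m (2 ℕ.* s) 1)

    even-maximum : IsSmallest (Condition₂ m n) (suc s) → ∀ q → 1 ℕ.≤ q → 2 ℕ.* q ℕ.≤ n →
      (2 ℕ.* suc s ℕ.≤ n × even q ≤ even (suc s)) ⊎ (2 ℕ.* s ℕ.≤ n × even q ≤ even s)
    even-maximum smallest@((_ , x<2/ln2) , _) q 1≤q k≤n =
      [ (λ (s<q , f≤f) → inj₁ (ℕ.≤-trans (ℕ.*-monoʳ-≤ 2 s<q) k≤n , f≤f))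
      , (λ (q≤s , f≤f) → inj₂ (in-range (2 ℕ.* s ℕ.≤? n) , f≤f)) ]′
      (maximum q 1≤q)
      where
      0≤E-before : ∀ t → s ≡ suc t → 1 ℕ.≤ t → 0ℚ ≤ E₂ t
      0≤E-before t refl 1≤t = 2≤x₂⇒0≤E₂ t 1≤t (≮2/ln2⇒2≤ λ x< →
        predecessor-fails smallest (s≤s 1≤t , subst _<2/ln2 (sym (condition₂-lhs s)) x<))
      open Unimodal even E₂ w even-suc 0≤w E₂-up E₂-down
        s 1≤s (x₂≤4⇒E₂≤0 (suc s) (s≤s z≤n) (<2/ln2⇒≤4 (subst _<2/ln2 (condition₂-lhs (suc s)) x<2/ln2)))
        0≤E-before
      in-range : Dec (2 ℕ.* s ℕ.≤ n) → 2 ℕ.* s ℕ.≤ n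
      in-range (yes ≤n) = ≤n
      in-range (no  ≰n) = contradiction
        (ℕ.<⇒≤ (3≤s n<2s) , subst _<2/ln2 (sym (condition₂-lhs s)) (<2⇒<2/ln2 (x₂<2 s (3≤s n<2s) n<2s)))
        (predecessor-fails smallest)
        where
        n<2s : n ℕ.< 2 ℕ.* s
        n<2s = ℕ.≰⇒> ≰n

  Dominated : (p₁ p₂ k : ℕ) → Set
  Dominated p₁ p₂ k = ∃[ k′ ]
    k′ ∈ (2 ℕ.* p₁ ∸ 1) ∷ (2 ℕ.* p₁ ∸ 3) ∷ (2 ℕ.* p₂) ∷ (2 ℕ.* p₂ ∸ 2) ∷ []
    × 2 ℕ.≤ k′ × k′ ℕ.≤ n × hubLink h n k ≤ hubLink h n k′

  dominated : (p₁ p₂ : ℕ) → IsSmallest (Condition₁ m n) p₁ → IsSmallest (Condition₂ m n) p₂ →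
    ∀ k → 2 ℕ.≤ k → k ℕ.≤ n → Dominated p₁ p₂ k
  dominated zero _ ((() , _) , _) _
  dominated (suc _) zero _ ((() , _) , _)
  dominated (suc s₁) (suc s₂) smallest₁@((s≤s 1≤s₁ , _) , _) smallest₂@((s≤s 1≤s₂ , _) , _) k 2≤k k≤n =
    by-parity (parity k)
    where
    on-even : ∀ q → k ≡ 2 ℕ.* q → Dominated (suc s₁) (suc s₂) k
    on-even q k≡2q =
      [ (λ (k′≤n , f≤f) → 2 ℕ.* suc s₂ , there (there (here refl)) , ℕ.*-monoʳ-≤ 2 {1} (s≤s z≤n)
                        , k′≤n , subst (λ j → hubLink h n j ≤ even (suc s₂)) (sym k≡2q) f≤f)
      , (λ (k′≤n , f≤f) → 2 ℕ.* s₂ , there (there (there (here (sym (cong (_∸ 2) (ℕ.*-suc 2 s₂))))))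
                        , ℕ.*-monoʳ-≤ 2 1≤s₂
                        , k′≤n , subst (λ j → hubLink h n j ≤ even s₂) (sym k≡2q) f≤f) ]′
      (even-maximum s₂ 1≤s₂ smallest₂ q (ℕ.*-cancelˡ-≤ 2 (subst (2 ℕ.≤_) k≡2q 2≤k)) (subst (ℕ._≤ n) k≡2q k≤n))

    on-odd : ∀ q → suc k ≡ 2 ℕ.* q → Dominated (suc s₁) (suc s₂) k
    on-odd q 1+k≡2q =
      [ (λ (k′≤n , f≤f) → 2 ℕ.* suc s₁ ∸ 1 , here refl
                        , ℕ.∸-monoˡ-≤ 1 (ℕ.≤-trans (ℕ.n≤1+n 3) (ℕ.*-monoʳ-≤ 2 {2} (s≤s 1≤s₁)))
                        , k′≤n , subst (λ j → hubLink h n j ≤ odd (suc s₁)) (sym k≡2q-1) f≤f)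
      , (λ (2≤s , k′≤n , f≤f) → 2 ℕ.* s₁ ∸ 1 , there (here (sym (cong (_∸ 3) (ℕ.*-suc 2 s₁))))
                        , ℕ.∸-monoˡ-≤ 1 (ℕ.≤-trans (ℕ.n≤1+n 3) (ℕ.*-monoʳ-≤ 2 {2} 2≤s))
                        , k′≤n , subst (λ j → hubLink h n j ≤ odd s₁) (sym k≡2q-1) f≤f) ]′
      (odd-maximum s₁ 1≤s₁ smallest₁ q (ℕ.*-cancelˡ-< 2 1 q (subst (2 ℕ.<_) 1+k≡2q (s≤s 2≤k)))
        (subst (ℕ._≤ n) k≡2q-1 k≤n))
      where
      k≡2q-1 : k ≡ 2 ℕ.* q ∸ 1
      k≡2q-1 = cong (_∸ 1) 1+k≡2q

    by-parity : ∃[ q ] (k ≡ 2 ℕ.* q ⊎ suc k ≡ 2 ℕ.* q) → Dominated (suc s₁) (suc s₂) k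
    by-parity (q , inj₁ k≡2q)   = on-even q k≡2q
    by-parity (q , inj₂ 1+k≡2q) = on-odd q 1+k≡2q

argmax-2 : (f : ℕ → ℚ) (n : ℕ) → 2 ℕ.≤ n →
  ∃[ k ] 2 ℕ.≤ k × k ℕ.≤ n × (∀ i → 2 ℕ.≤ i → i ℕ.≤ n → f i ≤ f k)
argmax-2 f (suc zero) (s≤s ())
argmax-2 f (suc (suc b)) _ with j , j≤b , max ← argmax (f ∘ suc ∘ suc) b =
  suc (suc j) , s≤s (s≤s z≤n) , s≤s (s≤s j≤b) , λ where
    (suc (suc i)) _ (s≤s (s≤s i≤b)) → max i i≤b
    (suc zero) (s≤s ())

module _ (h n : ℕ) (1≤h : 1 ℕ.≤ h) (5≤n : 5 ℕ.≤ n) (p₁ p₂ : ℕ) where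
  private m = 2 ℕ.+ h

  open Candidates h n 1≤h 5≤n using (Dominated; dominated)

  candidate-maximum : ∀ k → k ∈ (2 ℕ.* p₁ ∸ 1) ∷ (2 ℕ.* p₁ ∸ 3) ∷ (2 ℕ.* p₂) ∷ (2 ℕ.* p₂ ∸ 2) ∷ [] →
    2 ℕ.≤ k → k ℕ.≤ n → (∀ i → 2 ℕ.≤ i → i ℕ.≤ n → hubLink h n i ≤ hubLink h n k) →
    IsMaximum (Candidate m n p₁ p₂) (hubLink h n k)
  candidate-maximum k k∈ 2≤k k≤n largest = (k , k∈ , 2≤k , k≤n , hubLink≡a h n k) , upper
    where
    upper : ∀ y → Candidate m n p₁ p₂ y → y ≤ hubLink h n k
    upper y (i , _ , 2≤i , i≤n , y≡) = ℚ.≤-trans (ℚ.≤-reflexive (trans y≡ (sym (hubLink≡a h n i)))) (largest i 2≤i i≤n)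

  closeness-maximum : ∀ k → 2 ℕ.≤ k → k ℕ.≤ n → (∀ i → 2 ℕ.≤ i → i ℕ.≤ n → hubLink h n i ≤ hubLink h n k) →
    IsAdditionalCloseness (lollipop m n) (hubLink h n k)
  closeness-maximum k 2≤k k≤n largest = additional h n (attained-a h n k 2≤k k≤n) λ shape →
    let (i , 2≤i , i≤n , y≤) = bound-5 h n 1≤h 5≤n shape in ℚ.≤-trans y≤ (largest i 2≤i i≤n)

  -- A best k in the finite range 2, ..., n is dominated by a candidate in that range, which is then
  -- itself a best k. So one number is the maximum over the candidates and over all links.
  additional-≥5 : IsSmallest (Condition₁ m n) p₁ → IsSmallest (Condition₂ m n) p₂ →
    ∃[ x ] IsMaximum (Candidate m n p₁ p₂) x × IsAdditionalCloseness (lollipop m n) x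
  additional-≥5 smallest₁ smallest₂ = from-best (argmax-2 (hubLink h n) n (ℕ.≤-trans (s≤s (s≤s z≤n)) 5≤n))
    where
    from-best : ∃[ k ] 2 ℕ.≤ k × k ℕ.≤ n × (∀ i → 2 ℕ.≤ i → i ℕ.≤ n → hubLink h n i ≤ hubLink h n k) →
      ∃[ x ] IsMaximum (Candidate m n p₁ p₂) x × IsAdditionalCloseness (lollipop m n) x
    from-best (j , 2≤j , j≤n , best) = from-candidate (dominated p₁ p₂ smallest₁ smallest₂ j 2≤j j≤n)
      where
      from-candidate : Dominated p₁ p₂ j →
        ∃[ x ] IsMaximum (Candidate m n p₁ p₂) x × IsAdditionalCloseness (lollipop m n) x
      from-candidate (k , k∈ , 2≤k , k≤n , best≤k) =
        hubLink h n k , candidate-maximum k k∈ 2≤k k≤n largest , closeness-maximum k 2≤k k≤n largest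
        where
        largest : ∀ i → 2 ℕ.≤ i → i ℕ.≤ n → hubLink h n i ≤ hubLink h n k
        largest i 2≤i i≤n = ℚ.≤-trans (best i 2≤i i≤n) best≤k

theorem4 : (m : ℕ) → 3 ℕ.≤ m →
      IsAdditionalCloseness (lollipop m 1) (ι m * ι m * ½ + 1ℚ)
    × IsAdditionalCloseness (lollipop m 2) (ι m * (ι m + 1ℚ) * ½ + ι 2)
    × IsAdditionalCloseness (lollipop m 3) (ι m * (ι 2 * ι m + ι 3) * (+ 1 / 4) + ι 4)
    × IsAdditionalCloseness (lollipop m 4) (ι m * (ι m + ι 2) * ½ + ι 6)
    × ((n : ℕ) → 5 ℕ.≤ n →
          ((k : ℕ) → 2 ℕ.≤ k → k ℕ.≤ n →
           (p q : Fin (m ℕ.+ n)) (p≢q : p ≢ q) → label p ≡ m → label q ≡ m ℕ.+ k →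
           closeness (addLink (lollipop m n) p q p≢q) ≡ a m n k)
        × ((p₁ p₂ : ℕ) → IsSmallest (Condition₁ m n) p₁ → IsSmallest (Condition₂ m n) p₂ →
           ∃[ x ] IsMaximum (Candidate m n p₁ p₂) x × IsAdditionalCloseness (lollipop m n) x))
theorem4 (suc (suc h)) (s≤s (s≤s 1≤h)) =
    Small.additional-1 h 1≤h
  , Small.additional-2 h 1≤h
  , Small.additional-3 h 1≤h
  , Small.additional-4 h 1≤h
  , λ n 5≤n →
      (λ k 2≤k k≤n p q p≢q p≡m q≡m+k → trans (closeness-a h n k 2≤k k≤n p q p≢q p≡m q≡m+k) (hubLink≡a h n k))
    , additional-≥5 h n 1≤h 5≤n
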